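{- Let $\Gamma\in\mathscr G_3$ have coherent rank $9$. Then the coherent closure $\mathcal W(\Gamma)$ has type $\begin{bmatrix}2&2\\ &3\end{bmatrix}$.
   Context: All graphs are finite, undirected and simple; the eigenvalues of a graph are those of its adjacency matrix $A(\Gamma)$. $\mathscr G_3$ denotes the set of all connected graphs having precisely three distinct eigenvalues. A coherent algebra on a finite set $X$ is a matrix algebra $\mathcal A\subset \operatorname{Mat}_X(\mathbb C)$ that contains the identity matrix $I$ and the all-ones matrix $J$, and is closed under transposition, ordinary matrix multiplication and entrywise multiplication. Each coherent algebra has a unique linear basis $\{A_1,\dots,A_r\}$ consisting of $\{0,1\}$-matrices with $\sum_i A_i=J$; the number $r$ is the rank of $\mathcal A$. Some of the $A_i$ are diagonal and sum to $I$; the supports (in $X$) of these diagonal basis matrices are the fibres $X_1,\dots,X_f$, which partition $X$. Each $A_k$ is supported in a single block $X_i\times X_j$. The type of $\mathcal A$ is the symmetric matrix $(t_{ij})$ where $t_{ij}$ is the number of basis matrices supported in $X_i\times X_j$; it is taken up to reordering the fibres, and entries below the diagonal are omitted. The coherent closure $\mathcal W(\Gamma)$ of $\Gamma$ is the smallest coherent algebra containing $A(\Gamma)$, and the coherent rank of $\Gamma$ is the rank of $\mathcal W(\Gamma)$ (the sum of all entries of its type matrix). -}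

module Defs where

open import Algebra.Apartness.Bundles using (HeytingField; HeytingCommutativeRing)
open import Algebra.Bundles using (CommutativeRing; Semiring)
import Algebra.Definitions.RawSemiring as RawSemiringDefs
open import Data.Bool.Base using (Bool; true; false; T; if_then_else_)
open import Data.Bool.Properties using (_≟_)
open import Data.Fin.Base using (Fin; toℕ)
open import Data.Fin.Properties using (all?) renaming (_≟_ to _≟ᶠ_)
open import Data.List.Base using (length; filter; allFin)
open import Data.Nat.Base using (ℕ; suc)
open import Data.Product.Base using (Σ; ∃-syntax; _×_)
open import Data.Vec.Base using (Vec; lookup)
open import Level using (Level; _⊔_)
open import Relation.Binary.Construct.Closure.ReflexiveTransitive using (Star)
open import Relation.Binary.PropositionalEquality.Core using (_≡_; _≢_)
open import Relation.Nullary.Decidable using (Dec; ⌊_⌋; _×-dec_; _→-dec_)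

record Graph (n : ℕ) : Set where
  field
    adj      : Fin n → Fin n → Bool
    adj-sym  : ∀ x y → adj x y ≡ adj y x
    loopless : ∀ x → adj x x ≡ false

Connected : ∀ {n} → Graph n → Set
Connected {n} Γ = ∀ (x y : Fin n) → Star (λ u v → T (Graph.adj Γ u v)) x y

-- {0,1}-matrices are given by their supports.

BoolMatrix : ℕ → Set
BoolMatrix n = Fin n → Fin n → Bool

Diagonal : ∀ {n} → BoolMatrix n → Set
Diagonal {n} B = ∀ (x y : Fin n) → B x y ≡ true → x ≡ y

-- The fibres of a family of {0,1}-matrices: an enumeration, without
-- repetition, of its diagonal members.  The fibre X i is the support of
-- the i-th of them.

record Fibres {n r : ℕ} (B : Fin r → BoolMatrix n) (f : ℕ) : Set where
  field
    index      : Fin f → Fin r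
    injective  : ∀ {i j} → index i ≡ index j → i ≡ j
    diagonal   : ∀ i → Diagonal (B (index i))
    exhaustive : ∀ k → Diagonal (B k) → ∃[ i ] index i ≡ k

  _∈X_ : Fin n → Fin f → Set
  x ∈X i = B (index i) x x ≡ true

  SupportedIn : Fin f → Fin f → Fin r → Set
  SupportedIn i j k = ∀ x y → B k x y ≡ true → x ∈X i × y ∈X j

  supportedIn? : ∀ i j k → Dec (SupportedIn i j k)
  supportedIn? i j k = all? λ x → all? λ y →
    (B k x y ≟ true) →-dec
    ((B (index i) x x ≟ true) ×-dec (B (index j) y y ≟ true))

  t : Fin f → Fin f → ℕ
  t i j = length (filter (supportedIn? i j) (allFin r))

-- The library has no ℂ.  The scalars are an arbitrary algebraically closed
-- field of characteristic zero, of which ℂ is an instance; a Heyting field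
-- is asked for, rather than a field with decidable equality, so that the
-- constructive complex numbers are an instance as well.

module _ {c ℓ₁ ℓ₂ : Level} (K : HeytingField c ℓ₁ ℓ₂) where

  open HeytingField K
  open CommutativeRing
    (HeytingCommutativeRing.commutativeRing heytingCommutativeRing)
    using (semiring)
  open RawSemiringDefs (Semiring.rawSemiring semiring) using (sum; _^_) renaming (_×_ to _·_)

  AlgebraicallyClosed : Set (c ⊔ ℓ₁)
  AlgebraicallyClosed = ∀ d (a : Fin (suc d) → Carrier) →
    ∃[ z ] z ^ suc d + sum (λ i → a i * z ^ toℕ i) ≈ 0#

  CharacteristicZero : Set ℓ₂
  CharacteristicZero = ∀ m → (suc m · 1#) # 0#

  Matrix : ℕ → Set c
  Matrix n = Fin n → Fin n → Carrier

  𝟙 : Bool → Carrier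
  𝟙 b = if b then 1# else 0#

  ⟦_⟧ : ∀ {n} → BoolMatrix n → Matrix n
  ⟦ B ⟧ x y = 𝟙 (B x y)

  module _ {n : ℕ} where

    infix 4 _≋_
    _≋_ : Matrix n → Matrix n → Set ℓ₁
    M ≋ N = ∀ x y → M x y ≈ N x y

    I J : Matrix n
    I x y = 𝟙 ⌊ x ≟ᶠ y ⌋
    J x y = 1#

    infixl 6 _⊞_
    infixr 7 _⊡_
    infixl 7 _⊠_ _⊙_
    infix  8 _ᵀ

    _ᵀ : Matrix n → Matrix n
    (M ᵀ) x y = M y x

    _⊞_ _⊠_ _⊙_ : Matrix n → Matrix n → Matrix n
    (M ⊞ N) x y = M x y + N x y
    (M ⊠ N) x y = sum λ z → M x z * N z y
    (M ⊙ N) x y = M x y * N x y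

    _⊡_ : Carrier → Matrix n → Matrix n
    (a ⊡ M) x y = a * M x y

    IsEigenvalue : Matrix n → Carrier → Set (c ⊔ ℓ₁ ⊔ ℓ₂)
    IsEigenvalue M θ = Σ (Fin n → Carrier) λ v →
      (∃[ x ] v x # 0#) × (∀ x → sum (λ y → M x y * v y) ≈ θ * v x)

    record ExactlyDistinctEigenvalues (m : ℕ) (M : Matrix n) : Set (c ⊔ ℓ₁ ⊔ ℓ₂) where
      field
        θ          : Fin m → Carrier
        distinct   : ∀ i j → i ≢ j → θ i # θ j
        eigenvalue : ∀ i → IsEigenvalue M (θ i)
        exhaustive : ∀ μ → IsEigenvalue M μ → ∃[ i ] μ ≈ θ i

    record IsCoherentAlgebra {p} (𝒜 : Matrix n → Set p) : Set (c ⊔ ℓ₁ ⊔ p) where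
      field
        resp : ∀ {M N} → M ≋ N → 𝒜 M → 𝒜 N
        I∈   : 𝒜 I
        J∈   : 𝒜 J
        ⊞∈   : ∀ {M N} → 𝒜 M → 𝒜 N → 𝒜 (M ⊞ N)
        ⊡∈   : ∀ a {M} → 𝒜 M → 𝒜 (a ⊡ M)
        ⊠∈   : ∀ {M N} → 𝒜 M → 𝒜 N → 𝒜 (M ⊠ N)
        ⊙∈   : ∀ {M N} → 𝒜 M → 𝒜 N → 𝒜 (M ⊙ N)
        ᵀ∈   : ∀ {M} → 𝒜 M → 𝒜 (M ᵀ)

    record StandardBasis {p} (𝒜 : Matrix n → Set p) (r : ℕ) : Set (c ⊔ ℓ₁ ⊔ p) where
      field
        B           : Fin r → BoolMatrix n
        member      : ∀ k → 𝒜 ⟦ B k ⟧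
        spanning    : ∀ {M} → 𝒜 M →
                      Σ (Fin r → Carrier) λ a →
                        ∀ x y → M x y ≈ sum (λ k → a k * ⟦ B k ⟧ x y)
        independent : ∀ (a : Fin r → Carrier) →
                      (∀ x y → sum (λ k → a k * ⟦ B k ⟧ x y) ≈ 0#) →
                      ∀ k → a k ≈ 0#
        sum-is-J    : ∀ x y → sum (λ k → ⟦ B k ⟧ x y) ≈ J x y

    -- Types are taken up to reordering the fibres, hence the existential
    -- quantifier over enumerations of the fibres.

    HasType : ∀ {p} → (Matrix n → Set p) → ∀ {f} → Vec (Vec ℕ f) f → Set (c ⊔ ℓ₁ ⊔ p)
    HasType 𝒜 {f} τ =
      ∃[ r ] Σ (StandardBasis 𝒜 r) λ S →
      Σ (Fibres (StandardBasis.B S) f) λ F →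
        ∀ i j → Fibres.t F i j ≡ lookup (lookup τ i) j

    -- The smallest coherent algebra containing A: see Closure-isCoherent
    -- and Closure-least.

    data Closure (A : Matrix n) : Matrix n → Set (c ⊔ ℓ₁) where
      gen  : Closure A A
      resp : ∀ {M N} → M ≋ N → Closure A M → Closure A N
      I∈   : Closure A I
      J∈   : Closure A J
      ⊞∈   : ∀ {M N} → Closure A M → Closure A N → Closure A (M ⊞ N)
      ⊡∈   : ∀ a {M} → Closure A M → Closure A (a ⊡ M)
      ⊠∈   : ∀ {M N} → Closure A M → Closure A N → Closure A (M ⊠ N)
      ⊙∈   : ∀ {M N} → Closure A M → Closure A N → Closure A (M ⊙ N)
      ᵀ∈   : ∀ {M} → Closure A M → Closure A (M ᵀ)

    Closure-isCoherent : ∀ A → IsCoherentAlgebra (Closure A)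
    Closure-isCoherent A = record
      { resp = resp ; I∈ = I∈ ; J∈ = J∈ ; ⊞∈ = ⊞∈ ; ⊡∈ = ⊡∈
      ; ⊠∈ = ⊠∈ ; ⊙∈ = ⊙∈ ; ᵀ∈ = ᵀ∈ }

    Closure-least : ∀ {p} {A : Matrix n} {𝒜 : Matrix n → Set p} →
      IsCoherentAlgebra 𝒜 → 𝒜 A → ∀ {M} → Closure A M → 𝒜 M
    Closure-least {A = A} {𝒜} coh A∈ = go
      where
      module C = IsCoherentAlgebra coh
      go : ∀ {M} → Closure A M → 𝒜 M
      go gen        = A∈
      go (resp e m) = C.resp e (go m)
      go I∈         = C.I∈
      go J∈         = C.J∈
      go (⊞∈ m m′)  = C.⊞∈ (go m) (go m′)
      go (⊡∈ a m)   = C.⊡∈ a (go m)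
      go (⊠∈ m m′)  = C.⊠∈ (go m) (go m′)
      go (⊙∈ m m′)  = C.⊙∈ (go m) (go m′)
      go (ᵀ∈ m)     = C.ᵀ∈ (go m)

    adjacency : Graph n → Matrix n
    adjacency Γ = ⟦ Graph.adj Γ ⟧

    𝒢₃ : Graph n → Set (c ⊔ ℓ₁ ⊔ ℓ₂)
    𝒢₃ Γ = Connected Γ × ExactlyDistinctEigenvalues 3 (adjacency Γ)

    𝒲 : Graph n → Matrix n → Set (c ⊔ ℓ₁)
    𝒲 Γ = Closure (adjacency Γ)

    HasCoherentRank : Graph n → ℕ → Set (c ⊔ ℓ₁)
    HasCoherentRank Γ r = StandardBasis (𝒲 Γ) r

{-# OPTIONS --safe #-}
module Submission where

-- A graph Γ of coherent rank 9 has at most three fibres, as f fibres give at least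
-- f * f colours.  If there are three, no other colours occur, so the fibres are single
-- points, and Γ is one of the two connected graphs on three points.  With two fibres
-- the type has entries a, m, m, d with a + 2 m + d = 9, and a = 1 or d = 1 forces
-- m = 1; so m = 2 and (a , d) is (2 , 3) or (3 , 2), unless m = 1.  If m = 1, then Γ is
-- the join of two regular graphs.  With one fibre Γ is regular, which is a join with an
-- empty second side, and the connected graphs on three points are joins too.  It
-- remains to show that a graph with three eigenvalues which is a join of two regular
-- sides has coherent rank at most 8 (join-rank).
--
-- Let A be the adjacency matrix within the sides, and V the space of the vectors of
-- coordinate sum 0 that are supported on one side.  Eigenvectors of A in V are
-- eigenvectors of Γ.  One of the three eigenvalues does not occur in V.  If there is one
-- side, this is the valency, since harmonic vectors are constant.  If there are two, with
-- sizes n₁, n₂ and valencies k₁, k₂, then both roots of (z - k₁) (z - k₂) = n₁ n₂ are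
-- eigenvalues of Γ, and of k₁ - z for these roots one is negative, while the Laplacian
-- k₁ - A is positive semidefinite.  So A satisfies a quadratic equation on V
-- (Annihilation.quadratic), the square of A is a combination of I, A and J on each side
-- (Block.relation), and the matrices that are constant on the eight classes "same side:
-- equal, adjacent, neither" and "different sides" form a coherent algebra containing the
-- adjacency matrix of Γ (Coarse.coherent).
--
-- K carries no order, and sums of squares in K may vanish.  Therefore positivity is
-- used for vectors of integers only, where a sum of squares is a natural
-- number, and is carried over to K by descent: inclusions between kernels of commuting
-- symmetric integer matrices hold over K if they hold for vectors of integers.  This
-- gives that positive definite integer matrices are injective over K, and that symmetric
-- integer matrices are semisimple over K (semisimple).  The sign argument above becomes
-- the injectivity of L ⊗ L + n₁ n₂ for the Laplacian L (no-negative-product).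
--
-- Equality in K is stable but not decidable, so the joins are refuted by contradiction;
-- the fibres and the type are computed from the {0,1}-matrices of the basis.

open import Algebra.Apartness.Bundles using (HeytingField; HeytingCommutativeRing)
import Algebra.Apartness.Properties.HeytingCommutativeRing as HeytingProperties
open import Algebra.Bundles using (CommutativeRing; RawRing; Semiring)
import Algebra.Definitions.RawSemiring as RawSemiringDefs
import Algebra.Properties.Ring as RingProperties
import Algebra.Properties.Semiring.Mult as SemiringMult
import Algebra.Properties.Semiring.Sum as SemiringSum
import Algebra.Solver.Ring as RingSolver
open import Algebra.Solver.Ring.AlmostCommutativeRing using (fromCommutativeRing; _-Raw-AlmostCommutative⟶_)
open import Data.Bool.Base using (Bool; true; false; if_then_else_; T; _∧_; not)
open import Data.Bool.Properties using () renaming (_≟_ to _≟ᵇ_)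
open import Data.Empty using (⊥; ⊥-elim)
open import Data.Fin.Base using (Fin; zero; suc; toℕ; _<_; combine; punchIn; punchOut; remQuot; _↑ˡ_; _↑ʳ_)
open import Data.Fin.Patterns using (0F; 1F; 2F; 3F; 4F; 5F; 6F; 7F)
open import Data.Fin.Permutation using (permutation)
open import Data.Fin.Properties using (all?; any?; combine-remQuot; pigeonhole; punchIn-punchOut; remQuot-combine; suc-injective; <⇒≢) renaming (_≟_ to _≟ᶠ_)
open import Data.List.Base using (length; filter; tabulate)
open import Data.Maybe.Base using (Maybe; just; nothing)
open import Data.Nat.Base as ℕ using (ℕ; zero; suc; z≤n; s≤s)
import Data.Nat.Properties as ℕₚ
open import Data.Nat.Solver using (module +-*-Solver)
open import Data.Product.Base using (Σ; ∃-syntax; _×_; _,_; proj₁; proj₂)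
open import Data.Sum.Base using (_⊎_; inj₁; inj₂)
open import Data.Vec.Base using ([]; _∷_)
open import Function.Base using (_∘_; id)
open import Function.Bundles using (mk⇔)
open import Level using (Level; _⊔_)
open import Relation.Binary.Construct.Closure.ReflexiveTransitive using (Star; ε; _◅_; gmap)
open import Relation.Binary.PropositionalEquality.Core as ≡ using (_≡_; _≢_)
import Relation.Binary.Reasoning.Setoid as SetoidReasoning
open import Relation.Nullary using (¬_; Dec; yes; no; does)
open import Relation.Nullary.Decidable using (⌊_⌋; _×-dec_; ¬?; does-⇔)
open import Relation.Unary using (Decidable)
open import Defs

-- The field, and the natural numbers and integers in it

module Field {c ℓ₁ ℓ₂ : Level} (K : HeytingField c ℓ₁ ℓ₂) (char0 : CharacteristicZero K) where

  R : CommutativeRing c ℓ₁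
  R = HeytingCommutativeRing.commutativeRing (HeytingField.heytingCommutativeRing K)

  open CommutativeRing R public hiding (zero)
  open HeytingField K public using (_#_; #⇒invertible; tight)
  open HeytingProperties (HeytingField.heytingCommutativeRing K) public using (x#0y#0→xy#0; #-congʳ; 1#0)
  open SemiringSum semiring public using (sum; sum-cong-≋; ∑-distrib-+; ∑-comm; *-distribˡ-sum; *-distribʳ-sum; sum-replicate-zero)
  open SemiringMult semiring using (×-homo-+; ×1-homo-*) renaming (_×_ to _·_)
  open RingProperties ring using (-0#≈0#; -‿involutive)

  -- The image of a natural number in K.
  nat : ℕ → Carrier
  nat m = m · 1#

  nat-+ : ∀ m n → nat (m ℕ.+ n) ≈ nat m + nat n
  nat-+ = ×-homo-+ 1#

  nat-* : ∀ m n → nat (m ℕ.* n) ≈ nat m * nat n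
  nat-* = ×1-homo-*

  -- A ring solver for K.  K has no decidable equality, so the coefficients are
  -- integers, represented as formal differences of natural numbers; they are kept
  -- reduced, so that equal constants are equal terms.

  private
    module Semi where
      open import Algebra.Solver.Ring.NaturalCoefficients.Default commutativeSemiring public

    cancelled : ℕ × ℕ → ℕ × ℕ
    cancelled (suc a , suc b) = cancelled (a , b)
    cancelled d               = d

    _+ᵈ_ _*ᵈ_ : ℕ × ℕ → ℕ × ℕ → ℕ × ℕ
    (a , b) +ᵈ (c , d) = a ℕ.+ c , b ℕ.+ d
    (a , b) *ᵈ (c , d) = a ℕ.* c ℕ.+ b ℕ.* d , a ℕ.* d ℕ.+ b ℕ.* c

    -ᵈ_ : ℕ × ℕ → ℕ × ℕ
    -ᵈ (a , b) = b , a

    C : RawRing _ _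
    C = record
      { Carrier = ℕ × ℕ
      ; _≈_ = _≡_
      ; _+_ = λ x y → cancelled (x +ᵈ y)
      ; _*_ = λ x y → cancelled (x *ᵈ y)
      ; -_ = -ᵈ_
      ; 0# = 0 , 0
      ; 1# = 1 , 0
      }

  difference : ℕ × ℕ → Carrier
  difference (a , b) = nat a - nat b

  private
    -- a + d ≈ c + b gives a - b ≈ c - d
    move : ∀ {a b c d} → a + d ≈ c + b → a - b ≈ c - d
    move {a} {b} {c} {d} e = begin
      a - b                        ≈⟨ +-identityʳ _ ⟨
      (a - b) + 0#                 ≈⟨ +-congˡ (-‿inverseʳ d) ⟨
      (a - b) + (d - d)            ≈⟨ Semi.solve 4 (λ a b d e → ((a Semi.:+ b) Semi.:+ (d Semi.:+ e)) Semi.:= ((a Semi.:+ d) Semi.:+ (b Semi.:+ e))) refl a (- b) d (- d) ⟩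
      (a + d) + (- b - d)          ≈⟨ +-congʳ e ⟩
      (c + b) + (- b - d)          ≈⟨ Semi.solve 4 (λ c b b' d → ((c Semi.:+ b) Semi.:+ (b' Semi.:+ d)) Semi.:= ((c Semi.:+ d) Semi.:+ (b Semi.:+ b'))) refl c b (- b) (- d) ⟩
      (c - d) + (b - b)            ≈⟨ +-congˡ (-‿inverseʳ b) ⟩
      (c - d) + 0#                 ≈⟨ +-identityʳ _ ⟩
      c - d                        ∎
      where open SetoidReasoning setoid

    open RingProperties ring using (-‿distribˡ-*; -‿distribʳ-*; -‿+-comm)

    d-cancelled : ∀ x → difference (cancelled x) ≈ difference x
    d-cancelled (zero  , b)     = refl
    d-cancelled (suc a , zero)  = refl
    d-cancelled (suc a , suc b) = trans (d-cancelled (a , b)) (move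
      (Semi.solve 3 (λ o a b → a Semi.:+ (o Semi.:+ b) Semi.:= (o Semi.:+ a) Semi.:+ b) refl 1# (nat a) (nat b)))

    d-+ : ∀ x y → difference (x +ᵈ y) ≈ difference x + difference y
    d-+ (a , b) (c , d) = begin
      nat (a ℕ.+ c) - nat (b ℕ.+ d)          ≈⟨ +-cong (nat-+ a c) (-‿cong (nat-+ b d)) ⟩
      (nat a + nat c) - (nat b + nat d)      ≈⟨ +-congˡ (-‿+-comm _ _) ⟨
      (nat a + nat c) + (- nat b - nat d)    ≈⟨ Semi.solve 4 (λ a b d e → ((a Semi.:+ b) Semi.:+ (d Semi.:+ e)) Semi.:= ((a Semi.:+ d) Semi.:+ (b Semi.:+ e))) refl (nat a) (nat c) (- nat b) (- nat d) ⟩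
      (nat a - nat b) + (nat c - nat d)      ∎
      where open SetoidReasoning setoid

    d-* : ∀ x y → difference (x *ᵈ y) ≈ difference x * difference y
    d-* (a , b) (c , d) = begin
      nat (a ℕ.* c ℕ.+ b ℕ.* d) - nat (a ℕ.* d ℕ.+ b ℕ.* c)
        ≈⟨ +-cong (trans (nat-+ (a ℕ.* c) (b ℕ.* d)) (+-cong (nat-* a c) (nat-* b d))) (-‿cong (trans (nat-+ (a ℕ.* d) (b ℕ.* c)) (+-cong (nat-* a d) (nat-* b c)))) ⟩
      (A * C' + B * D) - (A * D + B * C')
        ≈⟨ +-congˡ (-‿+-comm _ _) ⟨
      (A * C' + B * D) + (- (A * D) - B * C')
        ≈⟨ +-cong (+-congˡ (trans (sym (-‿involutive _)) (trans (-‿cong (-‿distribʳ-* B D)) (-‿distribˡ-* B (- D))))) (+-cong (-‿distribʳ-* A D) (-‿distribˡ-* B C')) ⟩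
      (A * C' + - B * - D) + (A * - D + - B * C')
        ≈⟨ Semi.solve 4 (λ a b c d → ((a Semi.:* c Semi.:+ b Semi.:* d) Semi.:+ (a Semi.:* d Semi.:+ b Semi.:* c)) Semi.:= ((a Semi.:+ b) Semi.:* (c Semi.:+ d))) refl A (- B) C' (- D) ⟩
      (A - B) * (C' - D) ∎
      where
      open SetoidReasoning setoid
      A = nat a
      B = nat b
      C' = nat c
      D = nat d

    d-neg : ∀ x → difference (-ᵈ x) ≈ - difference x
    d-neg (a , b) = begin
      nat b - nat a           ≈⟨ +-comm _ _ ⟩
      - nat a + nat b         ≈⟨ +-congˡ (-‿involutive _) ⟨
      - nat a + - - nat b     ≈⟨ -‿+-comm _ _ ⟩
      - (nat a - nat b)       ∎
      where open SetoidReasoning setoid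

  -- The value of a formal difference, with constants that compute to 0# and 1#.
  coefficient : ℕ × ℕ → Carrier
  coefficient (0 , 0) = 0#
  coefficient (1 , 0) = 1#
  coefficient d       = difference d

  private
    coefficient≈ : ∀ d → coefficient d ≈ difference d
    coefficient≈ (0 , 0)           = sym (-‿inverseʳ 0#)
    coefficient≈ (1 , 0)           = sym (trans (+-congˡ -0#≈0#) (trans (+-identityʳ _) (+-identityʳ _)))
    coefficient≈ (0 , suc _)       = refl
    coefficient≈ (1 , suc _)       = refl
    coefficient≈ (suc (suc _) , _) = refl

    morphism : C -Raw-AlmostCommutative⟶ fromCommutativeRing R
    morphism = record
      { ⟦_⟧ = coefficient
      ; +-homo = λ x y → trans (coefficient≈ (cancelled (x +ᵈ y))) (trans (trans (d-cancelled (x +ᵈ y)) (d-+ x y)) (sym (+-cong (coefficient≈ x) (coefficient≈ y))))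
      ; *-homo = λ x y → trans (coefficient≈ (cancelled (x *ᵈ y))) (trans (trans (d-cancelled (x *ᵈ y)) (d-* x y)) (sym (*-cong (coefficient≈ x) (coefficient≈ y))))
      ; -‿homo = λ x → trans (coefficient≈ (-ᵈ x)) (trans (d-neg x) (-‿cong (sym (coefficient≈ x))))
      ; 0-homo = refl
      ; 1-homo = refl
      }

    coeff≟ : ∀ x y → Maybe (coefficient x ≈ coefficient y)
    coeff≟ x@(a , b) y@(c , d) with a ℕ.+ d ℕₚ.≟ c ℕ.+ b
    ... | yes e = just (trans (coefficient≈ x) (trans (move (trans (sym (nat-+ a d)) (trans (reflexive (≡.cong nat e)) (nat-+ c b)))) (sym (coefficient≈ y))))
    ... | no  _ = nothing

  open RingSolver C (fromCommutativeRing R) morphism coeff≟ public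
    using (solve; _:=_; _:+_; _:*_; :-_; _:-_; con; Polynomial)

  :0 :1 : ∀ {n} → Polynomial n
  :0 = con (0 , 0)
  :1 = con (1 , 0)

  module ≈R = SetoidReasoning setoid

  #⇒≉ : ∀ {x y} → x # y → ¬ (x ≈ y)
  #⇒≉ {x} {y} p q = proj₂ (tight x y) q p

  -- Equations may be proved by contradiction, as apartness is tight.
  ¬#⇒≈ : ∀ {x y} → ¬ (x # y) → x ≈ y
  ¬#⇒≈ {x} {y} = proj₁ (tight x y)

  recip : ∀ {a} → a # 0# → ∃[ b ] b * a ≈ 1#
  recip {a} a#0 with #⇒invertible a#0
  ... | b , e , _ = b , trans (*-congˡ (sym (trans (+-congˡ -0#≈0#) (+-identityʳ a)))) e

  cancel : ∀ {a x} → a # 0# → a * x ≈ 0# → x ≈ 0#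
  cancel {a} {x} a#0 e with recip a#0
  ... | b , ba = begin
    x             ≈⟨ *-identityˡ x ⟨
    1# * x        ≈⟨ *-congʳ ba ⟨
    b * a * x     ≈⟨ *-assoc b a x ⟩
    b * (a * x)   ≈⟨ *-congˡ e ⟩
    b * 0#        ≈⟨ zeroʳ b ⟩
    0#            ∎
    where open ≈R

  x-y≈0⇒x≈y : ∀ {x y} → x - y ≈ 0# → x ≈ y
  x-y≈0⇒x≈y {x} {y} e = begin
    x          ≈⟨ solve 2 (λ x y → x := (x :- y) :+ y) refl x y ⟩
    x - y + y  ≈⟨ +-congʳ e ⟩
    0# + y     ≈⟨ +-identityˡ y ⟩
    y          ∎
    where open ≈R

  nat≉0 : ∀ m → ¬ (nat (suc m) ≈ 0#)
  nat≉0 m = #⇒≉ (char0 m)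

  -- The natural numbers inside K.  They take the place of an order on K: a sum of
  -- natural numbers vanishes only if each term does.
  IsNat : Carrier → Set ℓ₁
  IsNat x = ∃[ m ] x ≈ nat m

  Nat-0 : IsNat 0#
  Nat-0 = 0 , refl

  Nat-1 : IsNat 1#
  Nat-1 = 1 , sym (+-identityʳ _)

  Nat-+ : ∀ {x y} → IsNat x → IsNat y → IsNat (x + y)
  Nat-+ (m , p) (n , q) = m ℕ.+ n , trans (+-cong p q) (sym (nat-+ m n))

  Nat-* : ∀ {x y} → IsNat x → IsNat y → IsNat (x * y)
  Nat-* (m , p) (n , q) = m ℕ.* n , trans (*-cong p q) (sym (nat-* m n))

  Nat-cong : ∀ {x y} → x ≈ y → IsNat x → IsNat y
  Nat-cong e (m , p) = m , trans (sym e) p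

  Nat-sum : ∀ {n} {f : Fin n → Carrier} → (∀ i → IsNat (f i)) → IsNat (sum f)
  Nat-sum {zero}  h = Nat-0
  Nat-sum {suc n} h = Nat-+ (h zero) (Nat-sum (λ i → h (suc i)))

  Nat-𝟙 : ∀ b → IsNat (𝟙 K b)
  Nat-𝟙 true  = Nat-1
  Nat-𝟙 false = Nat-0

  Nat-+≈0 : ∀ {x y} → IsNat x → IsNat y → x + y ≈ 0# → x ≈ 0#
  Nat-+≈0 (zero  , p) (n , q) e = p
  Nat-+≈0 (suc m , p) (n , q) e =
    ⊥-elim (nat≉0 (m ℕ.+ n) (trans (nat-+ (suc m) n) (trans (sym (+-cong p q)) e)))

  Nat-+≈0ʳ : ∀ {x y} → IsNat x → IsNat y → x + y ≈ 0# → y ≈ 0#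
  Nat-+≈0ʳ p q e = Nat-+≈0 q p (trans (+-comm _ _) e)

  Nat-sum≈0 : ∀ {n} {f : Fin n → Carrier} → (∀ i → IsNat (f i)) → sum f ≈ 0# → ∀ i → f i ≈ 0#
  Nat-sum≈0 h e zero    = Nat-+≈0 (h zero) (Nat-sum (λ i → h (suc i))) e
  Nat-sum≈0 h e (suc i) = Nat-sum≈0 (λ i → h (suc i)) (Nat-+≈0ʳ (h zero) (Nat-sum (λ i → h (suc i))) e) i

  -- The integers inside K.
  IsInt : Carrier → Set ℓ₁
  IsInt x = ∃[ d ] x ≈ difference d

  Int-+ : ∀ {x y} → IsInt x → IsInt y → IsInt (x + y)
  Int-+ (m , p) (n , q) = m +ᵈ n , trans (+-cong p q) (sym (d-+ m n))

  Int-* : ∀ {x y} → IsInt x → IsInt y → IsInt (x * y)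
  Int-* (m , p) (n , q) = m *ᵈ n , trans (*-cong p q) (sym (d-* m n))

  Int-neg : ∀ {x} → IsInt x → IsInt (- x)
  Int-neg (m , p) = -ᵈ m , trans (-‿cong p) (sym (d-neg m))

  Nat⇒Int : ∀ {x} → IsNat x → IsInt x
  Nat⇒Int (m , p) = (m , 0) , trans p (sym (trans (+-congˡ -0#≈0#) (+-identityʳ _)))

  Int-0 : IsInt 0#
  Int-0 = Nat⇒Int Nat-0

  Int-1 : IsInt 1#
  Int-1 = Nat⇒Int Nat-1

  Int-sum : ∀ {n} {f : Fin n → Carrier} → (∀ i → IsInt (f i)) → IsInt (sum f)
  Int-sum {zero}  h = Int-0
  Int-sum {suc n} h = Int-+ (h zero) (Int-sum (λ i → h (suc i)))

  Int-abs : ∀ {x} → IsInt x → ∃[ m ] (x ≈ nat m ⊎ x ≈ - nat m)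
  Int-abs ((a , b) , e) with ℕₚ.≤-total a b
  ... | inj₁ a≤b with ℕₚ.m≤n⇒∃[o]m+o≡n a≤b
  ...   | k , ≡.refl = k , inj₂ (trans e (trans (+-congˡ (-‿cong (nat-+ a k))) (solve 2 (λ a k → a :- (a :+ k) := :- k) refl (nat a) (nat k))))
  Int-abs ((a , b) , e) | inj₂ b≤a with ℕₚ.m≤n⇒∃[o]m+o≡n b≤a
  ...   | k , ≡.refl = k , inj₁ (trans e (trans (+-congʳ (nat-+ b k)) (solve 2 (λ b k → (b :+ k) :- b := k) refl (nat b) (nat k))))

  Int-dec : ∀ {x} → IsInt x → x ≈ 0# ⊎ x # 0#
  Int-dec i with Int-abs i
  ... | zero  , inj₁ e = inj₁ e
  ... | zero  , inj₂ e = inj₁ (trans e -0#≈0#)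
  ... | suc m , inj₁ e = inj₂ (#-congʳ (sym e) (char0 m))
  ... | suc m , inj₂ e = inj₂ (#-congʳ (sym e) (#-congʳ lem (x#0y#0→xy#0 -1#0 (char0 m))))
    where
    lem : - 1# * nat (suc m) ≈ - nat (suc m)
    lem = trans (sym (-‿distribˡ-* _ _)) (-‿cong (*-identityˡ _))
    -1#0 : - 1# # 0#
    -1*-1 : - 1# * (- 1# - 0#) ≈ 1#
    -1*-1 = solve 0 (:- :1 :* (:- :1 :- :0) := :1) refl
    -1#0 = HeytingField.invertible⇒# K (- 1# , -1*-1 , trans (*-comm _ _) -1*-1)

  Int-square : ∀ {x} → IsInt x → IsNat (x * x)
  Int-square i with Int-abs i
  ... | m , inj₁ e = Nat-* (m , e) (m , e)
  ... | m , inj₂ e = Nat-cong (trans (solve 1 (λ m → m :* m := :- m :* :- m) refl (nat m)) (sym (*-cong e e))) (Nat-* (m , refl) (m , refl))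

  square≈0 : ∀ {x} → x * x ≈ 0# → x ≈ 0#
  square≈0 e = ¬#⇒≈ λ p → #⇒≉ p (cancel p e)


-- Integral self-adjoint operators: relations, descent, semisimplicity

module LinearAlgebra {c ℓ₁ ℓ₂ : Level} (K : HeytingField c ℓ₁ ℓ₂) (char0 : CharacteristicZero K) where

  open Field K char0

  -- Vectors, and equality, addition and scaling of vectors.
  Vect : ℕ → Set c
  Vect n = Fin n → Carrier

  infix 4 _≐_
  _≐_ : ∀ {n} → Vect n → Vect n → Set ℓ₁
  u ≐ v = ∀ x → u x ≈ v x

  𝟎 : ∀ {n} → Vect n
  𝟎 _ = 0#

  infixl 6 _⊕_
  infixr 7 _⊛_
  _⊕_ : ∀ {n} → Vect n → Vect n → Vect n
  (u ⊕ v) x = u x + v x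

  _⊛_ : ∀ {n} → Carrier → Vect n → Vect n
  (a ⊛ u) x = a * u x

  IntVect : ∀ {n} → Vect n → Set ℓ₁
  IntVect u = ∀ x → IsInt (u x)

  -- The bilinear form of the standard basis; it may have isotropic vectors, but is
  -- definite on vectors of integers.
  dot : ∀ {n} → Vect n → Vect n → Carrier
  dot u v = sum λ x → u x * v x

  sum-0 : ∀ {n} {f : Vect n} → f ≐ 𝟎 → sum f ≈ 0#
  sum-0 {n} h = trans (sum-cong-≋ h) (sum-replicate-zero n)

  sum-⊕ : ∀ {n} {f : Vect n} (g h : Vect n) → f ≐ g ⊕ h → sum f ≈ sum g + sum h
  sum-⊕ g h e = trans (sum-cong-≋ e) (∑-distrib-+ g h)

  sum-⊛ : ∀ {n} {f : Vect n} a (g : Vect n) → f ≐ a ⊛ g → sum f ≈ a * sum g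
  sum-⊛ a g e = trans (sum-cong-≋ e) (sym (*-distribˡ-sum a g))

  dot-comm : ∀ {n} (u v : Vect n) → dot u v ≈ dot v u
  dot-comm u v = sum-cong-≋ λ x → *-comm (u x) (v x)

  dot-cong : ∀ {n} {u u′ v v′ : Vect n} → u ≐ u′ → v ≐ v′ → dot u v ≈ dot u′ v′
  dot-cong p q = sum-cong-≋ λ x → *-cong (p x) (q x)

  dot-⊕ˡ : ∀ {n} (u v w : Vect n) → dot (u ⊕ v) w ≈ dot u w + dot v w
  dot-⊕ˡ u v w = sum-⊕ (λ x → u x * w x) (λ x → v x * w x) λ x → distribʳ (w x) (u x) (v x)

  dot-⊛ˡ : ∀ {n} a (u w : Vect n) → dot (a ⊛ u) w ≈ a * dot u w
  dot-⊛ˡ a u w = sum-⊛ a (λ x → u x * w x) λ x → *-assoc a (u x) (w x)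

  dot-⊕ʳ : ∀ {n} (u v w : Vect n) → dot u (v ⊕ w) ≈ dot u v + dot u w
  dot-⊕ʳ u v w = sum-⊕ (λ x → u x * v x) (λ x → u x * w x) λ x → distribˡ (u x) (v x) (w x)

  dot-⊛ʳ : ∀ {n} a (u w : Vect n) → dot u (a ⊛ w) ≈ a * dot u w
  dot-⊛ʳ a u w = sum-⊛ a (λ x → u x * w x) λ x → solve 3 (λ a u w → u :* (a :* w) := a :* (u :* w)) refl a (u x) (w x)

  dot-𝟎ʳ : ∀ {n} {u v : Vect n} → v ≐ 𝟎 → dot u v ≈ 0#
  dot-𝟎ʳ {u = u} h = sum-0 λ x → trans (*-congˡ (h x)) (zeroʳ (u x))

  dot-𝟎ˡ : ∀ {n} {u v : Vect n} → u ≐ 𝟎 → dot u v ≈ 0#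
  dot-𝟎ˡ {v = v} h = sum-0 λ x → trans (*-congʳ (h x)) (zeroˡ (v x))

  Nat-norm : ∀ {n} {u : Vect n} → IntVect u → IsNat (dot u u)
  Nat-norm h = Nat-sum λ x → Int-square (h x)

  norm≈0 : ∀ {n} {u : Vect n} → IntVect u → dot u u ≈ 0# → u ≐ 𝟎
  norm≈0 h e x = square≈0 (Nat-sum≈0 (λ x → Int-square (h x)) e x)

  -- The standard basis; basis x y is also the entry of the identity matrix at (x , y).
  basis : ∀ {n} → Fin n → Vect n
  basis e x = 𝟙 K ⌊ e ≟ᶠ x ⌋

  basis-int : ∀ {n} (e : Fin n) → IntVect (basis e)
  basis-int e x = Nat⇒Int (Nat-𝟙 ⌊ e ≟ᶠ x ⌋)

  ≟-suc : ∀ {n} (x y : Fin n) → ⌊ Fin.suc x ≟ᶠ suc y ⌋ ≡ ⌊ x ≟ᶠ y ⌋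
  ≟-suc x y with x ≟ᶠ y
  ... | yes _ = ≡.refl
  ... | no  _ = ≡.refl

  dot-basis : ∀ {n} (e : Fin n) (v : Vect n) → dot (basis e) v ≈ v e
  dot-basis {suc n} zero v = trans (+-cong (*-identityˡ _) (dot-𝟎ˡ {v = λ x → v (suc x)} λ x → refl)) (+-identityʳ _)
  dot-basis {suc n} (suc e) v = begin
    0# * v zero + dot (λ x → basis (suc e) (suc x)) (v ∘ suc)
      ≈⟨ +-cong (zeroˡ _) (dot-cong {u′ = basis e} {v = v ∘ suc} (λ x → reflexive (≡.cong (𝟙 K) (≟-suc e x))) λ x → refl) ⟩
    0# + dot (basis e) (v ∘ suc)   ≈⟨ +-identityˡ _ ⟩
    dot (basis e) (v ∘ suc)        ≈⟨ dot-basis e (v ∘ suc) ⟩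
    v (suc e)                      ∎
    where open ≈R

  record Linear {n} (T : Vect n → Vect n) : Set (c ⊔ ℓ₁) where
    field
      cong  : ∀ {u v} → u ≐ v → T u ≐ T v
      add   : ∀ u v → T (u ⊕ v) ≐ T u ⊕ T v
      scale : ∀ a u → T (a ⊛ u) ≐ a ⊛ T u

    zeroᵀ : ∀ {u} → u ≐ 𝟎 → T u ≐ 𝟎
    zeroᵀ {u} h x = begin
      T u x          ≈⟨ cong (λ y → trans (h y) (sym (zeroˡ 0#))) x ⟩
      T (0# ⊛ 𝟎) x  ≈⟨ scale 0# 𝟎 x ⟩
      0# * T 𝟎 x    ≈⟨ zeroˡ _ ⟩
      0#             ∎
      where open ≈R

  -- The operators of symmetric integer matrices: self-adjoint for dot, and preserving
  -- vectors of integers.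
  record SelfAdjoint {n} (T : Vect n → Vect n) : Set (c ⊔ ℓ₁) where
    field
      linear  : Linear T
      adjoint : ∀ u v → dot (T u) v ≈ dot u (T v)
      int     : ∀ {u} → IntVect u → IntVect (T u)
    open Linear linear public

  find : ∀ {n} {u : Vect n} → IntVect u → u ≐ 𝟎 ⊎ ∃[ x ] u x # 0#
  find {zero}  h = inj₁ λ ()
  find {suc n} h with Int-dec (h zero) | find (λ x → h (suc x))
  ... | inj₂ p | _            = inj₂ (zero , p)
  ... | inj₁ e | inj₂ (x , p) = inj₂ (suc x , p)
  ... | inj₁ e | inj₁ e′      = inj₁ λ { zero → e ; (suc x) → e′ x }

  -- A nontrivial relation with integer coefficients.
  Dependence : ∀ {k n} → (Fin k → Vect n) → Set (c ⊔ ℓ₁ ⊔ ℓ₂)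
  Dependence {k} w = Σ (Vect k) λ a → IntVect a × (∃[ i ] a i # 0#) × (∀ x → sum (λ i → a i * w i x) ≈ 0#)

  -- Clearing the coordinate x of the vectors w (suc i) by means of w zero, whose
  -- coordinate x is not zero: a relation between the cleared vectors lifts.
  module Clearing {m n : ℕ} (w : Fin (suc m) → Vect (suc n)) (w-int : ∀ i → IntVect (w i))
                  (x : Fin (suc n)) (p#0 : w zero x # 0#) where

    cleared : Fin m → Vect (suc n)
    cleared i y = w zero x * w (suc i) y - w (suc i) x * w zero y

    cleared-int : ∀ i → IntVect (cleared i)
    cleared-int i y = Int-+ (Int-* (w-int zero x) (w-int (suc i) y)) (Int-neg (Int-* (w-int (suc i) x) (w-int zero y)))

    module _ (a : Vect m) (rel : ∀ y → sum (λ i → a i * cleared i (punchIn x y)) ≈ 0#) where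

      lifted : Vect (suc m)
      lifted zero    = - sum (λ i → a i * w (suc i) x)
      lifted (suc i) = w zero x * a i

      cleared-vanish : ∀ y → sum (λ i → a i * cleared i y) ≈ 0#
      cleared-vanish y with x ≟ᶠ y
      ... | yes ≡.refl = sum-0 λ i → solve 3 (λ a p q → a :* (p :* q :- q :* p) := :0) refl (a i) (w zero x) (w (suc i) x)
      ... | no x≢y = ≡.subst (λ y → sum (λ i → a i * cleared i y) ≈ 0#) (punchIn-punchOut x≢y) (rel (punchOut x≢y))

      lifted-vanish : ∀ y → sum (λ i → lifted i * w i y) ≈ 0#
      lifted-vanish y = begin
        - sum s * w₀ + sum t   ≈⟨ +-congʳ (solve 2 (λ d w → :- d :* w := :- w :* d) refl (sum s) w₀) ⟩
        - w₀ * sum s + sum t   ≈⟨ +-congʳ (*-distribˡ-sum (- w₀) s) ⟩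
        sum (- w₀ ⊛ s) + sum t ≈⟨ ∑-distrib-+ (- w₀ ⊛ s) t ⟨
        sum (- w₀ ⊛ s ⊕ t)     ≈⟨ sum-cong-≋ (λ i → solve 5 (λ a p w q w₀ → :- w₀ :* (a :* q) :+ p :* a :* w := a :* (p :* w :- q :* w₀)) refl (a i) (w zero x) (w (suc i) y) (w (suc i) x) w₀) ⟩
        sum (λ i → a i * cleared i y) ≈⟨ cleared-vanish y ⟩
        0# ∎
        where
        open ≈R
        w₀ = w zero y
        s t : Vect m
        s i = a i * w (suc i) x
        t i = w zero x * a i * w (suc i) y

    lift : Dependence (λ i y → cleared i (punchIn x y)) → Dependence w
    lift (a , a-int , (j , aj#0) , rel) = lifted a rel , lifted-int , (suc j , x#0y#0→xy#0 p#0 aj#0) , lifted-vanish a rel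
      where
      lifted-int : IntVect (lifted a rel)
      lifted-int zero    = Int-neg (Int-sum λ i → Int-* (a-int i) (w-int (suc i) x))
      lifted-int (suc i) = Int-* (w-int zero x) (a-int i)

  -- Fraction-free Gaussian elimination: more integer vectors than coordinates are
  -- linearly dependent.
  dependent : ∀ {n} (w : Fin (suc n) → Vect n) → (∀ i → IntVect (w i)) → Dependence w
  dependent {zero}  w h = (λ _ → 1#) , (λ _ → Int-1) , (zero , 1#0) , λ ()
  dependent {suc n} w h with find (h zero)
  ... | inj₁ w₀≈0 = basis zero , basis-int zero , (zero , 1#0) , λ x →
        trans (dot-basis zero (λ i → w i x)) (w₀≈0 x)
  ... | inj₂ (x , p#0) = lift (dependent (λ i y → cleared i (punchIn x y)) λ i y → cleared-int i (punchIn x y))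
    where open Clearing w h x p#0

  -- Polynomials in an operator: pow i is the i-th power, and act a is the
  -- polynomial with coefficients a.
  module _ {n : ℕ} (T : Vect n → Vect n) where

    pow : ∀ {k} → Fin k → Vect n → Vect n
    pow zero    v = v
    pow (suc i) v = pow i (T v)

    act : ∀ {k} → Vect k → Vect n → Vect n
    act a v x = sum λ i → a i * pow i v x

  module Act {n : ℕ} {T : Vect n → Vect n} (ST : SelfAdjoint T) where
    private module T = SelfAdjoint ST

    pow-int : ∀ {k} (i : Fin k) {v} → IntVect v → IntVect (pow T i v)
    pow-int zero    h = h
    pow-int (suc i) h = pow-int i (T.int h)

    act-cong : ∀ {k} (a : Vect k) {u v} → u ≐ v → act T a u ≐ act T a v
    act-cong {zero}  a h x = refl
    act-cong {suc k} a h x = +-cong (*-congˡ (h x)) (act-cong (a ∘ suc) (T.cong h) x)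

    act-add : ∀ {k} (a : Vect k) u v → act T a (u ⊕ v) ≐ act T a u ⊕ act T a v
    act-add {zero}  a u v x = sym (+-identityˡ 0#)
    act-add {suc k} a u v x = trans
      (+-congˡ (trans (act-cong (a ∘ suc) (T.add u v) x) (act-add (a ∘ suc) (T u) (T v) x)))
      (solve 5 (λ a u v p q → a :* (u :+ v) :+ (p :+ q) := (a :* u :+ p) :+ (a :* v :+ q)) refl (a zero) (u x) (v x) _ _)

    act-scale : ∀ {k} (a : Vect k) b u → act T a (b ⊛ u) ≐ b ⊛ act T a u
    act-scale {zero}  a b u x = sym (zeroʳ b)
    act-scale {suc k} a b u x = trans
      (+-congˡ (trans (act-cong (a ∘ suc) (T.scale b u) x) (act-scale (a ∘ suc) b (T u) x)))
      (solve 4 (λ a b u p → a :* (b :* u) :+ b :* p := b :* (a :* u :+ p)) refl (a zero) b (u x) _)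

    act-comm : ∀ {k} (a : Vect k) v → act T a (T v) ≐ T (act T a v)
    act-comm {zero}  a v x = sym (T.zeroᵀ (λ _ → refl) x)
    act-comm {suc k} a v x = begin
      a zero * T v x + act T (a ∘ suc) (T (T v)) x       ≈⟨ +-cong (sym (T.scale (a zero) v x)) (act-comm (a ∘ suc) (T v) x) ⟩
      T (a zero ⊛ v) x + T (act T (a ∘ suc) (T v)) x     ≈⟨ T.add (a zero ⊛ v) (act T (a ∘ suc) (T v)) x ⟨
      T (act T a v) x                                     ∎
      where open ≈R

    act-adjoint : ∀ {k} (a : Vect k) u v → dot (act T a u) v ≈ dot u (act T a v)
    act-adjoint {zero}  a u v = trans (dot-𝟎ˡ {v = v} λ _ → refl) (sym (dot-𝟎ʳ {u = u} λ _ → refl))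
    act-adjoint {suc k} a u v = begin
      dot (a₀ ⊛ u ⊕ act T a′ (T u)) v              ≈⟨ dot-⊕ˡ (a₀ ⊛ u) (act T a′ (T u)) v ⟩
      dot (a₀ ⊛ u) v + dot (act T a′ (T u)) v      ≈⟨ +-cong (trans (dot-⊛ˡ a₀ u v) (sym (dot-⊛ʳ a₀ u v))) (act-adjoint a′ (T u) v) ⟩
      dot u (a₀ ⊛ v) + dot (T u) (act T a′ v)      ≈⟨ +-congˡ (T.adjoint u (act T a′ v)) ⟩
      dot u (a₀ ⊛ v) + dot u (T (act T a′ v))      ≈⟨ +-congˡ (dot-cong {u = u} (λ _ → refl) λ x → sym (act-comm a′ v x)) ⟩
      dot u (a₀ ⊛ v) + dot u (act T a′ (T v))      ≈⟨ dot-⊕ʳ u (a₀ ⊛ v) (act T a′ (T v)) ⟨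
      dot u (act T a v)                            ∎
      where
      open ≈R
      a₀ = a zero
      a′ : Vect k
      a′ = a ∘ suc

    act-selfAdjoint : ∀ {k} {a : Vect k} → IntVect a → SelfAdjoint (act T a)
    act-selfAdjoint {k} {a} h = record
      { linear  = record { cong = act-cong a ; add = act-add a ; scale = act-scale a }
      ; adjoint = act-adjoint a
      ; int     = λ hv x → Int-sum λ i → Int-* (h i) (pow-int i hv x)
      }

    -- A nonzero integral polynomial in T kills a given vector of integers, as there are
    -- only n coordinates.
    annihilator : ∀ {v} → IntVect v → Σ (Vect (suc n)) λ a → IntVect a × (∃[ i ] a i # 0#) × act T a v ≐ 𝟎
    annihilator {v} h = dependent (λ i → pow T i v) λ i → pow-int i h

  -- Kernels of commuting integral self-adjoint operators descend to the integers:
  -- if ker T lies in ker S on vectors of integers, then it does so over K.  For a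
  -- basis vector e take a relation a 0 e + T y = 0, with y a polynomial in T applied
  -- to e; it gives a 0 S e = - T S y, which is orthogonal to ker T.  If a 0 is zero,
  -- then T S y = 0, hence S S y = 0 and S y = 0, and y takes the place of the relation;
  -- therefore only S applied to the relation is assumed to vanish.
  module Descent {n : ℕ} {S T : Vect n → Vect n} (SS : SelfAdjoint S) (ST : SelfAdjoint T)
                 (commute : ∀ u → S (T u) ≐ T (S u))
                 (ker : ∀ {u} → IntVect u → T u ≐ 𝟎 → S u ≐ 𝟎) where
    private
      module S = SelfAdjoint SS
      module T = SelfAdjoint ST
    open Act ST

    -- S and S S have the same kernel on vectors of integers, as S is self-adjoint
    square : ∀ {u} → IntVect u → S (S u) ≐ 𝟎 → S u ≐ 𝟎
    square {u} h e = norm≈0 (S.int h) (trans (S.adjoint u (S u)) (dot-𝟎ʳ {u = u} e))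

    private
      go : ∀ {k} (a : Vect k) → IntVect a → (∃[ i ] a i # 0#) → ∀ {e} → IntVect e →
           S (act T a e) ≐ 𝟎 → ∀ {x} → T x ≐ 𝟎 → dot e (S x) ≈ 0#
      go {suc k} a h nz {e} he rel {x} Tx≈0 with Int-dec (h zero)
      ... | inj₂ a₀#0 = cancel a₀#0 (begin
        a₀ * dot e (S x)                           ≈⟨ *-congˡ (S.adjoint e x) ⟨
        a₀ * dot (S e) x                           ≈⟨ dot-⊛ˡ a₀ (S e) x ⟨
        dot (a₀ ⊛ S e) x                           ≈⟨ +-identityʳ _ ⟨
        dot (a₀ ⊛ S e) x + 0#                      ≈⟨ +-congˡ (dot-𝟎ʳ {u = S y} Tx≈0) ⟨
        dot (a₀ ⊛ S e) x + dot (S y) (T x)         ≈⟨ +-congˡ (T.adjoint (S y) x) ⟨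
        dot (a₀ ⊛ S e) x + dot (T (S y)) x         ≈⟨ dot-⊕ˡ (a₀ ⊛ S e) (T (S y)) x ⟨
        dot (a₀ ⊛ S e ⊕ T (S y)) x                 ≈⟨ dot-𝟎ˡ {v = x} (λ z → trans (rel′ z) (rel z)) ⟩
        0#                                         ∎)
        where
        open ≈R
        a₀ = a zero
        y = act T (a ∘ suc) e
        rel′ : a₀ ⊛ S e ⊕ T (S y) ≐ S (act T a e)
        rel′ z = begin
          a₀ * S e z + T (S y) z       ≈⟨ +-cong (S.scale a₀ e z) (commute y z) ⟨
          S (a₀ ⊛ e) z + S (T y) z     ≈⟨ S.add (a₀ ⊛ e) (T y) z ⟨
          S (a₀ ⊛ e ⊕ T y) z           ≈⟨ S.cong (λ w → +-congˡ (act-comm (a ∘ suc) e w)) z ⟨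
          S (act T a e) z              ∎
      go {suc k} a h (zero , p) he rel Tx≈0 | inj₁ a₀≈0 = ⊥-elim (#⇒≉ p a₀≈0)
      go {suc k} a h (suc i , p) {e} he rel {x} Tx≈0 | inj₁ a₀≈0 =
        go (a ∘ suc) (h ∘ suc) (i , p) he (square y-int (ker (S.int y-int) λ z → trans (sym (commute y z)) (rel′ z))) Tx≈0
        where
        y = act T (a ∘ suc) e
        y-int : IntVect y
        y-int = SelfAdjoint.int (act-selfAdjoint (h ∘ suc)) he
        rel′ : S (T y) ≐ 𝟎
        rel′ z = trans (S.cong (λ w → begin
          T y w                                  ≈⟨ act-comm (a ∘ suc) e w ⟨
          act T (a ∘ suc) (T e) w                ≈⟨ +-identityˡ _ ⟨
          0# + act T (a ∘ suc) (T e) w           ≈⟨ +-congʳ (trans (*-congʳ a₀≈0) (zeroˡ _)) ⟨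
          act T a e w                            ∎) z) (rel z)
          where open ≈R

    descent : ∀ {x} → T x ≐ 𝟎 → S x ≐ 𝟎
    descent {x} Tx≈0 e with annihilator (basis-int e)
    ... | a , h , nz , rel = trans (sym (dot-basis e (S x))) (go a h nz (basis-int e) (S.zeroᵀ rel) Tx≈0)

  open Descent public using (descent)

  -- The values at z of the polynomial with coefficients a, and of its derivative.
  eval deriv : ∀ {k} → Vect k → Carrier → Carrier
  eval {zero}  a z = 0#
  eval {suc k} a z = a zero + z * eval (a ∘ suc) z
  deriv {zero}  a z = 0#
  deriv {suc k} a z = eval (a ∘ suc) z + z * deriv (a ∘ suc) z

  derivative : ∀ {k} → Vect (suc k) → Vect k
  derivative a i = nat (suc (toℕ i)) * a (suc i)

  eval-cong : ∀ {k} {a b : Vect k} → a ≐ b → ∀ z → eval a z ≈ eval b z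
  eval-cong {zero}  h z = refl
  eval-cong {suc k} h z = +-cong (h zero) (*-congˡ (eval-cong (h ∘ suc) z))

  eval-⊕ : ∀ {k} (a b : Vect k) z → eval (a ⊕ b) z ≈ eval a z + eval b z
  eval-⊕ {zero}  a b z = sym (+-identityˡ 0#)
  eval-⊕ {suc k} a b z = trans (+-congˡ (*-congˡ (eval-⊕ (a ∘ suc) (b ∘ suc) z)))
    (solve 5 (λ a b z p q → (a :+ b) :+ z :* (p :+ q) := (a :+ z :* p) :+ (b :+ z :* q)) refl (a zero) (b zero) z _ _)

  eval-derivative : ∀ {k} (a : Vect (suc k)) z → eval (derivative a) z ≈ deriv a z
  eval-weighted : ∀ {k} (a : Vect k) z → eval (λ i → nat (toℕ i) * a i) z ≈ z * deriv a z

  eval-derivative a z = begin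
    eval (derivative a) z
      ≈⟨ eval-cong (λ i → trans (distribʳ (a (suc i)) 1# _) (+-congʳ (*-identityˡ _))) z ⟩
    eval ((a ∘ suc) ⊕ λ i → nat (toℕ i) * a (suc i)) z
      ≈⟨ eval-⊕ (a ∘ suc) (λ i → nat (toℕ i) * a (suc i)) z ⟩
    eval (a ∘ suc) z + eval (λ i → nat (toℕ i) * a (suc i)) z
      ≈⟨ +-congˡ (eval-weighted (a ∘ suc) z) ⟩
    deriv a z ∎
    where open ≈R
  eval-weighted {zero}  a z = sym (zeroʳ z)
  eval-weighted {suc k} a z = trans (+-cong (zeroˡ _) (*-congˡ (eval-derivative a z))) (+-identityˡ _)

  eval-0 : ∀ {k} {a : Vect k} → a ≐ 𝟎 → ∀ z → eval a z ≈ 0#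
  eval-0 {zero}  h z = refl
  eval-0 {suc k} h z = trans (+-cong (h zero) (trans (*-congˡ (eval-0 (h ∘ suc) z)) (zeroʳ z))) (+-identityˡ 0#)

  -- An integral self-adjoint operator L has no Jordan blocks over K, although dot may
  -- have isotropic vectors there.  Let L x = z x + y and L y = z y with y not zero.  Then z
  -- is algebraic: it is a root of some nonzero integral polynomial a.  If z is a
  -- simple root of a, then a (L) is integral and self-adjoint, it takes x to a
  -- nonzero multiple of y, and its square kills x; by descent its square has the same
  -- kernel as itself, a contradiction.  Otherwise a is replaced by its derivative.
  module Semisimple {n : ℕ} {L : Vect n → Vect n} (SL : SelfAdjoint L) where
    private module L = SelfAdjoint SL
    open Act SL

    module _ {z : Carrier} {x y : Vect n} (Lx : L x ≐ z ⊛ x ⊕ y) (Ly : L y ≐ z ⊛ y) where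

      -- The polynomial a (L) on the Jordan chain x , y.
      act-y : ∀ {k} (a : Vect k) → act L a y ≐ eval a z ⊛ y
      act-y {zero}  a w = sym (zeroˡ _)
      act-y {suc k} a w = begin
        a zero * y w + act L (a ∘ suc) (L y) w      ≈⟨ +-congˡ (trans (act-cong (a ∘ suc) Ly w) (act-scale (a ∘ suc) z y w)) ⟩
        a zero * y w + z * act L (a ∘ suc) y w      ≈⟨ +-congˡ (*-congˡ (act-y (a ∘ suc) w)) ⟩
        a zero * y w + z * (eval (a ∘ suc) z * y w) ≈⟨ solve 4 (λ a y z e → a :* y :+ z :* (e :* y) := (a :+ z :* e) :* y) refl (a zero) (y w) z _ ⟩
        eval a z * y w                              ∎
        where open ≈R

      act-x : ∀ {k} (a : Vect k) → act L a x ≐ eval a z ⊛ x ⊕ deriv a z ⊛ y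
      act-x {zero}  a w = solve 2 (λ x y → :0 := :0 :* x :+ :0 :* y) refl (x w) (y w)
      act-x {suc k} a w = begin
        a zero * x w + act L (a ∘ suc) (L x) w
          ≈⟨ +-congˡ (trans (act-cong (a ∘ suc) Lx w) (act-add (a ∘ suc) (z ⊛ x) y w)) ⟩
        a zero * x w + (act L (a ∘ suc) (z ⊛ x) w + act L (a ∘ suc) y w)
          ≈⟨ +-congˡ (+-cong (trans (act-scale (a ∘ suc) z x w) (*-congˡ (act-x (a ∘ suc) w))) (act-y (a ∘ suc) w)) ⟩
        a zero * x w + (z * (eval (a ∘ suc) z * x w + deriv (a ∘ suc) z * y w) + eval (a ∘ suc) z * y w)
          ≈⟨ solve 6 (λ a x z e d y → a :* x :+ (z :* (e :* x :+ d :* y) :+ e :* y) := (a :+ z :* e) :* x :+ (e :+ z :* d) :* y) refl (a zero) (x w) z _ _ (y w) ⟩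
        eval a z * x w + deriv a z * y w ∎
        where open ≈R

      private
        -- By induction on the degree: if y is not zero, then z is not a root of a nonzero
        -- integral polynomial.
        no-root : ∀ {k} (a : Vect k) → IntVect a → (∃[ i ] a i # 0#) → eval a z ≈ 0# → ∀ {e} → ¬ (y e # 0#)
        no-root {suc k} a h nz root {e} ye#0 =
          no-root (derivative a) (λ i → Int-* (Nat⇒Int (suc (toℕ i) , refl)) (h (suc i))) (nonzero nz)
            (trans (eval-derivative a z) (¬#⇒≈ simple-root)) ye#0
          where
          ax : act L a x ≐ deriv a z ⊛ y
          ax w = trans (act-x a w) (trans (+-congʳ (trans (*-congʳ root) (zeroˡ _))) (+-identityˡ _))
          aax : act L a (act L a x) ≐ 𝟎
          aax w = trans (act-cong a ax w) (trans (act-scale a (deriv a z) y w)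
                    (trans (*-congˡ (trans (act-y a w) (trans (*-congʳ root) (zeroˡ _)))) (zeroʳ _)))
          Sa = act-selfAdjoint h
          SSa : SelfAdjoint (λ v → act L a (act L a v))
          SSa = record
            { linear = record
              { cong = λ p → act-cong a (act-cong a p)
              ; add = λ u v w → trans (act-cong a (act-add a u v) w) (act-add a (act L a u) (act L a v) w)
              ; scale = λ b u w → trans (act-cong a (act-scale a b u) w) (act-scale a b (act L a u) w)
              }
            ; adjoint = λ u v → trans (act-adjoint a (act L a u) v) (act-adjoint a u (act L a v))
            ; int = λ hu → SelfAdjoint.int Sa (SelfAdjoint.int Sa hu)
            }
          simple-root : ¬ (deriv a z # 0#)
          simple-root d#0 = #⇒≉ ye#0 (cancel d#0 (trans (sym (ax e)) (descent Sa SSa (λ _ _ → refl)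
            (λ {u} hu p → norm≈0 (SelfAdjoint.int Sa hu) (trans (act-adjoint a u (act L a u)) (dot-𝟎ʳ {u = u} p))) aax e)))
          nonzero : (∃[ i ] a i # 0#) → ∃[ i ] derivative a i # 0#
          nonzero nz with find {u = a ∘ suc} (h ∘ suc) | nz
          ... | inj₂ (i , p) | _          = i , x#0y#0→xy#0 (char0 (toℕ i)) p
          ... | inj₁ e₀      | suc i , p  = ⊥-elim (#⇒≉ p (e₀ i))
          ... | inj₁ e₀      | zero , p   = ⊥-elim (#⇒≉ p (trans (sym (trans (+-congˡ (trans (*-congˡ (eval-0 e₀ z)) (zeroʳ z))) (+-identityʳ _))) root))

      semisimple : y ≐ 𝟎
      semisimple e = ¬#⇒≈ λ ye#0 → absurd ye#0 (annihilator (basis-int e))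
        where
        absurd : y e # 0# → Σ (Vect (suc n)) (λ a → IntVect a × (∃[ i ] a i # 0#) × act L a (basis e) ≐ 𝟎) → ⊥
        absurd ye#0 (a , h , nz , rel) = no-root a h nz (¬#⇒≈ λ p → #⇒≉ p (cancel ye#0 (begin
          y e * eval a z              ≈⟨ *-comm _ _ ⟩
          eval a z * y e              ≈⟨ act-y a e ⟨
          act L a y e                 ≈⟨ dot-basis e (act L a y) ⟨
          dot (basis e) (act L a y)   ≈⟨ act-adjoint a (basis e) y ⟨
          dot (act L a (basis e)) y   ≈⟨ dot-𝟎ˡ {v = y} rel ⟩
          0#                          ∎))) ye#0
          where open ≈R

  open Semisimple public using (semisimple)


-- Splitting polynomials in an operator into linear factors

module Factorisation {c ℓ₁ ℓ₂ : Level} (K : HeytingField c ℓ₁ ℓ₂) (char0 : CharacteristicZero K)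
  (closed : AlgebraicallyClosed K) where

  open Field K char0
  open LinearAlgebra K char0
  open RawSemiringDefs (Semiring.rawSemiring semiring) using (_^_)

  -- The monic polynomial X^k + a (k-1) X^(k-1) + ... + a 0 at z and, as an
  -- operator in T, at a vector.

  evalM : ∀ {k} → Vect k → Carrier → Carrier
  evalM {zero}  a z = 1#
  evalM {suc k} a z = a zero + z * evalM (a ∘ suc) z

  actM : ∀ {n} (T : Vect n → Vect n) {k} → Vect k → Vect n → Vect n
  actM T {zero}  a v = v
  actM T {suc k} a v = a zero ⊛ v ⊕ actM T (a ∘ suc) (T v)

  evalM≈ : ∀ {k} (a : Vect k) z → z ^ k + sum (λ i → a i * z ^ toℕ i) ≈ evalM a z
  evalM≈ {zero}  a z = +-identityʳ 1#
  evalM≈ {suc k} a z = begin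
    z * z ^ k + (a zero * 1# + sum s)   ≈⟨ +-congˡ (+-congˡ (sum-⊛ z t λ i → solve 3 (λ a z p → a :* (z :* p) := z :* (a :* p)) refl (a (suc i)) z (z ^ toℕ i))) ⟩
    z * z ^ k + (a zero * 1# + z * sum t)
      ≈⟨ solve 4 (λ a z p s → z :* p :+ (a :* :1 :+ z :* s) := a :+ z :* (p :+ s)) refl (a zero) z (z ^ k) (sum t) ⟩
    a zero + z * (z ^ k + sum t)        ≈⟨ +-congˡ (*-congˡ (evalM≈ (a ∘ suc) z)) ⟩
    evalM a z                           ∎
    where
    open ≈R
    s t : Vect k
    s i = a (suc i) * (z * z ^ toℕ i)
    t i = a (suc i) * z ^ toℕ i

  root : ∀ {k} (a : Vect (suc k)) → ∃[ z ] evalM a z ≈ 0#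
  root {k} a with closed k a
  ... | z , e = z , trans (sym (evalM≈ a z)) e

  -- Synthetic division by X - z.
  quotient : ∀ {k} → Vect (suc k) → Carrier → Vect k
  quotient {suc k} a z zero    = evalM (a ∘ suc) z
  quotient {suc k} a z (suc i) = quotient (a ∘ suc) z i

  -- If L has no eigenvalues other than α and γ on an L-invariant space V, then
  -- (L - α) (L - γ) kills the integer vectors of V.
  module Annihilation {n : ℕ} {L : Vect n → Vect n} (SL : SelfAdjoint L) where
    private module L = SelfAdjoint SL
    open Act SL

    -- The operator L - z.
    shift : Carrier → Vect n → Vect n
    shift z v x = L v x - z * v x

    L-shift : ∀ z v → L (shift z v) ≐ shift z (L v)
    L-shift z v x = begin
      L (shift z v) x               ≈⟨ L.cong (λ y → solve 3 (λ l z v → l :- z :* v := l :+ (:- z) :* v) refl (L v y) z (v y)) x ⟩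
      L (L v ⊕ (- z) ⊛ v) x         ≈⟨ L.add (L v) ((- z) ⊛ v) x ⟩
      L (L v) x + L ((- z) ⊛ v) x   ≈⟨ +-congˡ (L.scale (- z) v x) ⟩
      L (L v) x + - z * L v x       ≈⟨ solve 3 (λ l z v → l :+ (:- z) :* v := l :- z :* v) refl (L (L v) x) z (L v x) ⟩
      shift z (L v) x               ∎
      where open ≈R

    shift-cong : ∀ z {u v} → u ≐ v → shift z u ≐ shift z v
    shift-cong z h x = +-cong (L.cong h x) (-‿cong (*-congˡ (h x)))

    shift-minus : ∀ z u v → shift z (λ x → u x - v x) ≐ λ x → shift z u x - shift z v x
    shift-minus z u v x = begin
      L (λ y → u y - v y) x - z * (u x - v x)
        ≈⟨ +-congʳ (L.cong (λ y → solve 2 (λ u v → u :- v := u :+ (:- :1) :* v) refl (u y) (v y)) x) ⟩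
      L (u ⊕ (- 1#) ⊛ v) x - z * (u x - v x)
        ≈⟨ +-congʳ (trans (L.add u ((- 1#) ⊛ v) x) (+-congˡ (L.scale (- 1#) v x))) ⟩
      L u x + - 1# * L v x - z * (u x - v x)
        ≈⟨ solve 5 (λ l m z u v → l :+ (:- :1) :* m :- z :* (u :- v) := (l :- z :* u) :- (m :- z :* v)) refl (L u x) (L v x) z (u x) (v x) ⟩
      shift z u x - shift z v x ∎
      where open ≈R

    shift-comm : ∀ y z v → shift y (shift z v) ≐ shift z (shift y v)
    shift-comm y z v x = begin
      L (shift z v) x - y * shift z v x         ≈⟨ +-congʳ (L-shift z v x) ⟩
      L (L v) x - z * L v x - y * shift z v x   ≈⟨ solve 5 (λ ll l v y z → ll :- z :* l :- y :* (l :- z :* v) := ll :- y :* l :- z :* (l :- y :* v)) refl (L (L v) x) (L v x) (v x) y z ⟩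
      L (L v) x - y * L v x - z * shift y v x   ≈⟨ +-congʳ (L-shift y v x) ⟨
      L (shift y v) x - z * shift y v x         ∎
      where open ≈R

    shift-𝟎 : ∀ z {v} → v ≐ 𝟎 → shift z v ≐ 𝟎
    shift-𝟎 z {v} h x = trans (+-cong (L.zeroᵀ h x) (-‿cong (*-congˡ (h x)))) (solve 1 (λ z → :0 :- z :* :0 := :0) refl z)

    actM-cong : ∀ {k} (a : Vect k) {u v} → u ≐ v → actM L a u ≐ actM L a v
    actM-cong {zero}  a h = h
    actM-cong {suc k} a h x = +-cong (*-congˡ (h x)) (actM-cong (a ∘ suc) (L.cong h) x)

    -- X - z divides a - a (z).
    divide : ∀ {k} (a : Vect (suc k)) z v → actM L a v ≐ actM L (quotient a z) (shift z v) ⊕ evalM a z ⊛ v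
    divide {zero} a z v x = solve 4 (λ a v l z → a :* v :+ l := (l :- z :* v) :+ (a :+ z :* :1) :* v) refl (a zero) (v x) (L v x) z
    divide {suc k} a z v x = begin
      a zero * v x + actM L a′ (L v) x
        ≈⟨ +-congˡ (divide a′ z (L v) x) ⟩
      a zero * v x + (actM L (quotient a′ z) (shift z (L v)) x + e * L v x)
        ≈⟨ +-congˡ (+-congʳ (actM-cong (quotient a′ z) (λ y → sym (L-shift z v y)) x)) ⟩
      a zero * v x + (actM L (quotient a′ z) (L (shift z v)) x + e * L v x)
        ≈⟨ solve 6 (λ a v m e l z → a :* v :+ (m :+ e :* l) := (e :* (l :- z :* v) :+ m) :+ (a :+ z :* e) :* v) refl (a zero) (v x) _ e (L v x) z ⟩
      (e * shift z v x + actM L (quotient a′ z) (L (shift z v)) x) + (a zero + z * e) * v x ∎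
      where
      open ≈R
      a′ : Vect (suc k)
      a′ = a ∘ suc
      e = evalM a′ z

    act-𝟎 : ∀ {k} {a : Vect k} → a ≐ 𝟎 → ∀ v → act L a v ≐ 𝟎
    act-𝟎 h v x = sum-0 λ i → trans (*-congʳ (h i)) (zeroˡ _)

    -- A nonzero integral polynomial is a nonzero multiple of a monic polynomial, as its
    -- leading coefficient can be found: integers are decidably zero.
    normalise : ∀ {k} (a : Vect k) → IntVect a → (∃[ i ] a i # 0#) →
      ∃[ m ] Σ (Vect m) λ f → ∃[ u ] u # 0# × ∀ v → act L a v ≐ u ⊛ actM L f v
    normalise {suc k} a h nz with find {u = a ∘ suc} (h ∘ suc)
    normalise {suc k} a h nz | inj₂ nz′ with normalise (a ∘ suc) (h ∘ suc) nz′
    ... | m , f , u , u#0 , e with recip u#0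
    ...   | b , bu = suc m , g , u , u#0 , λ v x → begin
      a zero * v x + act L (a ∘ suc) (L v) x      ≈⟨ +-cong (trans (*-congʳ (sym (*-identityˡ _))) (*-congʳ (*-congʳ (sym bu)))) (e (L v) x) ⟩
      b * u * a zero * v x + u * actM L f (L v) x ≈⟨ solve 5 (λ b u a v m → b :* u :* a :* v :+ u :* m := u :* (b :* a :* v :+ m)) refl b u (a zero) (v x) _ ⟩
      u * (b * a zero * v x + actM L f (L v) x)   ∎
      where
      open ≈R
      g : Vect (suc m)
      g zero    = b * a zero
      g (suc i) = f i
    normalise {suc k} a h (suc i , p) | inj₁ a′≈0 = ⊥-elim (#⇒≉ p (a′≈0 i))
    normalise {suc k} a h (zero , p)  | inj₁ a′≈0 = zero , (λ ()) , a zero , p , λ v x →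
      trans (+-congˡ (act-𝟎 a′≈0 (L v) x)) (+-identityʳ _)

    module _ {p : Level} (α γ : Carrier) (V : Vect n → Set p) (V-shift : ∀ z {v} → V v → V (shift z v))
             (eigenvalues : ∀ z {v} → V v → L v ≐ z ⊛ v → ∀ {x} → v x # 0# → z ≈ α ⊎ z ≈ γ) where

      private
        quad : Vect n → Vect n
        quad v = shift α (shift γ v)

        eigen : ∀ {z} v → shift z v ≐ 𝟎 → L v ≐ z ⊛ v
        eigen v h x = x-y≈0⇒x≈y (h x)

        jordan : ∀ {z y} v → shift z v ≐ y → L v ≐ z ⊛ v ⊕ y
        jordan {z} v h x = trans (solve 2 (λ l t → l := t :+ (l :- t)) refl (L v x) (z * v x)) (+-congˡ (h x))

        -- One linear factor at a time: if (L - z) (quad v) = 0 then quad v is an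
        -- eigenvector, so z is α or γ, and quad v = 0 because L is semisimple.
        step : ∀ {v} → V v → ∀ {z} → shift z (quad v) ≐ 𝟎 → quad v ≐ 𝟎
        step {v} Vv {z} zq x = ¬#⇒≈ λ q → absurd q (eigenvalues z (V-shift α (V-shift γ Vv)) (eigen (quad v) zq) q)
          where
          absurd : quad v x # 0# → z ≈ α ⊎ z ≈ γ → ⊥
          absurd q (inj₁ e) = #⇒≉ q (semisimple SL {α} {shift γ v} {quad v} (jordan (shift γ v) λ _ → refl)
            (λ y → trans (eigen (quad v) zq y) (*-congʳ e)) x)
          absurd q (inj₂ e) = #⇒≉ q (semisimple SL {γ} {shift α v} {quad v} (jordan (shift α v) (shift-comm γ α v))
            (λ y → trans (eigen (quad v) zq y) (*-congʳ e)) x)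

        go : ∀ {k} (a : Vect k) {v} → V v → actM L a v ≐ 𝟎 → quad v ≐ 𝟎
        go {zero}  a     Vv h = shift-𝟎 α (shift-𝟎 γ h)
        go {suc k} a {v} Vv h = step Vv λ y → begin
          shift z (shift α (shift γ v)) y   ≈⟨ shift-comm z α (shift γ v) y ⟩
          shift α (shift z (shift γ v)) y   ≈⟨ shift-cong α (shift-comm z γ v) y ⟩
          quad (shift z v) y                ≈⟨ go (quotient a z) (V-shift z Vv) divided y ⟩
          0#                                ∎
          where
          open ≈R
          z = proj₁ (root a)
          divided : actM L (quotient a z) (shift z v) ≐ 𝟎
          divided w = begin
            actM L (quotient a z) (shift z v) w                   ≈⟨ +-identityʳ _ ⟨
            actM L (quotient a z) (shift z v) w + 0#              ≈⟨ +-congˡ (trans (*-congʳ (proj₂ (root a))) (zeroˡ _)) ⟨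
            actM L (quotient a z) (shift z v) w + evalM a z * v w ≈⟨ divide a z v w ⟨
            actM L a v w                                          ≈⟨ h w ⟩
            0#                                                    ∎

      quadratic : ∀ {v} → IntVect v → V v → shift α (shift γ v) ≐ 𝟎
      quadratic {v} hv Vv with annihilator hv
      ... | a , h , nz , rel with normalise a h nz
      ...   | m , f , u , u#0 , e = go f Vv λ x → cancel u#0 (trans (sym (e v x)) (rel x))

-- Symmetric {0,1}-matrices: regular blocks and the Laplacian

module Matrices {c ℓ₁ ℓ₂ : Level} (K : HeytingField c ℓ₁ ℓ₂) (char0 : CharacteristicZero K)
  (closed : AlgebraicallyClosed K) where

  open Field K char0
  open LinearAlgebra K char0
  open Factorisation K char0 closed

  -- The operator of a matrix.
  mv : ∀ {n} → Matrix K n → Vect n → Vect n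
  mv M v x = sum λ y → M x y * v y

  ∑∑ : ∀ {m n} → (Fin m → Fin n → Carrier) → Carrier
  ∑∑ f = sum λ x → sum (f x)

  ∑∑-cong : ∀ {m n} {f g : Fin m → Fin n → Carrier} → (∀ x y → f x y ≈ g x y) → ∑∑ f ≈ ∑∑ g
  ∑∑-cong h = sum-cong-≋ λ x → sum-cong-≋ (h x)

  ∑∑-+ : ∀ {m n} (f g : Fin m → Fin n → Carrier) → ∑∑ (λ x y → f x y + g x y) ≈ ∑∑ f + ∑∑ g
  ∑∑-+ f g = trans (sum-cong-≋ λ x → ∑-distrib-+ (f x) (g x)) (∑-distrib-+ (λ x → sum (f x)) (λ x → sum (g x)))

  mv-selfAdjoint : ∀ {n} {M : Matrix K n} → (∀ x y → M x y ≈ M y x) → (∀ x y → IsInt (M x y)) → SelfAdjoint (mv M)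
  mv-selfAdjoint {n} {M} M-sym M-int = record
    { linear = record
      { cong  = λ h x → sum-cong-≋ λ y → *-congˡ (h y)
      ; add   = λ u v x → sum-⊕ _ _ λ y → distribˡ (M x y) (u y) (v y)
      ; scale = λ a u x → sum-⊛ a _ λ y → solve 3 (λ m a u → m :* (a :* u) := a :* (m :* u)) refl (M x y) a (u y)
      }
    ; adjoint = λ u v → begin
        sum (λ x → mv M u x * v x)                  ≈⟨ sum-cong-≋ (λ x → *-distribʳ-sum (v x) (λ y → M x y * u y)) ⟩
        ∑∑ (λ x y → M x y * u y * v x)              ≈⟨ ∑-comm (λ x y → M x y * u y * v x) ⟩
        ∑∑ (λ y x → M x y * u y * v x)              ≈⟨ ∑∑-cong (λ y x → trans (*-congʳ (*-congʳ (M-sym x y))) (solve 3 (λ m u v → m :* u :* v := u :* (m :* v)) refl (M y x) (u y) (v x))) ⟩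
        ∑∑ (λ y x → u y * (M y x * v x))            ≈⟨ sum-cong-≋ (λ y → *-distribˡ-sum (u y) (λ x → M y x * v x)) ⟨
        sum (λ y → u y * mv M v y)                  ∎
    ; int = λ h x → Int-sum λ y → Int-* (M-int x y) (h y)
    }
    where open ≈R

  𝟙*-cong : ∀ b {s t} → (b ≡ true → s ≈ t) → 𝟙 K b * s ≈ 𝟙 K b * t
  𝟙*-cong true  h = *-congˡ (h ≡.refl)
  𝟙*-cong false h = trans (zeroˡ _) (sym (zeroˡ _))

  basis-sym : ∀ {n} (x y : Fin n) → basis x y ≈ basis y x
  basis-sym x y with x ≟ᶠ y | y ≟ᶠ x
  ... | yes _ | yes _ = refl
  ... | no _  | no _  = refl
  ... | yes p | no q  = ⊥-elim (q (≡.sym p))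
  ... | no p  | yes q = ⊥-elim (p (≡.sym q))

  basis-* : ∀ {n} (x y : Fin n) (f : Vect n) → basis x y * f x ≈ basis x y * f y
  basis-* x y f with x ≟ᶠ y
  ... | yes ≡.refl = refl
  ... | no _       = trans (zeroˡ _) (sym (zeroˡ _))

  sum-basis : ∀ {n} (x : Fin n) → sum (basis x) ≈ 1#
  sum-basis x = trans (sum-cong-≋ λ y → sym (*-identityʳ (basis x y))) (dot-basis x λ _ → 1#)

  mv-basis : ∀ {n} (M : Matrix K n) x → mv M (basis x) ≐ λ y → M y x
  mv-basis M x y = trans (dot-comm (M y) (basis x)) (dot-basis x (M y))

  -- A symmetric relation C, with adjacency matrix A and valencies deg.
  module Symmetric {n : ℕ} (C : BoolMatrix n) (C-sym : ∀ x y → C x y ≡ C y x) where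

    A : Matrix K n
    A = ⟦_⟧ K C

    A-sym : ∀ x y → A x y ≈ A y x
    A-sym x y = reflexive (≡.cong (𝟙 K) (C-sym x y))

    SA : SelfAdjoint (mv A)
    SA = mv-selfAdjoint A-sym λ x y → Nat⇒Int (Nat-𝟙 (C x y))

    open Annihilation SA public

    deg : Vect n
    deg x = sum (A x)

    -- A union P of components of C, on which C is regular, and the space V of the
    -- vectors that are supported on P and have coordinate sum 0.  If A has at most two
    -- eigenvalues on V, then on P the square of A is a combination of I, A and J.
    module Block (P : Fin n → Bool) (C-block : ∀ x y → C x y ≡ true → P x ≡ P y)
                 (k : Carrier) (regular : ∀ x → P x ≡ true → deg x ≈ k) where

      V : Vect n → Set ℓ₁
      V v = (∀ x → P x ≡ false → v x ≈ 0#) × sum v ≈ 0#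

      outside : ∀ {v} → V v → ∀ x → P x ≡ false → mv A v x ≈ 0#
      outside (h , _) x Px = sum-0 λ y → trans
        (𝟙*-cong (C x y) λ Cxy → h y (≡.trans (≡.sym (C-block x y Cxy)) Px)) (zeroʳ _)

      column : ∀ {v} → V v → ∀ y → sum (λ x → A x y * v y) ≈ k * v y
      column {v} (h , _) y with P y in Py
      ... | true  = begin
        sum (λ x → A x y * v y)   ≈⟨ sum-cong-≋ (λ x → *-congʳ (A-sym x y)) ⟩
        sum (λ x → A y x * v y)   ≈⟨ *-distribʳ-sum (v y) (A y) ⟨
        deg y * v y               ≈⟨ *-congʳ (regular y Py) ⟩
        k * v y                   ∎
        where open ≈R
      ... | false = trans (sum-0 {f = λ x → A x y * v y} λ x → trans (*-congˡ (h y Py)) (zeroʳ _)) (sym (trans (*-congˡ (h y Py)) (zeroʳ _)))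

      V-shift : ∀ z {v} → V v → V (shift z v)
      V-shift z {v} Vv@(h , s) = (λ x Px → trans (+-cong (outside Vv x Px) (-‿cong (trans (*-congˡ (h x Px)) (zeroʳ z)))) (-‿inverseʳ 0#))
        , (begin
        sum (shift z v)                  ≈⟨ sum-⊕ (mv A v) ((- z) ⊛ v) (λ x → solve 3 (λ a z v → a :- z :* v := a :+ (:- z) :* v) refl (mv A v x) z (v x)) ⟩
        sum (mv A v) + sum ((- z) ⊛ v)   ≈⟨ +-cong (trans (∑-comm (λ x y → A x y * v y)) (trans (sum-cong-≋ (column Vv)) (sym (*-distribˡ-sum k v)))) (sym (*-distribˡ-sum (- z) v)) ⟩
        k * sum v + - z * sum v          ≈⟨ +-cong (*-congˡ s) (*-congˡ s) ⟩
        k * 0# + - z * 0#                ≈⟨ solve 2 (λ k z → k :* :0 :+ (:- z) :* :0 := :0) refl k z ⟩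
        0#                               ∎)
        where open ≈R

      square : Matrix K n
      square x y = sum λ z → A x z * A z y

      V-basis : ∀ x x′ → P x ≡ true → P x′ ≡ true → V (λ y → basis x y - basis x′ y)
      V-basis x x′ Px Px′ = (λ y Py → trans (+-cong (off x y Px Py) (-‿cong (off x′ y Px′ Py))) (-‿inverseʳ 0#)) , (begin
        sum (λ y → basis x y - basis x′ y)             ≈⟨ sum-⊕ (basis x) ((- 1#) ⊛ basis x′) (λ y → solve 2 (λ a b → a :- b := a :+ (:- :1) :* b) refl (basis x y) (basis x′ y)) ⟩
        sum (basis x) + sum ((- 1#) ⊛ basis x′)        ≈⟨ +-cong (sum-basis x) (trans (sym (*-distribˡ-sum (- 1#) (basis x′))) (*-congˡ (sum-basis x′))) ⟩
        1# + - 1# * 1#                                 ≈⟨ solve 0 (:1 :+ (:- :1) :* :1 := :0) refl ⟩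
        0#                                             ∎)
        where
        open ≈R
        off : ∀ x y → P x ≡ true → P y ≡ false → basis x y ≈ 0#
        off x y Px Py with x ≟ᶠ y
        ... | no _ = refl
        ... | yes ≡.refl with ≡.trans (≡.sym Px) Py
        ...   | ()

      -- On P the square of A is a combination of I, A and J.
      Relation : Set (c ⊔ ℓ₁)
      Relation = ∃[ u ] ∃[ v ] ∃[ w ] ∀ x y → P x ≡ true → P y ≡ true → square x y ≈ u * basis x y + v * A x y + w

      -- The matrix q = (A - α) (A - γ) kills the differences of basis vectors in P, and
      -- is symmetric; so it is constant on P.
      module _ (α γ : Carrier) (eigenvalues : ∀ z {v} → V v → mv A v ≐ z ⊛ v → ∀ {x} → v x # 0# → z ≈ α ⊎ z ≈ γ) where

        private
          q : Matrix K n
          q x y = shift α (shift γ (basis x)) y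

          q-expand : ∀ x y → q x y ≈ square y x - (α + γ) * A y x + α * γ * basis x y
          q-expand x y = begin
            mv A (shift γ (basis x)) y - α * shift γ (basis x) y
              ≈⟨ +-congʳ (L-shift γ (basis x) y) ⟩
            (mv A (mv A (basis x)) y - γ * mv A (basis x) y) - α * (mv A (basis x) y - γ * basis x y)
              ≈⟨ solve 5 (λ s a b α γ → (s :- γ :* a) :- α :* (a :- γ :* b) := s :- (α :+ γ) :* a :+ α :* γ :* b) refl _ (mv A (basis x) y) (basis x y) α γ ⟩
            mv A (mv A (basis x)) y - (α + γ) * mv A (basis x) y + α * γ * basis x y
              ≈⟨ +-congʳ (+-cong (SelfAdjoint.cong SA (mv-basis A x) y) (-‿cong (*-congˡ (mv-basis A x y)))) ⟩
            square y x - (α + γ) * A y x + α * γ * basis x y ∎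
            where open ≈R

          q-sym : ∀ x y → q x y ≈ q y x
          q-sym x y = begin
            q x y                                               ≈⟨ q-expand x y ⟩
            square y x - (α + γ) * A y x + α * γ * basis x y    ≈⟨ +-cong (+-cong (sum-cong-≋ λ z → trans (*-comm _ _) (*-cong (A-sym z x) (A-sym y z))) (-‿cong (*-congˡ (A-sym y x)))) (*-congˡ (basis-sym x y)) ⟩
            square x y - (α + γ) * A x y + α * γ * basis y x    ≈⟨ q-expand y x ⟨
            q y x                                               ∎
            where open ≈R

          q-const : ∀ {x x′} → P x ≡ true → P x′ ≡ true → ∀ y → q x y ≈ q x′ y
          q-const {x} {x′} Px Px′ y = x-y≈0⇒x≈y (begin
            q x y - q x′ y                                         ≈⟨ shift-minus α (shift γ (basis x)) (shift γ (basis x′)) y ⟨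
            shift α (λ z → shift γ (basis x) z - shift γ (basis x′) z) y  ≈⟨ shift-cong α (shift-minus γ (basis x) (basis x′)) y ⟨
            shift α (shift γ (λ z → basis x z - basis x′ z)) y     ≈⟨ quadratic α γ V V-shift eigenvalues (λ z → Int-+ (basis-int x z) (Int-neg (basis-int x′ z))) (V-basis x x′ Px Px′) y ⟩
            0#                                                     ∎)
            where open ≈R

        relation : ∀ {x₀} → P x₀ ≡ true → Relation
        relation {x₀} Px₀ = - (α * γ) , α + γ , q x₀ x₀ , λ x y Px Py → begin
          square x y
            ≈⟨ solve 5 (λ s α γ a b → s := :- (α :* γ) :* b :+ (α :+ γ) :* a :+ (s :- (α :+ γ) :* a :+ α :* γ :* b)) refl (square x y) α γ (A x y) (basis y x) ⟩
          - (α * γ) * basis y x + (α + γ) * A x y + (square x y - (α + γ) * A x y + α * γ * basis y x)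
            ≈⟨ +-cong (+-congʳ (*-congˡ (basis-sym y x))) (begin
               square x y - (α + γ) * A x y + α * γ * basis y x   ≈⟨ q-expand y x ⟨
               q y x     ≈⟨ q-const Py Px₀ x ⟩
               q x₀ x    ≈⟨ q-sym x₀ x ⟩
               q x x₀    ≈⟨ q-const Px Px₀ x₀ ⟩
               q x₀ x₀   ∎) ⟩
          - (α * γ) * basis x y + (α + γ) * A x y + q x₀ x₀ ∎
          where open ≈R

    -- The Laplacian.
    Lap : Matrix K n
    Lap x y = basis x y * deg x - A x y

    Lap-sym : ∀ x y → Lap x y ≈ Lap y x
    Lap-sym x y = +-cong (trans (basis-* x y deg) (*-congʳ (basis-sym x y))) (-‿cong (A-sym x y))

    Lap-int : ∀ x y → IsInt (Lap x y)
    Lap-int x y = Int-+ (Int-* (basis-int x y) (Int-sum λ z → Nat⇒Int (Nat-𝟙 (C x z)))) (Int-neg (Nat⇒Int (Nat-𝟙 (C x y))))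

    lap : ∀ v x → mv Lap v x ≈ deg x * v x - mv A v x
    lap v x = begin
      sum (λ y → Lap x y * v y)
        ≈⟨ sum-⊕ (λ y → basis x y * (deg x * v y)) ((- 1#) ⊛ λ y → A x y * v y) (λ y → solve 4 (λ b d a v → (b :* d :- a) :* v := b :* (d :* v) :+ (:- :1) :* (a :* v)) refl (basis x y) (deg x) (A x y) (v y)) ⟩
      sum (λ y → basis x y * (deg x * v y)) + sum ((- 1#) ⊛ λ y → A x y * v y)
        ≈⟨ +-cong (dot-basis x (deg x ⊛ v)) (sym (*-distribˡ-sum (- 1#) (λ y → A x y * v y))) ⟩
      deg x * v x + - 1# * mv A v x
        ≈⟨ solve 2 (λ d m → d :+ (:- :1) :* m := d :- m) refl (deg x * v x) (mv A v x) ⟩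
      deg x * v x - mv A v x ∎
      where open ≈R

    -- The Dirichlet form, summed over ordered pairs of adjacent points.
    energy : Vect n → Vect n → Carrier
    energy u v = ∑∑ λ x y → A x y * ((u x - u y) * (v x - v y))

    Nat-energy : ∀ {u} → IntVect u → IsNat (energy u u)
    Nat-energy h = Nat-sum λ x → Nat-sum λ y → Nat-* (Nat-𝟙 (C x y)) (Int-square (Int-+ (h x) (Int-neg (h y))))

    -- Green's identity, doubled because energy runs over ordered pairs.
    energy≈ : ∀ u v → dot u (mv Lap v) + dot u (mv Lap v) ≈ energy u v
    energy≈ u v = begin
      dot u (mv Lap v) + dot u (mv Lap v)        ≈⟨ +-cong half (trans half (∑-comm f)) ⟩
      ∑∑ f + ∑∑ (λ y x → f x y)                  ≈⟨ ∑∑-+ f (λ y x → f x y) ⟨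
      ∑∑ (λ x y → f x y + f y x)                 ≈⟨ ∑∑-cong (λ x y → trans (+-congˡ (*-congʳ (A-sym y x)))
        (solve 5 (λ a ux uy vx vy → a :* (ux :* (vx :- vy)) :+ a :* (uy :* (vy :- vx)) := a :* ((ux :- uy) :* (vx :- vy))) refl (A x y) (u x) (u y) (v x) (v y))) ⟩
      energy u v                                 ∎
      where
      open ≈R
      f : Fin n → Fin n → Carrier
      f x y = A x y * (u x * (v x - v y))
      half : dot u (mv Lap v) ≈ ∑∑ f
      half = sum-cong-≋ λ x → begin
        u x * mv Lap v x                                      ≈⟨ *-congˡ (lap v x) ⟩
        u x * (deg x * v x - mv A v x)                        ≈⟨ solve 4 (λ u d v m → u :* (d :* v :- m) := (u :* v) :* d :+ (:- u) :* m) refl (u x) (deg x) (v x) (mv A v x) ⟩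
        u x * v x * deg x + - u x * mv A v x                  ≈⟨ +-cong (*-distribˡ-sum (u x * v x) (A x)) (*-distribˡ-sum (- u x) (λ y → A x y * v y)) ⟩
        sum (λ y → u x * v x * A x y) + sum (λ y → - u x * (A x y * v y)) ≈⟨ ∑-distrib-+ (λ y → u x * v x * A x y) (λ y → - u x * (A x y * v y)) ⟨
        sum (λ y → u x * v x * A x y + - u x * (A x y * v y)) ≈⟨ sum-cong-≋ (λ y → solve 4 (λ u v a w → (u :* v) :* a :+ (:- u) :* (a :* w) := a :* (u :* (v :- w))) refl (u x) (v x) (A x y) (v y)) ⟩
        sum (f x)                                             ∎

-- Positivity of the Laplacian

module Positivity {c ℓ₁ ℓ₂ : Level} (K : HeytingField c ℓ₁ ℓ₂) (char0 : CharacteristicZero K)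
  (closed : AlgebraicallyClosed K) where

  open Field K char0
  open LinearAlgebra K char0
  open Matrices K char0 closed

  sum-split : ∀ m {k} (f : Vect (m ℕ.+ k)) → sum f ≈ sum (λ i → f (i ↑ˡ k)) + sum (λ j → f (m ↑ʳ j))
  sum-split zero    f = sym (+-identityˡ _)
  sum-split (suc m) f = trans (+-congˡ (sum-split m (f ∘ suc))) (sym (+-assoc _ _ _))

  sum-combine : ∀ m {k} (f : Vect (m ℕ.* k)) → sum f ≈ ∑∑ {m} {k} (λ x y → f (combine x y))
  sum-combine zero        f = refl
  sum-combine (suc m) {k} f = trans (sum-split k f) (+-congˡ (sum-combine m (λ j → f (k ↑ʳ j))))

  sum-const : ∀ n a → sum {n} (λ _ → a) ≈ nat n * a
  sum-const zero    a = sym (zeroˡ a)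
  sum-const (suc n) a = trans (+-cong (sym (*-identityˡ a)) (sum-const n a)) (sym (distribʳ a 1# (nat n)))

  id-selfAdjoint : ∀ {n} → SelfAdjoint {n} id
  id-selfAdjoint = record
    { linear  = record { cong = id ; add = λ _ _ _ → refl ; scale = λ _ _ _ → refl }
    ; adjoint = λ _ _ → refl
    ; int     = id
    }

  -- A self-adjoint integral operator which is injective on vectors of integers
  -- is injective.
  injective : ∀ {n} {T : Vect n → Vect n} → SelfAdjoint T →
    (∀ {u} → IntVect u → T u ≐ 𝟎 → u ≐ 𝟎) → ∀ {v} → T v ≐ 𝟎 → v ≐ 𝟎
  injective ST = descent id-selfAdjoint ST (λ _ _ → refl)

  T⇒𝟙#0 : ∀ b → T b → 𝟙 K b # 0#
  T⇒𝟙#0 true _ = 1#0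

  module Laplacian {n : ℕ} (C : BoolMatrix n) (C-sym : ∀ x y → C x y ≡ C y x) where
    open Symmetric C C-sym

    -- On a connected graph Lap + J is positive definite on vectors of integers, hence
    -- injective over K; so harmonic vectors of coordinate sum 0 vanish.
    module _ (connected : ∀ x y → Star (λ u v → T (C u v)) x y) where

      private
        M : Matrix K n
        M x y = Lap x y + 1#

        SM : SelfAdjoint (mv M)
        SM = mv-selfAdjoint
          (λ x y → +-congʳ (Lap-sym x y))
          (λ x y → Int-+ (Lap-int x y) Int-1)

        M≈ : ∀ v x → mv M v x ≈ mv Lap v x + sum v
        M≈ v x = sum-⊕ (λ y → Lap x y * v y) v λ y → solve 2 (λ l v → (l :+ :1) :* v := l :* v :+ v) refl (Lap x y) (v y)

        definite : ∀ {u} → IntVect u → mv M u ≐ 𝟎 → u ≐ 𝟎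
        definite {u} hu Mu x = cancel-n x (trans (sym (sum-const n (u x))) (trans (sum-cong-≋ λ y → sym (const (connected x y))) s≈0))
          where
          s = sum u
          total : energy u u + (s * s + s * s) ≈ 0#
          total = begin
            energy u u + (s * s + s * s)
              ≈⟨ +-congʳ (energy≈ u u) ⟨
            d + d + (s * s + s * s)
              ≈⟨ solve 2 (λ d s → d :+ d :+ (s :+ s) := (d :+ s) :+ (d :+ s)) refl d (s * s) ⟩
            (d + s * s) + (d + s * s)
              ≈⟨ +-cong zero′ zero′ ⟩
            0# + 0#
              ≈⟨ +-identityˡ 0# ⟩
            0# ∎
            where
            open ≈R
            d = dot u (mv Lap u)
            zero′ : d + s * s ≈ 0#
            zero′ = begin
              d + s * s                                ≈⟨ +-congˡ (*-distribʳ-sum s u) ⟩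
              d + sum (λ x → u x * s)                  ≈⟨ dot-⊕ʳ u (mv Lap u) (λ _ → s) ⟨
              sum (λ x → u x * (mv Lap u x + s))       ≈⟨ dot-𝟎ʳ {u = u} (λ x → trans (sym (M≈ u x)) (Mu x)) ⟩
              0#                                       ∎
          ss : IsNat (s * s)
          ss = Int-square (Int-sum hu)
          s≈0 : s ≈ 0#
          s≈0 = square≈0 (Nat-+≈0 ss ss (Nat-+≈0ʳ (Nat-energy hu) (Nat-+ ss ss) total))
          energy≈0 : energy u u ≈ 0#
          energy≈0 = Nat-+≈0 (Nat-energy hu) (Nat-+ ss ss) total
          term : ∀ x y → IsNat (A x y * ((u x - u y) * (u x - u y)))
          term x y = Nat-* (Nat-𝟙 (C x y)) (Int-square (Int-+ (hu x) (Int-neg (hu y))))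
          edge : ∀ {x y} → T (C x y) → u x ≈ u y
          edge {x} {y} t = x-y≈0⇒x≈y (square≈0 (cancel (T⇒𝟙#0 (C x y) t)
            (Nat-sum≈0 (term x) (Nat-sum≈0 (λ x → Nat-sum (term x)) energy≈0 x) y)))
          const : ∀ {x y} → Star (λ u v → T (C u v)) x y → u y ≈ u x
          const ε       = refl
          const (t ◅ p) = trans (const p) (sym (edge t))
          cancel-n : ∀ {m} (x : Fin m) {a} → nat m * a ≈ 0# → a ≈ 0#
          cancel-n {suc m} x = cancel (char0 m)

      harmonic : ∀ {v} → mv Lap v ≐ 𝟎 → sum v ≈ 0# → v ≐ 𝟎
      harmonic {v} h s = injective SM definite λ x → trans (M≈ v x) (trans (+-cong (h x) s) (+-identityˡ 0#))

    -- K is not ordered, but still no two eigenvalues of Lap have a negative integer - N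
    -- as their product: the Kronecker square of Lap is positive semidefinite, so adding
    -- N gives an integer matrix which is positive definite on vectors of integers and
    -- hence injective over K, while it kills the tensor product of the eigenvectors.
    module _ {N : Carrier} (N-nat : IsNat N) (N#0 : N # 0#) where

      private
        q r : Fin (n ℕ.* n) → Fin n
        q i = proj₁ (remQuot {n} n i)
        r i = proj₂ (remQuot {n} n i)

        M : Matrix K (n ℕ.* n)
        M i j = Lap (q i) (q j) * Lap (r i) (r j) + N * basis i j

        SM : SelfAdjoint (mv M)
        SM = mv-selfAdjoint
          (λ i j → +-cong (*-cong (Lap-sym (q i) (q j)) (Lap-sym (r i) (r j))) (*-congˡ (basis-sym i j)))
          (λ i j → Int-+ (Int-* (Lap-int (q i) (q j)) (Lap-int (r i) (r j))) (Int-* (Nat⇒Int N-nat) (basis-int i j)))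

        q-combine : ∀ (x y : Fin n) → q (combine x y) ≡ x
        q-combine x y = ≡.cong proj₁ (remQuot-combine {n} {n} x y)
        r-combine : ∀ (x y : Fin n) → r (combine x y) ≡ y
        r-combine x y = ≡.cong proj₂ (remQuot-combine {n} {n} x y)

        M≈ : ∀ u i → mv M u i ≈ ∑∑ {n} {n} (λ x y → Lap (q i) x * (Lap (r i) y * u (combine x y))) + N * u i
        M≈ u i = begin
          sum (λ j → M i j * u j)
            ≈⟨ sum-⊕ (λ j → Lap (q i) (q j) * (Lap (r i) (r j) * u j)) (λ j → N * (basis i j * u j))
                 (λ j → solve 5 (λ l m n b u → (l :* m :+ n :* b) :* u := l :* (m :* u) :+ n :* (b :* u)) refl _ _ N (basis i j) (u j)) ⟩
          sum (λ j → Lap (q i) (q j) * (Lap (r i) (r j) * u j)) + sum (λ j → N * (basis i j * u j))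
            ≈⟨ +-cong (sum-combine n (λ j → Lap (q i) (q j) * (Lap (r i) (r j) * u j))) (trans (sym (*-distribˡ-sum N (λ j → basis i j * u j))) (*-congˡ (dot-basis i u))) ⟩
          ∑∑ {n} {n} (λ x y → Lap (q i) (q (combine x y)) * (Lap (r i) (r (combine x y)) * u (combine x y))) + N * u i
            ≈⟨ +-congʳ (∑∑-cong {n} {n} (λ x y → *-cong (reflexive (≡.cong (Lap (q i)) (q-combine x y))) (*-congʳ (reflexive (≡.cong (Lap (r i)) (r-combine x y)))))) ⟩
          ∑∑ {n} {n} (λ x y → Lap (q i) x * (Lap (r i) y * u (combine x y))) + N * u i ∎
          where open ≈R

        -- Green's identity in either tensor factor: 4 dot u (M u) is H plus 4 N times the
        -- square of the length of u, and H is a natural number.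
        module Definite (u : Vect (n ℕ.* n)) (hu : IntVect u) where
          U Z : Fin n → Vect n
          U x y = u (combine x y)
          Z x = mv Lap (U x)

          Mu : ∀ x y → mv M u (combine x y) ≈ mv Lap (λ x′ → Z x′ y) x + N * U x y
          Mu x y = begin
            mv M u (combine x y)
              ≈⟨ M≈ u (combine x y) ⟩
            ∑∑ {n} {n} (λ x′ y′ → Lap (q (combine x y)) x′ * (Lap (r (combine x y)) y′ * U x′ y′)) + N * U x y
              ≈⟨ +-congʳ (∑∑-cong {n} {n} (λ x′ y′ → *-cong (reflexive (≡.cong (λ z → Lap z x′) (q-combine x y))) (*-congʳ (reflexive (≡.cong (λ z → Lap z y′) (r-combine x y)))))) ⟩
            ∑∑ {n} {n} (λ x′ y′ → Lap x x′ * (Lap y y′ * U x′ y′)) + N * U x y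
              ≈⟨ +-congʳ (sum-cong-≋ (λ x′ → *-distribˡ-sum (Lap x x′) (λ y′ → Lap y y′ * U x′ y′))) ⟨
            mv Lap (λ x′ → Z x′ y) x + N * U x y ∎
            where open ≈R

          F G : Carrier
          F = ∑∑ λ x y → U x y * mv Lap (λ x′ → Z x′ y) x
          D : Fin n → Fin n → Vect n
          D x x′ y = U x y - U x′ y
          G = ∑∑ λ x x′ → A x x′ * dot (D x x′) (mv Lap (D x x′))

          F+F : F + F ≈ G
          F+F = begin
            F + F
              ≈⟨ +-cong F≈ F≈ ⟩
            sum f + sum f
              ≈⟨ ∑-distrib-+ f f ⟨
            sum (λ y → f y + f y)
              ≈⟨ sum-cong-≋ (λ y → energy≈ (λ x → U x y) (λ x → Z x y)) ⟩
            sum (λ y → ∑∑ λ x x′ → A x x′ * (D x x′ y * (Z x y - Z x′ y)))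
              ≈⟨ ∑-comm (λ y x → sum λ x′ → A x x′ * (D x x′ y * (Z x y - Z x′ y))) ⟩
            sum (λ x → ∑∑ λ y x′ → A x x′ * (D x x′ y * (Z x y - Z x′ y)))
              ≈⟨ sum-cong-≋ (λ x → ∑-comm (λ y x′ → A x x′ * (D x x′ y * (Z x y - Z x′ y)))) ⟩
            ∑∑ (λ x x′ → sum λ y → A x x′ * (D x x′ y * (Z x y - Z x′ y)))
              ≈⟨ ∑∑-cong (λ x x′ → trans (sum-cong-≋ λ y → *-congˡ (*-congˡ (Z-Z x x′ y))) (sym (*-distribˡ-sum (A x x′) (λ y → D x x′ y * mv Lap (D x x′) y)))) ⟩
            G ∎
            where
            open ≈R
            f : Vect n
            f y = dot (λ x → U x y) (mv Lap (λ x → Z x y))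
            F≈ : F ≈ sum f
            F≈ = ∑-comm (λ x y → U x y * mv Lap (λ x′ → Z x′ y) x)
            Z-Z : ∀ x x′ y → Z x y - Z x′ y ≈ mv Lap (D x x′) y
            Z-Z x x′ y = sym (begin
              mv Lap (D x x′) y
                ≈⟨ sum-⊕ (λ z → Lap y z * U x z) ((- 1#) ⊛ λ z → Lap y z * U x′ z) (λ z → solve 3 (λ l u v → l :* (u :- v) := l :* u :+ (:- :1) :* (l :* v)) refl (Lap y z) (U x z) (U x′ z)) ⟩
              Z x y + sum ((- 1#) ⊛ λ z → Lap y z * U x′ z)
                ≈⟨ +-congˡ (sym (*-distribˡ-sum (- 1#) (λ z → Lap y z * U x′ z))) ⟩
              Z x y + - 1# * Z x′ y
                ≈⟨ solve 2 (λ a b → a :+ (:- :1) :* b := a :- b) refl (Z x y) (Z x′ y) ⟩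
              Z x y - Z x′ y ∎)

          H : Carrier
          H = ∑∑ λ x x′ → A x x′ * energy (D x x′) (D x x′)

          G+G : G + G ≈ H
          G+G = trans (sym (∑∑-+ g g)) (∑∑-cong λ x x′ → trans (sym (distribˡ (A x x′) _ _)) (*-congˡ (energy≈ (D x x′) (D x x′))))
            where
            g : Fin n → Fin n → Carrier
            g x x′ = A x x′ * dot (D x x′) (mv Lap (D x x′))

          Nat-H : IsNat H
          Nat-H = Nat-sum λ x → Nat-sum λ x′ → Nat-* (Nat-𝟙 (C x x′))
            (Nat-energy λ y → Int-+ (hu (combine x y)) (Int-neg (hu (combine x′ y))))

          form : dot u (mv M u) ≈ F + N * dot u u
          form = begin
            dot u (mv M u)
              ≈⟨ sum-combine n (λ i → u i * mv M u i) ⟩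
            ∑∑ (λ x y → U x y * mv M u (combine x y))
              ≈⟨ ∑∑-cong (λ x y → trans (*-congˡ (Mu x y)) (solve 3 (λ u l n → u :* (l :+ n :* u) := u :* l :+ n :* (u :* u)) refl (U x y) _ N)) ⟩
            ∑∑ (λ x y → U x y * mv Lap (λ x′ → Z x′ y) x + N * (U x y * U x y))
              ≈⟨ ∑∑-+ (λ x y → U x y * mv Lap (λ x′ → Z x′ y) x) (λ x y → N * (U x y * U x y)) ⟩
            F + ∑∑ (λ x y → N * (U x y * U x y))
              ≈⟨ +-congˡ (trans (sym (sum-combine n (λ i → N * (u i * u i)))) (sym (*-distribˡ-sum N (λ i → u i * u i)))) ⟩
            F + N * dot u u ∎
            where open ≈R

          definite : mv M u ≐ 𝟎 → u ≐ 𝟎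
          definite h = norm≈0 hu (cancel N#0 (Nat-+≈0 Nat-g Nat-g (Nat-+≈0 (Nat-+ Nat-g Nat-g) (Nat-+ Nat-g Nat-g) (Nat-+≈0ʳ Nat-H (Nat-+ (Nat-+ Nat-g Nat-g) (Nat-+ Nat-g Nat-g)) total))))
            where
            open ≈R
            g = N * dot u u
            Nat-g : IsNat g
            Nat-g = Nat-* N-nat (Nat-norm hu)
            F+g : F + g ≈ 0#
            F+g = trans (sym form) (dot-𝟎ʳ {u = u} h)
            total : H + ((g + g) + (g + g)) ≈ 0#
            total = begin
              H + ((g + g) + (g + g))              ≈⟨ +-congʳ G+G ⟨
              G + G + ((g + g) + (g + g))          ≈⟨ +-congʳ (+-cong F+F F+F) ⟨
              (F + F) + (F + F) + ((g + g) + (g + g)) ≈⟨ solve 2 (λ f g → (f :+ f) :+ (f :+ f) :+ ((g :+ g) :+ (g :+ g)) := ((f :+ g) :+ (f :+ g)) :+ ((f :+ g) :+ (f :+ g))) refl F g ⟩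
              ((F + g) + (F + g)) + ((F + g) + (F + g)) ≈⟨ +-cong (+-cong F+g F+g) (+-cong F+g F+g) ⟩
              (0# + 0#) + (0# + 0#)                ≈⟨ trans (+-cong (+-identityʳ 0#) (+-identityʳ 0#)) (+-identityʳ 0#) ⟩
              0#                                   ∎

      no-negative-product : ∀ {λ₁ λ₂} w₁ w₂ → mv Lap w₁ ≐ λ₁ ⊛ w₁ → mv Lap w₂ ≐ λ₂ ⊛ w₂ →
        λ₁ * λ₂ + N ≈ 0# → ∀ x y → w₁ x * w₂ y ≈ 0#
      no-negative-product {λ₁} {λ₂} w₁ w₂ e₁ e₂ e x y =
        trans (sym (at x y)) (injective SM (λ {u} hu → Definite.definite u hu) MW (combine x y))
        where
        open ≈R
        W : Vect (n ℕ.* n)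
        W i = w₁ (q i) * w₂ (r i)
        at : ∀ x y → W (combine x y) ≈ w₁ x * w₂ y
        at x y = reflexive (≡.cong₂ (λ a b → w₁ a * w₂ b) (q-combine x y) (r-combine x y))
        MW : mv M W ≐ 𝟎
        MW i = begin
          mv M W i
            ≈⟨ M≈ W i ⟩
          ∑∑ {n} {n} (λ x y → Lap (q i) x * (Lap (r i) y * W (combine x y))) + N * W i
            ≈⟨ +-congʳ (∑∑-cong {n} {n} λ x y → trans (*-congˡ (*-congˡ (at x y))) (solve 4 (λ l m u v → l :* (m :* (u :* v)) := (l :* u) :* (m :* v)) refl (Lap (q i) x) (Lap (r i) y) (w₁ x) (w₂ y))) ⟩
          ∑∑ {n} {n} (λ x y → (Lap (q i) x * w₁ x) * (Lap (r i) y * w₂ y)) + N * W i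
            ≈⟨ +-congʳ (sum-cong-≋ (λ x → *-distribˡ-sum (Lap (q i) x * w₁ x) (λ y → Lap (r i) y * w₂ y))) ⟨
          sum (λ x → (Lap (q i) x * w₁ x) * mv Lap w₂ (r i)) + N * W i
            ≈⟨ +-congʳ (*-distribʳ-sum (mv Lap w₂ (r i)) (λ x → Lap (q i) x * w₁ x)) ⟨
          mv Lap w₁ (q i) * mv Lap w₂ (r i) + N * W i
            ≈⟨ +-congʳ (*-cong (e₁ (q i)) (e₂ (r i))) ⟩
          λ₁ * w₁ (q i) * (λ₂ * w₂ (r i)) + N * W i
            ≈⟨ solve 5 (λ a u b v n → a :* u :* (b :* v) :+ n :* (u :* v) := (a :* b :+ n) :* (u :* v)) refl λ₁ (w₁ (q i)) λ₂ (w₂ (r i)) N ⟩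
          (λ₁ * λ₂ + N) * W i
            ≈⟨ trans (*-congʳ e) (zeroˡ _) ⟩
          0# ∎

-- Standard bases as colourings

module StandardBases {c ℓ₁ ℓ₂ : Level} (K : HeytingField c ℓ₁ ℓ₂) (char0 : CharacteristicZero K) where

  open Field K char0
  open LinearAlgebra K char0

  1≉0 : ¬ (1# ≈ 0#)
  1≉0 = #⇒≉ 1#0

  𝟙-injective : ∀ a b → 𝟙 K a ≈ 𝟙 K b → a ≡ b
  𝟙-injective true  true  e = ≡.refl
  𝟙-injective false false e = ≡.refl
  𝟙-injective true  false e = ⊥-elim (1≉0 e)
  𝟙-injective false true  e = ⊥-elim (1≉0 (sym e))

  ¬true⇒false : ∀ {b} → ¬ (b ≡ true) → b ≡ false
  ¬true⇒false {true}  h = ⊥-elim (h ≡.refl)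
  ¬true⇒false {false} h = ≡.refl

  ⇔⇒≡ : ∀ {a b} → (a ≡ true → b ≡ true) → (b ≡ true → a ≡ true) → a ≡ b
  ⇔⇒≡ {true}  f g = ≡.sym (f ≡.refl)
  ⇔⇒≡ {false} {true}  f g = g ≡.refl
  ⇔⇒≡ {false} {false} f g = ≡.refl

  Nat-split : ∀ {r} {f : Vect r} → (∀ i → IsNat (f i)) → ∀ k → ∃[ m ] IsNat m × sum f ≈ f k + m
  Nat-split {suc r} {f} h zero    = _ , Nat-sum (h ∘ suc) , refl
  Nat-split {suc r} {f} h (suc k) =
    let m , hm , e = Nat-split (h ∘ suc) k in
    f zero + m , Nat-+ (h zero) hm , trans (+-congˡ e) (solve 3 (λ a b m → a :+ (b :+ m) := b :+ (a :+ m)) refl (f zero) (f (suc k)) m)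

  Nat-split₂ : ∀ {r} {f : Vect r} → (∀ i → IsNat (f i)) → ∀ k l → k ≢ l → ∃[ m ] IsNat m × sum f ≈ f k + f l + m
  Nat-split₂ h zero zero k≢l = ⊥-elim (k≢l ≡.refl)
  Nat-split₂ {suc r} {f} h zero (suc l) k≢l =
    let m , hm , e = Nat-split (h ∘ suc) l in
    m , hm , trans (+-congˡ e) (sym (+-assoc (f zero) (f (suc l)) m))
  Nat-split₂ {suc r} {f} h (suc k) zero k≢l =
    let m , hm , e = Nat-split (h ∘ suc) k in
    m , hm , trans (+-congˡ e) (solve 3 (λ a b m → a :+ (b :+ m) := b :+ a :+ m) refl (f zero) (f (suc k)) m)
  Nat-split₂ {suc r} {f} h (suc k) (suc l) k≢l =
    let m , hm , e = Nat-split₂ (h ∘ suc) k l (λ p → k≢l (≡.cong suc p)) in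
    f zero + m , Nat-+ (h zero) hm , trans (+-congˡ e) (solve 4 (λ a b d m → a :+ (b :+ d :+ m) := b :+ d :+ (a :+ m)) refl (f zero) (f (suc k)) (f (suc l)) m)

  Nat≈0-term : ∀ {r} (P : Fin r → Bool) → sum (λ i → 𝟙 K (P i)) ≈ 0# → ∀ i → P i ≡ false
  Nat≈0-term P e i = 𝟙-injective (P i) false (Nat-sum≈0 (λ i → Nat-𝟙 (P i)) e i)

  1+1+Nat≉1 : ∀ {m} → IsNat m → ¬ (1# + 1# + m ≈ 1#)
  1+1+Nat≉1 {m} hm e = 1≉0 (Nat-+≈0 Nat-1 hm (begin
    1# + m             ≈⟨ solve 2 (λ a m → a :+ m := (a :+ a :+ m) :- a) refl 1# m ⟩
    (1# + 1# + m) - 1# ≈⟨ +-congʳ e ⟩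
    1# - 1#            ≈⟨ -‿inverseʳ 1# ⟩
    0#                 ∎))
    where open ≈R

  -- The standard basis of a coherent algebra as a colouring of the pairs of points:
  -- each pair has one colour, each colour occurs, and the members of the algebra are
  -- the matrices that are constant on the colours.
  module Colours {n r : ℕ} {p : Level} {𝒜 : Matrix K n → Set p} (coh : IsCoherentAlgebra K 𝒜) (S : StandardBasis K 𝒜 r) where
    open StandardBasis S public
    open IsCoherentAlgebra coh

    Basis-Nat : ∀ x y k → IsNat (𝟙 K (B k x y))
    Basis-Nat x y k = Nat-𝟙 (B k x y)

    disjoint : ∀ {k l x y} → B k x y ≡ true → B l x y ≡ true → k ≡ l
    disjoint {k} {l} {x} {y} p q = decide (k ≟ᶠ l)
      where
      decide : Dec (k ≡ l) → k ≡ l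
      decide (yes e) = e
      decide (no k≢l) =
        let m , hm , e = Nat-split₂ (Basis-Nat x y) k l k≢l in
        ⊥-elim (1+1+Nat≉1 hm (trans (+-congʳ (+-cong (reflexive (≡.cong (𝟙 K) (≡.sym p))) (reflexive (≡.cong (𝟙 K) (≡.sym q))))) (trans (sym e) (sum-is-J x y))))

    total : ∀ x y → ∃[ k ] B k x y ≡ true
    total x y = decide (any? λ k → B k x y ≟ᵇ true)
      where
      decide : Dec (∃[ k ] B k x y ≡ true) → ∃[ k ] B k x y ≡ true
      decide (yes p) = p
      decide (no ¬p) = ⊥-elim (1≉0 (trans (sym (sum-is-J x y)) (sum-0 {f = λ k → 𝟙 K (B k x y)} λ k → reflexive (≡.cong (𝟙 K) (¬true⇒false λ q → ¬p (k , q))))))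

    colour : Fin n → Fin n → Fin r
    colour x y = proj₁ (total x y)

    B-colour : ∀ x y → B (colour x y) x y ≡ true
    B-colour x y = proj₂ (total x y)

    colour-unique : ∀ {k x y} → B k x y ≡ true → colour x y ≡ k
    colour-unique {k} {x} {y} p = disjoint (B-colour x y) p

    nonempty : ∀ k → ∃[ x ] ∃[ y ] B k x y ≡ true
    nonempty k = decide (any? λ x → any? λ y → B k x y ≟ᵇ true)
      where
      decide : Dec (∃[ x ] ∃[ y ] B k x y ≡ true) → ∃[ x ] ∃[ y ] B k x y ≡ true
      decide (yes p) = p
      decide (no ¬p) = ⊥-elim (1≉0 (trans (sym (basis-diag k)) (independent (basis k)
        (λ x y → trans (dot-basis k (λ l → 𝟙 K (B l x y))) (reflexive (≡.cong (𝟙 K) (¬true⇒false λ q → ¬p (x , y , q))))) k)))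
        where
        basis-diag : ∀ {m} (k : Fin m) → basis k k ≈ 1#
        basis-diag k with k ≟ᶠ k
        ... | yes _ = refl
        ... | no q  = ⊥-elim (q ≡.refl)

    B-determined : ∀ {x y x′ y′} → colour x y ≡ colour x′ y′ → ∀ k → B k x y ≡ B k x′ y′
    B-determined {x} {y} {x′} {y′} e k = ⇔⇒≡ (go e) (go (≡.sym e))
      where
      go : ∀ {x y x′ y′} → colour x y ≡ colour x′ y′ → B k x y ≡ true → B k x′ y′ ≡ true
      go {x} {y} {x′} {y′} e p = ≡.subst (λ k → B k x′ y′ ≡ true) (≡.trans (≡.sym e) (colour-unique p)) (B-colour x′ y′)

    constant : ∀ {M} → 𝒜 M → ∀ {x y x′ y′} → colour x y ≡ colour x′ y′ → M x y ≈ M x′ y′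
    constant {M} hM {x} {y} {x′} {y′} e =
      let a , span = spanning hM in
      trans (span x y) (trans (sum-cong-≋ λ k → *-congˡ (reflexive (≡.cong (𝟙 K) (B-determined e k)))) (sym (span x′ y′)))

-- Joins of two regular graphs with three eigenvalues

module Joins {c ℓ₁ ℓ₂ : Level} (K : HeytingField c ℓ₁ ℓ₂) (char0 : CharacteristicZero K)
  (closed : AlgebraicallyClosed K) where

  open Field K char0
  open LinearAlgebra K char0
  open Factorisation K char0 closed
  open Matrices K char0 closed
  open Positivity K char0 closed
  open StandardBases K char0

  -- Equality of truth values.
  _≡ᵇ_ : Bool → Bool → Bool
  true  ≡ᵇ β = β
  false ≡ᵇ β = not β

  ≡ᵇ-true : ∀ {α β} → (α ≡ᵇ β) ≡ true → α ≡ β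
  ≡ᵇ-true {true}  {true}  _ = ≡.refl
  ≡ᵇ-true {false} {false} _ = ≡.refl

  ≡ᵇ-refl : ∀ α → (α ≡ᵇ α) ≡ true
  ≡ᵇ-refl true  = ≡.refl
  ≡ᵇ-refl false = ≡.refl

  ≡ᵇ-sym : ∀ α β → (α ≡ᵇ β) ≡ (β ≡ᵇ α)
  ≡ᵇ-sym true  true  = ≡.refl
  ≡ᵇ-sym true  false = ≡.refl
  ≡ᵇ-sym false true  = ≡.refl
  ≡ᵇ-sym false false = ≡.refl

  -- The two indices other than i.
  others : (i : Fin 3) → Σ (Fin 3) λ j → Σ (Fin 3) λ k → ∀ l → l ≡ i ⊎ l ≡ j ⊎ l ≡ k
  others zero = suc zero , suc (suc zero) , λ
    { zero → inj₁ ≡.refl ; (suc zero) → inj₂ (inj₁ ≡.refl) ; (suc (suc zero)) → inj₂ (inj₂ ≡.refl) }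
  others (suc zero) = zero , suc (suc zero) , λ
    { zero → inj₂ (inj₁ ≡.refl) ; (suc zero) → inj₁ ≡.refl ; (suc (suc zero)) → inj₂ (inj₂ ≡.refl) }
  others (suc (suc zero)) = zero , suc zero , λ
    { zero → inj₂ (inj₁ ≡.refl) ; (suc zero) → inj₂ (inj₂ ≡.refl) ; (suc (suc zero)) → inj₁ ≡.refl }

  -- The sides of Γ are the two fibres of b : points → Bool, of which one may be empty.
  -- C is adjacency within the sides, and X is J between the sides.
  module Within {n : ℕ} (Γ : Graph n) (b : Fin n → Bool) where
    open Graph Γ

    C : BoolMatrix n
    C x y = adj x y ∧ (b x ≡ᵇ b y)

    C-sym : ∀ x y → C x y ≡ C y x
    C-sym x y = ≡.cong₂ _∧_ (adj-sym x y) (≡ᵇ-sym (b x) (b y))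

    C⇒≡ : ∀ x y → C x y ≡ true → b x ≡ b y
    C⇒≡ x y h = ≡ᵇ-true (proj {adj x y} h)
      where
      proj : ∀ {p q} → p ∧ q ≡ true → q ≡ true
      proj {true} h = h

    X : Matrix K n
    X x y = 𝟙 K (not (b x ≡ᵇ b y))

    adjacency-split : (∀ x y → b x ≢ b y → adj x y ≡ true) → ∀ x y → adjacency K Γ x y ≈ ⟦_⟧ K C x y + X x y
    adjacency-split join x y = go (b x) (b y) (adj x y) (join x y)
      where
      go : ∀ β β′ a → (β ≢ β′ → a ≡ true) → 𝟙 K a ≈ 𝟙 K (a ∧ (β ≡ᵇ β′)) + 𝟙 K (not (β ≡ᵇ β′))
      go true  true  true  h = sym (+-identityʳ _)
      go true  true  false h = sym (+-identityʳ _)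
      go false false true  h = sym (+-identityʳ _)
      go false false false h = sym (+-identityʳ _)
      go true  false true  h = sym (+-identityˡ _)
      go false true  true  h = sym (+-identityˡ _)
      go true  false false h with h (λ ())
      ... | ()
      go false true  false h with h (λ ())
      ... | ()

  -- Γ is a join of its two sides, and each side is regular.  If Γ has three eigenvalues,
  -- then on each side one of them does not occur among the eigenvectors in V, so that
  -- the square of A is a combination of I, A and J there.
  module Join {n : ℕ} (Γ : Graph n) (connected : Connected Γ) (ED : ExactlyDistinctEigenvalues K 3 (adjacency K Γ))
              (b : Fin n → Bool) (join : ∀ x y → b x ≢ b y → Graph.adj Γ x y ≡ true)
              (k : Bool → HeytingField.Carrier K)
              (regular : ∀ x → HeytingField._≈_ K (Symmetric.deg (Within.C Γ b) (Within.C-sym Γ b) x) (k (b x))) where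
    open Graph Γ
    open ExactlyDistinctEigenvalues ED using (θ; exhaustive)
    open Within Γ b
    open Symmetric C C-sym
    open Laplacian C C-sym

    adjacency≈ : ∀ x y → adjacency K Γ x y ≈ A x y + X x y
    adjacency≈ = adjacency-split join

    mv-adjacency : ∀ v x → mv (adjacency K Γ) v x ≈ mv A v x + mv X v x
    mv-adjacency v x = sum-⊕ (λ y → A x y * v y) (λ y → X x y * v y) λ y → trans (*-congʳ (adjacency≈ x y)) (distribʳ (v y) (A x y) (X x y))

    module Side (β : Bool) where
      P : Fin n → Bool
      P x = b x ≡ᵇ β

      open Block P (λ x y Cxy → ≡.cong (_≡ᵇ β) (C⇒≡ x y Cxy)) (k β)
                 (λ x Px → trans (regular x) (reflexive (≡.cong k (≡ᵇ-true Px)))) public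

      -- X kills V, so that eigenvectors of A in V are eigenvectors of Γ.
      mv-X : ∀ {v} → V v → mv X v ≐ 𝟎
      mv-X {v} (h , s) x = decide (b x ≟ᵇ β)
        where
        decide : Dec (b x ≡ β) → mv X v x ≈ 0#
        decide (yes e) = sum-0 {f = λ y → X x y * v y} λ y → trans
          (𝟙*-cong (not (b x ≡ᵇ b y)) {v y} {0#} λ p → h y (lem (b x) (b y) e p)) (zeroʳ _)
          where
          lem : ∀ α α′ → α ≡ β → not (α ≡ᵇ α′) ≡ true → (α′ ≡ᵇ β) ≡ false
          lem true  false ≡.refl p = ≡.refl
          lem false true  ≡.refl p = ≡.refl
        decide (no b≢β) = trans (sum-cong-≋ λ y → lem (b x) (b y) (v y) b≢β (h y)) s
          where
          lem : ∀ α α′ t → α ≢ β → ((α′ ≡ᵇ β) ≡ false → t ≈ 0#) → 𝟙 K (not (α ≡ᵇ α′)) * t ≈ t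
          lem α α′ t = go α α′ β
            where
            go : ∀ α α′ β → α ≢ β → ((α′ ≡ᵇ β) ≡ false → t ≈ 0#) → 𝟙 K (not (α ≡ᵇ α′)) * t ≈ t
            go true  true  true  p z = ⊥-elim (p ≡.refl)
            go true  true  false p z = trans (zeroˡ t) (sym (z ≡.refl))
            go true  false true  p z = ⊥-elim (p ≡.refl)
            go true  false false p z = *-identityˡ t
            go false true  true  p z = *-identityˡ t
            go false true  false p z = ⊥-elim (p ≡.refl)
            go false false true  p z = trans (zeroˡ t) (sym (z ≡.refl))
            go false false false p z = ⊥-elim (p ≡.refl)

      eigenvalue : ∀ {z v} → V v → mv A v ≐ z ⊛ v → ∀ {x} → v x # 0# → ∃[ i ] z ≈ θ i
      eigenvalue {z} {v} Vv e {x} p = exhaustive z (v , (x , p) , λ y →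
        trans (mv-adjacency v y) (trans (+-cong (e y) (mv-X Vv y)) (+-identityʳ _)))

      -- The eigenvalue θ i has no eigenvectors in V.
      Missing : Fin 3 → Set (c ⊔ ℓ₁)
      Missing i = ∀ {v} → V v → mv A v ≐ θ i ⊛ v → v ≐ 𝟎

      missing⇒relation : ∀ {x₀} → P x₀ ≡ true → ∀ i → Missing i → Relation
      missing⇒relation Px₀ i missing =
        let j , l , cover = others i in relation (θ j) (θ l) (two j l cover) Px₀
        where
        two : ∀ j l → (∀ m → m ≡ i ⊎ m ≡ j ⊎ m ≡ l) → ∀ z {v} → V v → mv A v ≐ z ⊛ v → ∀ {x} → v x # 0# → z ≈ θ j ⊎ z ≈ θ l
        two j l cover z {v} Vv e {x} p =
          let m , z≈ = eigenvalue Vv e p in which m z≈ (cover m)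
          where
          which : ∀ m → z ≈ θ m → m ≡ i ⊎ m ≡ j ⊎ m ≡ l → z ≈ θ j ⊎ z ≈ θ l
          which m z≈ (inj₁ ≡.refl)        = ⊥-elim (#⇒≉ p (missing Vv (λ y → trans (e y) (*-congʳ z≈)) x))
          which m z≈ (inj₂ (inj₁ ≡.refl)) = inj₁ z≈
          which m z≈ (inj₂ (inj₂ ≡.refl)) = inj₂ z≈

      lap-eigen : ∀ {z v} → V v → mv A v ≐ z ⊛ v → mv Lap v ≐ (k β - z) ⊛ v
      lap-eigen {z} {v} (h , _) e x = begin
        mv Lap v x                 ≈⟨ lap v x ⟩
        deg x * v x - mv A v x     ≈⟨ +-cong (deg-v (P x ≟ᵇ true)) (-‿cong (e x)) ⟩
        k β * v x - z * v x        ≈⟨ solve 3 (λ k z v → k :* v :- z :* v := (k :- z) :* v) refl (k β) z (v x) ⟩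
        (k β - z) * v x            ∎
        where
        open ≈R
        deg-v : Dec (P x ≡ true) → deg x * v x ≈ k β * v x
        deg-v (yes p) = *-congʳ (trans (regular x) (reflexive (≡.cong k (≡ᵇ-true p))))
        deg-v (no ¬p) = trans (*-congˡ v≈0) (trans (zeroʳ _) (sym (trans (*-congˡ v≈0) (zeroʳ _))))
          where
          v≈0 : v x ≈ 0#
          v≈0 = h x (¬true⇒false ¬p)

      -- Only one side: k β is the valency of Γ.  Its eigenvectors are harmonic, hence it
      -- does not occur in V.
      module Single (one-sided : ∀ x → b x ≡ β) (x₀ : Fin n) where

        X≈0 : ∀ x y → X x y ≈ 0#
        X≈0 x y = reflexive (≡.cong (𝟙 K) (≡.trans (≡.cong₂ (λ α α′ → not (α ≡ᵇ α′)) (one-sided x) (one-sided y)) (≡.cong not (≡ᵇ-refl β))))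

        valency : ∃[ i ] k β ≈ θ i
        valency = exhaustive (k β) ((λ _ → 1#) , (x₀ , 1#0) , λ x → begin
          mv (adjacency K Γ) (λ _ → 1#) x              ≈⟨ mv-adjacency (λ _ → 1#) x ⟩
          mv A (λ _ → 1#) x + mv X (λ _ → 1#) x        ≈⟨ +-cong (sum-cong-≋ λ y → *-identityʳ (A x y)) (sum-0 {f = λ y → X x y * 1#} λ y → trans (*-identityʳ _) (X≈0 x y)) ⟩
          deg x + 0#                                   ≈⟨ +-identityʳ _ ⟩
          deg x                                        ≈⟨ regular x ⟩
          k (b x)                                      ≈⟨ reflexive (≡.cong k (one-sided x)) ⟩
          k β                                          ≈⟨ *-identityʳ _ ⟨
          k β * 1#                                     ∎)
          where open ≈R

        missing : Missing (proj₁ valency)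
        missing {v} Vv e = harmonic (λ x y → gmap id (λ {x} {y} → T-C x y) (connected x y)) (λ x →
          trans (lap-eigen Vv e x) (trans (*-congʳ (trans (+-congʳ (proj₂ valency)) (-‿inverseʳ _))) (zeroˡ _))) (proj₂ Vv)
          where
          T-C : ∀ x y → T (adj x y) → T (C x y)
          T-C x y t = ≡.subst T (≡.sym (≡.trans (≡.cong (adj x y ∧_) (≡.trans (≡.cong₂ _≡ᵇ_ (one-sided x) (one-sided y)) (≡ᵇ-refl β))) (∧-true (adj x y)))) t
            where
            ∧-true : ∀ p → p ∧ true ≡ p
            ∧-true true  = ≡.refl
            ∧-true false = ≡.refl

      -- Both sides: the two roots λ₁ and λ₂ of (z - k₁) (z - k₂) = n₁ n₂ are eigenvalues
      -- of Γ, with eigenvectors that are constant on the sides.  As the product of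
      -- k₁ - λ₁ and k₁ - λ₂ is - n₁ n₂, not both λ₁ and λ₂ occur in V.
      module Double (x₀ x₁ : Fin n) (b₀ : b x₀ ≡ β) (b₁ : b x₁ ≡ not β) where

        -- The number of points on a side.
        size : Bool → Carrier
        size γ = sum λ x → 𝟙 K (b x ≡ᵇ γ)

        Nat-size : ∀ γ → IsNat (size γ)
        Nat-size γ = Nat-sum λ x → Nat-𝟙 (b x ≡ᵇ γ)

        size#0 : ∀ γ x → b x ≡ γ → size γ # 0#
        size#0 γ x e = go (Int-dec (Nat⇒Int (Nat-size γ)))
          where
          go : size γ ≈ 0# ⊎ size γ # 0# → size γ # 0#
          go (inj₂ p) = p
          go (inj₁ p) = ⊥-elim (absurd (≡.trans (≡.sym (≡.trans (≡.cong (_≡ᵇ γ) e) (≡ᵇ-refl γ))) (Nat≈0-term (λ x → b x ≡ᵇ γ) p x)))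
            where
            absurd : ¬ (true ≡ false)
            absurd ()

        k₁ k₂ n₁ n₂ N : Carrier
        k₁ = k β
        k₂ = k (not β)
        n₁ = size β
        n₂ = size (not β)
        N  = n₁ * n₂

        -- The eigenvector for the root z, as a function of the side.
        e : Carrier → Bool → Carrier
        e z α = if α ≡ᵇ β then n₂ else z - k₁

        e-β : ∀ z → e z β ≈ n₂
        e-β z = reflexive (≡.cong (λ p → if p then n₂ else z - k₁) (≡ᵇ-refl β))

        e-¬β : ∀ z → e z (not β) ≈ z - k₁
        e-¬β z = reflexive (≡.cong (λ p → if p then n₂ else z - k₁) (not≡ᵇ β))
          where
          not≡ᵇ : ∀ β → (not β ≡ᵇ β) ≡ false
          not≡ᵇ true  = ≡.refl
          not≡ᵇ false = ≡.refl

        mv-A-const : ∀ (f : Bool → Carrier) x → mv A (f ∘ b) x ≈ k (b x) * f (b x)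
        mv-A-const f x = begin
          sum (λ y → A x y * f (b y))   ≈⟨ sum-cong-≋ (λ y → 𝟙*-cong (C x y) λ Cxy → reflexive (≡.cong f (≡.sym (C⇒≡ x y Cxy)))) ⟩
          sum (λ y → A x y * f (b x))   ≈⟨ *-distribʳ-sum (f (b x)) (A x) ⟨
          deg x * f (b x)               ≈⟨ *-congʳ (regular x) ⟩
          k (b x) * f (b x)             ∎
          where open ≈R

        mv-X-const : ∀ (f : Bool → Carrier) x → mv X (f ∘ b) x ≈ size (not (b x)) * f (not (b x))
        mv-X-const f x = trans (sum-cong-≋ λ y → lem (b x) (b y)) (sym (*-distribʳ-sum (f (not (b x))) (λ y → 𝟙 K (b y ≡ᵇ not (b x)))))
          where
          lem : ∀ α α′ → 𝟙 K (not (α ≡ᵇ α′)) * f α′ ≈ 𝟙 K (α′ ≡ᵇ not α) * f (not α)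
          lem true  true  = trans (zeroˡ _) (sym (zeroˡ _))
          lem true  false = refl
          lem false true  = refl
          lem false false = trans (zeroˡ _) (sym (zeroˡ _))

        is-eigenvalue : ∀ z → (z - k₁) * (z - k₂) ≈ N → ∃[ i ] z ≈ θ i
        is-eigenvalue z q = exhaustive z ((λ x → e z (b x)) , (x₀ , nonzero) , λ x → begin
          mv (adjacency K Γ) (e z ∘ b) x                            ≈⟨ mv-adjacency (e z ∘ b) x ⟩
          mv A (e z ∘ b) x + mv X (e z ∘ b) x                       ≈⟨ +-cong (mv-A-const (e z) x) (mv-X-const (e z) x) ⟩
          k (b x) * e z (b x) + size (not (b x)) * e z (not (b x))  ≈⟨ sides (b x) ⟩
          z * e z (b x)                                             ∎)
          where
          open ≈R
          nonzero : e z (b x₀) # 0#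
          nonzero = #-congʳ (sym (trans (reflexive (≡.cong (e z) b₀)) (e-β z))) (size#0 (not β) x₁ b₁)
          at-β : k β * e z β + size (not β) * e z (not β) ≈ z * e z β
          at-β = begin
            k₁ * e z β + n₂ * e z (not β)   ≈⟨ +-cong (*-congˡ (e-β z)) (*-congˡ (e-¬β z)) ⟩
            k₁ * n₂ + n₂ * (z - k₁)         ≈⟨ solve 3 (λ k n z → k :* n :+ n :* (z :- k) := z :* n) refl k₁ n₂ z ⟩
            z * n₂                          ≈⟨ *-congˡ (e-β z) ⟨
            z * e z β                       ∎
          at-¬β : k (not β) * e z (not β) + size β * e z β ≈ z * e z (not β)
          at-¬β = begin
            k₂ * e z (not β) + n₁ * e z β             ≈⟨ +-cong (*-congˡ (e-¬β z)) (trans (*-congˡ (e-β z)) (sym q)) ⟩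
            k₂ * (z - k₁) + (z - k₁) * (z - k₂)       ≈⟨ solve 3 (λ k l z → l :* (z :- k) :+ (z :- k) :* (z :- l) := z :* (z :- k)) refl k₁ k₂ z ⟩
            z * (z - k₁)                              ≈⟨ *-congˡ (e-¬β z) ⟨
            z * e z (not β)                           ∎
          sides : ∀ α → k α * e z α + size (not α) * e z (not α) ≈ z * e z α
          sides α = go α β at-β at-¬β
            where
            go : ∀ α β′ → k β′ * e z β′ + size (not β′) * e z (not β′) ≈ z * e z β′ →
                 k (not β′) * e z (not β′) + size β′ * e z β′ ≈ z * e z (not β′) →
                 k α * e z α + size (not α) * e z (not α) ≈ z * e z α
            go true  true  p q = p
            go false false p q = p
            go true  false p q = q
            go false true  p q = q

        coefficients : Vect 2
        coefficients zero    = k₁ * k₂ - N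
        coefficients (suc _) = - (k₁ + k₂)

        λ₁ λ₂ : Carrier
        λ₁ = proj₁ (root coefficients)
        λ₂ = k₁ + k₂ - λ₁

        q₁ : (λ₁ - k₁) * (λ₁ - k₂) ≈ N
        q₁ = begin
          (λ₁ - k₁) * (λ₁ - k₂)
            ≈⟨ solve 4 (λ z k l n → (z :- k) :* (z :- l) := (k :* l :- n :+ z :* (:- (k :+ l) :+ z :* :1)) :+ n) refl λ₁ k₁ k₂ N ⟩
          evalM coefficients λ₁ + N   ≈⟨ +-congʳ (proj₂ (root coefficients)) ⟩
          0# + N                      ≈⟨ +-identityˡ N ⟩
          N                           ∎
          where open ≈R

        q₂ : (λ₂ - k₁) * (λ₂ - k₂) ≈ N
        q₂ = trans (solve 3 (λ z k l → ((k :+ l :- z) :- k) :* ((k :+ l :- z) :- l) := (z :- k) :* (z :- l)) refl λ₁ k₁ k₂) q₁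

        product : (k₁ - λ₁) * (k₁ - λ₂) + N ≈ 0#
        product = begin
          (k₁ - λ₁) * (k₁ - λ₂) + N                ≈⟨ +-congˡ q₁ ⟨
          (k₁ - λ₁) * (k₁ - λ₂) + (λ₁ - k₁) * (λ₁ - k₂)
            ≈⟨ solve 3 (λ z k l → (k :- z) :* (k :- (k :+ l :- z)) :+ (z :- k) :* (z :- l) := :0) refl λ₁ k₁ k₂ ⟩
          0# ∎
          where open ≈R

        i₁ : ∃[ i ] λ₁ ≈ θ i
        i₁ = is-eigenvalue λ₁ q₁

        i₂ : ∃[ i ] λ₂ ≈ θ i
        i₂ = is-eigenvalue λ₂ q₂

        one-missing : ¬ Missing (proj₁ i₂) → Missing (proj₁ i₁)
        one-missing ¬m {v} Vv ev x = ¬#⇒≈ λ vx#0 → ¬m λ {w} Vw ew y →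
          cancel vx#0 (no-negative-product (Nat-* (Nat-size β) (Nat-size (not β)))
            (x#0y#0→xy#0 (size#0 β x₀ b₀) (size#0 (not β) x₁ b₁)) v w
            (lap-eigen Vv λ z → trans (ev z) (*-congʳ (sym (proj₂ i₁))))
            (lap-eigen Vw λ z → trans (ew z) (*-congʳ (sym (proj₂ i₂)))) product x y)

      -- A double negation, as it is not decidable which of λ₁ and λ₂ occurs in V.
      relation? : ¬ ¬ Relation
      relation? ¬rel = cases (any? λ x → b x ≟ᵇ β) (any? λ x → b x ≟ᵇ not β)
        where
        b≡ : ∀ {x} → b x ≢ not β → b x ≡ β
        b≡ {x} h = go (b x) β h
          where
          go : ∀ α β → α ≢ not β → α ≡ β
          go true  true  h = ≡.refl
          go true  false h = ⊥-elim (h ≡.refl)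
          go false true  h = ⊥-elim (h ≡.refl)
          go false false h = ≡.refl
        P-true : ∀ {x} → b x ≡ β → P x ≡ true
        P-true p = ≡.trans (≡.cong (_≡ᵇ β) p) (≡ᵇ-refl β)
        cases : Dec (∃[ x ] b x ≡ β) → Dec (∃[ x ] b x ≡ not β) → ⊥
        cases (no ¬p) _ = ¬rel (0# , 0# , 0# , λ x y Px _ → ⊥-elim (¬p (x , ≡ᵇ-true Px)))
        cases (yes (x₀ , b₀)) (no ¬p) = ¬rel (missing⇒relation (P-true b₀) _ (Single.missing (λ x → b≡ λ p → ¬p (x , p)) x₀))
        cases (yes (x₀ , b₀)) (yes (x₁ , b₁)) =
          let open Double x₀ x₁ b₀ b₁ in
          ¬rel (missing⇒relation (P-true b₀) (proj₁ i₁) (one-missing λ m → ¬rel (missing⇒relation (P-true b₀) (proj₁ i₂) m)))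

-- A coherent algebra of rank at most eight

module CoarseAlgebras {c ℓ₁ ℓ₂ : Level} (K : HeytingField c ℓ₁ ℓ₂) (char0 : CharacteristicZero K)
  (closed : AlgebraicallyClosed K) where

  open Field K char0
  open LinearAlgebra K char0
  open Matrices K char0 closed
  open StandardBases K char0
  open Joins K char0 closed

  -- The entry at (x , y) of the matrix that is α I + d A + e J, with coefficients
  -- depending on the sides β and β′ of x and y; here δ and a are the entries of I and
  -- of the adjacency matrix A within the sides.
  entry : (α d : Bool → Carrier) (e : Bool → Bool → Carrier) → Bool → Bool → Carrier → Carrier → Carrier
  entry α d e β β′ δ a = α β * δ + d β * a + e β β′

  -- Pairs of points fall into eight classes, according to their sides and whether they
  -- are equal or adjacent within a side; value is the entry on each class.
  class : Bool → Bool → Bool → Bool → Fin 8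
  class true  true  true  _     = 0F
  class true  true  false true  = 1F
  class true  true  false false = 2F
  class false false true  _     = 3F
  class false false false true  = 4F
  class false false false false = 5F
  class true  false _     _     = 6F
  class false true  _     _     = 7F

  value : (α d : Bool → Carrier) (e : Bool → Bool → Carrier) → Fin 8 → Carrier
  value α d e 0F = α true + e true true
  value α d e 1F = d true + e true true
  value α d e 2F = e true true
  value α d e 3F = α false + e false false
  value α d e 4F = d false + e false false
  value α d e 5F = e false false
  value α d e 6F = e true false
  value α d e 7F = e false true

  -- The possible positions of a pair of points: the two sides, whether the points are
  -- equal, and whether they are adjacent within a side.
  data Position : Bool → Bool → Bool → Bool → Set where
    equal    : ∀ {β} → Position β β true false
    adjacent : ∀ {β} → Position β β false true
    distant  : ∀ {β β′} → Position β β′ false false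

  entry-equal : ∀ x y z → x * 1# + y * 0# + z ≈ x + z
  entry-equal = solve 3 (λ x y z → x :* :1 :+ y :* :0 :+ z := x :+ z) refl

  entry-adjacent : ∀ x y z → x * 0# + y * 1# + z ≈ y + z
  entry-adjacent = solve 3 (λ x y z → x :* :0 :+ y :* :1 :+ z := y :+ z) refl

  entry-distant : ∀ x y z → x * 0# + y * 0# + z ≈ z
  entry-distant = solve 3 (λ x y z → x :* :0 :+ y :* :0 :+ z := z) refl

  entry≈value : ∀ α d e {β β′ δ a} → Position β β′ δ a → entry α d e β β′ (𝟙 K δ) (𝟙 K a) ≈ value α d e (class β β′ δ a)
  entry≈value α d e (equal {true})           = entry-equal _ _ _
  entry≈value α d e (equal {false})          = entry-equal _ _ _
  entry≈value α d e (adjacent {true})        = entry-adjacent _ _ _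
  entry≈value α d e (adjacent {false})       = entry-adjacent _ _ _
  entry≈value α d e (distant {true} {true})  = entry-distant _ _ _
  entry≈value α d e (distant {true} {false}) = entry-distant _ _ _
  entry≈value α d e (distant {false} {true}) = entry-distant _ _ _
  entry≈value α d e (distant {false} {false}) = entry-distant _ _ _

  entry-* : ∀ α d e α′ d′ e′ {β β′ δ a} → Position β β′ δ a →
    entry α d e β β′ (𝟙 K δ) (𝟙 K a) * entry α′ d′ e′ β β′ (𝟙 K δ) (𝟙 K a) ≈
    entry (λ β → α β * α′ β + α β * e′ β β + e β β * α′ β) (λ β → d β * d′ β + d β * e′ β β + e β β * d′ β)
          (λ β β′ → e β β′ * e′ β β′) β β′ (𝟙 K δ) (𝟙 K a)
  entry-* α d e α′ d′ e′ equal = solve 6 (λ a d e a′ d′ e′ →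
      (a :* :1 :+ d :* :0 :+ e) :* (a′ :* :1 :+ d′ :* :0 :+ e′) :=
      (a :* a′ :+ a :* e′ :+ e :* a′) :* :1 :+ (d :* d′ :+ d :* e′ :+ e :* d′) :* :0 :+ e :* e′)
    refl (α _) (d _) (e _ _) (α′ _) (d′ _) (e′ _ _)
  entry-* α d e α′ d′ e′ adjacent = solve 6 (λ a d e a′ d′ e′ →
      (a :* :0 :+ d :* :1 :+ e) :* (a′ :* :0 :+ d′ :* :1 :+ e′) :=
      (a :* a′ :+ a :* e′ :+ e :* a′) :* :0 :+ (d :* d′ :+ d :* e′ :+ e :* d′) :* :1 :+ e :* e′)
    refl (α _) (d _) (e _ _) (α′ _) (d′ _) (e′ _ _)
  entry-* α d e α′ d′ e′ distant = solve 8 (λ a d e a′ d′ e′ r s →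
      (a :* :0 :+ d :* :0 :+ e) :* (a′ :* :0 :+ d′ :* :0 :+ e′) :=
      r :* :0 :+ s :* :0 :+ e :* e′)
    refl (α _) (d _) (e _ _) (α′ _) (d′ _) (e′ _ _) _ _

  entry-transpose : ∀ α d e {β β′ δ a} → Position β β′ δ a →
    entry α d e β′ β (𝟙 K δ) (𝟙 K a) ≈ entry α d (λ β β′ → e β′ β) β β′ (𝟙 K δ) (𝟙 K a)
  entry-transpose α d e equal    = refl
  entry-transpose α d e adjacent = refl
  entry-transpose α d e distant  = trans (entry-distant _ _ _) (sym (entry-distant _ _ _))

  -- If the square of A is a combination of I, A and J on each side, then the matrices
  -- that are constant on the eight classes form a coherent algebra.
  module Coarse {n : ℕ} (C : BoolMatrix n) (C-sym : ∀ x y → C x y ≡ C y x) (C-loopless : ∀ x → C x x ≡ false)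
                (b : Fin n → Bool) (C⇒≡ : ∀ x y → C x y ≡ true → b x ≡ b y)
                (k : Bool → HeytingField.Carrier K)
                (regular : ∀ x → HeytingField._≈_ K (Symmetric.deg C C-sym x) (k (b x)))
                (u v w : Bool → HeytingField.Carrier K)
                (relation : ∀ x y → b x ≡ b y → sum (λ z → ⟦_⟧ K C x z * ⟦_⟧ K C z y) ≈ u (b x) * basis x y + v (b x) * ⟦_⟧ K C x y + w (b x)) where
    open Symmetric C C-sym

    position : ∀ x y → Position (b x) (b y) ⌊ x ≟ᶠ y ⌋ (C x y)
    position x y with x ≟ᶠ y | C x y in Cxy
    ... | yes ≡.refl | false = equal
    ... | yes ≡.refl | true with ≡.trans (≡.sym Cxy) (C-loopless x)
    ...   | ()
    position x y | no _ | true  = ≡.subst (λ β → Position (b x) β false true) (C⇒≡ x y Cxy) adjacent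
    position x y | no _ | false = distant

    𝒜 : Matrix K n → Set (c ⊔ ℓ₁)
    𝒜 M = Σ (Bool → Carrier) λ α → Σ (Bool → Carrier) λ d → Σ (Bool → Bool → Carrier) λ e →
      ∀ x y → M x y ≈ entry α d e (b x) (b y) (basis x y) (A x y)

    cell : Fin n → Fin n → Fin 8
    cell x y = class (b x) (b y) ⌊ x ≟ᶠ y ⌋ (C x y)

    constant-on-cells : ∀ {M} → 𝒜 M → ∀ {x y x′ y′} → cell x y ≡ cell x′ y′ → M x y ≈ M x′ y′
    constant-on-cells (α , d , e , h) {x} {y} {x′} {y′} p =
      trans (h x y) (trans (entry≈value α d e (position x y))
        (trans (reflexive (≡.cong (value α d e) p))
        (sym (trans (h x′ y′) (entry≈value α d e (position x′ y′))))))

    A*f : ∀ (f : Bool → Carrier) x y → A x y * f (b y) ≈ A x y * f (b x)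
    A*f f x y = 𝟙*-cong (C x y) λ Cxy → reflexive (≡.cong f (≡.sym (C⇒≡ x y Cxy)))

    -- The coefficient of J in the square of A; it vanishes between the sides.
    S : Bool → Bool → Carrier
    S β β′ = w β * 𝟙 K (β ≡ᵇ β′)

    square : ∀ x y → sum (λ z → A x z * A z y) ≈ entry u v S (b x) (b y) (basis x y) (A x y)
    square x y = decide (b x ≟ᵇ b y)
      where
      open ≈R
      decide : Dec (b x ≡ b y) → sum (λ z → A x z * A z y) ≈ entry u v S (b x) (b y) (basis x y) (A x y)
      decide (yes p) = trans (relation x y p) (+-congˡ (sym (trans (*-congˡ (reflexive (≡.cong (𝟙 K) (≡.trans (≡.cong (b x ≡ᵇ_) (≡.sym p)) (≡ᵇ-refl (b x)))))) (*-identityʳ _))))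
      decide (no ¬p) = begin
        sum (λ z → A x z * A z y)
          ≈⟨ sum-0 {f = λ z → A x z * A z y} (λ z → trans (𝟙*-cong (C x z) {A z y} {0#} λ Cxz → reflexive (≡.cong (𝟙 K) (¬true⇒false λ Czy → ¬p (≡.trans (C⇒≡ x z Cxz) (C⇒≡ z y Czy))))) (zeroʳ _)) ⟩
        0#
          ≈⟨ entry-distant _ _ _ ⟨
        u (b x) * 0# + v (b x) * 0# + 0#
          ≈⟨ +-cong (+-cong (*-congˡ (reflexive (≡.cong (𝟙 K) (≡.sym basis-off)))) (*-congˡ (reflexive (≡.cong (𝟙 K) (≡.sym (¬true⇒false (λ Cxy → ¬p (C⇒≡ x y Cxy)))))))) S-off ⟩
        entry u v S (b x) (b y) (basis x y) (A x y) ∎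
        where
        basis-off : ⌊ x ≟ᶠ y ⌋ ≡ false
        basis-off = off (x ≟ᶠ y)
          where
          off : (q : Dec (x ≡ y)) → ⌊ q ⌋ ≡ false
          off (yes q) = ⊥-elim (¬p (≡.cong b q))
          off (no _)  = ≡.refl
        S-off : 0# ≈ S (b x) (b y)
        S-off = sym (trans (*-congˡ (reflexive (≡.cong (𝟙 K) (¬true⇒false λ q → ¬p (≡ᵇ-true q))))) (zeroʳ _))

    module _ (α d : Bool → Carrier) (e : Bool → Bool → Carrier) (α′ d′ : Bool → Carrier) (e′ : Bool → Bool → Carrier) where

      private
        E : Fin n → Fin n → Carrier
        E x y = entry α′ d′ e′ (b x) (b y) (basis x y) (A x y)

        -- The product of two matrices that are constant on the blocks.
        EE : Bool → Bool → Carrier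
        EE β β′ = sum λ z → e β (b z) * e′ (b z) β′

        product-A : ∀ x y → sum (λ z → A x z * E z y) ≈
          (α′ (b x) * A x y + d′ (b x) * sum (λ z → A x z * A z y)) + k (b x) * e′ (b x) (b y)
        product-A x y = begin
          sum (λ z → A x z * E z y)
            ≈⟨ sum-cong-≋ (λ z → trans (A*f (λ β → entry α′ d′ e′ β (b y) (basis z y) (A z y)) x z)
                 (solve 6 (λ a α δ d a′ e → a :* (α :* δ :+ d :* a′ :+ e) := (α :* (δ :* a) :+ d :* (a :* a′)) :+ a :* e) refl (A x z) (α′ (b x)) (basis z y) (d′ (b x)) (A z y) (e′ (b x) (b y)))) ⟩
          sum (λ z → (α′ (b x) * (basis z y * A x z) + d′ (b x) * (A x z * A z y)) + A x z * e′ (b x) (b y))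
            ≈⟨ trans (∑-distrib-+ (λ z → α′ (b x) * (basis z y * A x z) + d′ (b x) * (A x z * A z y)) (λ z → A x z * e′ (b x) (b y)))
                 (+-congʳ (∑-distrib-+ (λ z → α′ (b x) * (basis z y * A x z)) (λ z → d′ (b x) * (A x z * A z y)))) ⟩
          sum (λ z → α′ (b x) * (basis z y * A x z)) + sum (λ z → d′ (b x) * (A x z * A z y)) + sum (λ z → A x z * e′ (b x) (b y))
            ≈⟨ +-cong (+-cong
                 (trans (sym (*-distribˡ-sum (α′ (b x)) (λ z → basis z y * A x z))) (*-congˡ (trans (sum-cong-≋ λ z → *-congʳ (basis-sym z y)) (dot-basis y (A x)))))
                 (sym (*-distribˡ-sum (d′ (b x)) (λ z → A x z * A z y))))
                 (trans (sym (*-distribʳ-sum (e′ (b x) (b y)) (A x))) (*-congʳ (regular x))) ⟩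
          (α′ (b x) * A x y + d′ (b x) * sum (λ z → A x z * A z y)) + k (b x) * e′ (b x) (b y) ∎
          where open ≈R

        product-e : ∀ x y → sum (λ z → e (b x) (b z) * E z y) ≈
          (α′ (b y) * e (b x) (b y) + k (b y) * (e (b x) (b y) * d′ (b y))) + EE (b x) (b y)
        product-e x y = begin
          sum (λ z → e (b x) (b z) * E z y)
            ≈⟨ sum-cong-≋ (λ z → trans
                 (solve 6 (λ e α δ d a e′ → e :* (α :* δ :+ d :* a :+ e′) := (δ :* (α :* e) :+ a :* (e :* d)) :+ e :* e′) refl (e (b x) (b z)) (α′ (b z)) (basis z y) (d′ (b z)) (A z y) (e′ (b z) (b y)))
                 (+-congʳ (+-cong (*-congʳ (basis-sym z y)) (trans (*-congʳ (A-sym z y)) (A*f (λ β → e (b x) β * d′ β) y z))))) ⟩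
          sum (λ z → (basis y z * (α′ (b z) * e (b x) (b z)) + A y z * (e (b x) (b y) * d′ (b y))) + e (b x) (b z) * e′ (b z) (b y))
            ≈⟨ trans (∑-distrib-+ (λ z → basis y z * (α′ (b z) * e (b x) (b z)) + A y z * (e (b x) (b y) * d′ (b y))) (λ z → e (b x) (b z) * e′ (b z) (b y)))
                 (+-congʳ (∑-distrib-+ (λ z → basis y z * (α′ (b z) * e (b x) (b z))) (λ z → A y z * (e (b x) (b y) * d′ (b y))))) ⟩
          sum (λ z → basis y z * (α′ (b z) * e (b x) (b z))) + sum (λ z → A y z * (e (b x) (b y) * d′ (b y))) + EE (b x) (b y)
            ≈⟨ +-congʳ (+-cong (dot-basis y (λ z → α′ (b z) * e (b x) (b z)))
                 (trans (sym (*-distribʳ-sum (e (b x) (b y) * d′ (b y)) (A y))) (*-congʳ (regular y)))) ⟩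
          (α′ (b y) * e (b x) (b y) + k (b y) * (e (b x) (b y) * d′ (b y))) + EE (b x) (b y) ∎
          where open ≈R

      α″ d″ : Bool → Carrier
      α″ β = α β * α′ β + d β * (d′ β * u β)
      d″ β = α β * d′ β + d β * (α′ β + d′ β * v β)
      e″ : Bool → Bool → Carrier
      e″ β β′ = α β * e′ β β′ + d β * (d′ β * S β β′ + k β * e′ β β′) + ((α′ β′ * e β β′ + k β′ * (e β β′ * d′ β′)) + EE β β′)

      product : ∀ x y → sum (λ z → entry α d e (b x) (b z) (basis x z) (A x z) * entry α′ d′ e′ (b z) (b y) (basis z y) (A z y))
                          ≈ entry α″ d″ e″ (b x) (b y) (basis x y) (A x y)
      product x y = begin
        sum (λ z → entry α d e (b x) (b z) (basis x z) (A x z) * E z y)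
          ≈⟨ sum-cong-≋ (λ z → solve 6 (λ α δ d a e f → (α :* δ :+ d :* a :+ e) :* f := (α :* (δ :* f) :+ d :* (a :* f)) :+ e :* f) refl (α (b x)) (basis x z) (d (b x)) (A x z) (e (b x) (b z)) (E z y)) ⟩
        sum (λ z → (α (b x) * (basis x z * E z y) + d (b x) * (A x z * E z y)) + e (b x) (b z) * E z y)
          ≈⟨ trans (∑-distrib-+ (λ z → α (b x) * (basis x z * E z y) + d (b x) * (A x z * E z y)) (λ z → e (b x) (b z) * E z y))
               (+-congʳ (∑-distrib-+ (λ z → α (b x) * (basis x z * E z y)) (λ z → d (b x) * (A x z * E z y)))) ⟩
        sum (λ z → α (b x) * (basis x z * E z y)) + sum (λ z → d (b x) * (A x z * E z y)) + sum (λ z → e (b x) (b z) * E z y)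
          ≈⟨ +-cong (+-cong
               (trans (sym (*-distribˡ-sum (α (b x)) (λ z → basis x z * E z y))) (*-congˡ (dot-basis x (λ z → E z y))))
               (trans (sym (*-distribˡ-sum (d (b x)) (λ z → A x z * E z y))) (*-congˡ (trans (product-A x y) (+-congʳ (+-congˡ (*-congˡ (square x y))))))))
               (product-e x y) ⟩
        α (b x) * E x y
          + d (b x) * ((α′ (b x) * A x y + d′ (b x) * entry u v S (b x) (b y) (basis x y) (A x y)) + k (b x) * e′ (b x) (b y))
          + ((α′ (b y) * e (b x) (b y) + k (b y) * (e (b x) (b y) * d′ (b y))) + EE (b x) (b y))
          ≈⟨ collect (α (b x)) (d (b x)) (α′ (b x)) (d′ (b x)) (e′ (b x) (b y)) (basis x y) (A x y) (u (b x)) (v (b x)) (S (b x) (b y)) (k (b x)) _ ⟩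
        entry α″ d″ e″ (b x) (b y) (basis x y) (A x y) ∎
        where
        open ≈R
        collect : ∀ α d α′ d′ e′ δ a u v s k t →
          α * (α′ * δ + d′ * a + e′) + d * ((α′ * a + d′ * (u * δ + v * a + s)) + k * e′) + t ≈
          (α * α′ + d * (d′ * u)) * δ + (α * d′ + d * (α′ + d′ * v)) * a + (α * e′ + d * (d′ * s + k * e′) + t)
        collect = solve 12 (λ α d α′ d′ e′ δ a u v s k t →
          α :* (α′ :* δ :+ d′ :* a :+ e′) :+ d :* ((α′ :* a :+ d′ :* (u :* δ :+ v :* a :+ s)) :+ k :* e′) :+ t :=
          (α :* α′ :+ d :* (d′ :* u)) :* δ :+ (α :* d′ :+ d :* (α′ :+ d′ :* v)) :* a :+ (α :* e′ :+ d :* (d′ :* s :+ k :* e′) :+ t)) refl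

    coherent : IsCoherentAlgebra K 𝒜
    coherent = record
      { resp = λ { p (α , d , e , h) → α , d , e , λ x y → trans (sym (p x y)) (h x y) }
      ; I∈   = (λ _ → 1#) , (λ _ → 0#) , (λ _ _ → 0#) , λ x y → solve 2 (λ δ a → δ := :1 :* δ :+ :0 :* a :+ :0) refl (basis x y) (A x y)
      ; J∈   = (λ _ → 0#) , (λ _ → 0#) , (λ _ _ → 1#) , λ x y → solve 2 (λ δ a → :1 := :0 :* δ :+ :0 :* a :+ :1) refl (basis x y) (A x y)
      ; ⊞∈   = λ { (α , d , e , h) (α′ , d′ , e′ , h′) → (λ β → α β + α′ β) , (λ β → d β + d′ β) , (λ β β′ → e β β′ + e′ β β′) , λ x y →
          trans (+-cong (h x y) (h′ x y)) (solve 8 (λ α d e α′ d′ e′ δ a → (α :* δ :+ d :* a :+ e) :+ (α′ :* δ :+ d′ :* a :+ e′) := (α :+ α′) :* δ :+ (d :+ d′) :* a :+ (e :+ e′)) refl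
            (α (b x)) (d (b x)) (e (b x) (b y)) (α′ (b x)) (d′ (b x)) (e′ (b x) (b y)) (basis x y) (A x y)) }
      ; ⊡∈   = λ { s (α , d , e , h) → (λ β → s * α β) , (λ β → s * d β) , (λ β β′ → s * e β β′) , λ x y →
          trans (*-congˡ (h x y)) (solve 6 (λ s α d e δ a → s :* (α :* δ :+ d :* a :+ e) := s :* α :* δ :+ s :* d :* a :+ s :* e) refl s
            (α (b x)) (d (b x)) (e (b x) (b y)) (basis x y) (A x y)) }
      ; ⊠∈   = λ { (α , d , e , h) (α′ , d′ , e′ , h′) → α″ α d e α′ d′ e′ , d″ α d e α′ d′ e′ , e″ α d e α′ d′ e′ , λ x y →
          trans (sum-cong-≋ λ z → *-cong (h x z) (h′ z y)) (product α d e α′ d′ e′ x y) }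
      ; ⊙∈   = λ { (α , d , e , h) (α′ , d′ , e′ , h′) →
          (λ β → α β * α′ β + α β * e′ β β + e β β * α′ β) , (λ β → d β * d′ β + d β * e′ β β + e β β * d′ β) , (λ β β′ → e β β′ * e′ β β′) , λ x y →
          trans (*-cong (h x y) (h′ x y)) (entry-* α d e α′ d′ e′ (position x y)) }
      ; ᵀ∈   = λ { (α , d , e , h) → α , d , (λ β β′ → e β′ β) , λ x y →
          trans (h y x) (trans (+-congʳ (+-cong (*-congˡ (basis-sym y x)) (*-congˡ (A-sym y x)))) (entry-transpose α d e (position x y))) }
      }

  -- The coherent closure of a join of two regular graphs which has three eigenvalues
  -- has rank at most 8: it lies in the coarse algebra.
  module _ {n : ℕ} (Γ : Graph n) (connected : Connected Γ) (ED : ExactlyDistinctEigenvalues K 3 (adjacency K Γ))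
           (b : Fin n → Bool) (join : ∀ x y → b x ≢ b y → Graph.adj Γ x y ≡ true)
           (valency : Bool → HeytingField.Carrier K)
           (valency≈ : ∀ x → HeytingField._≈_ K (sum (adjacency K Γ x)) (valency (b x))) where

    open Graph Γ
    open Within Γ b
    open Symmetric C C-sym

    private
      k : Bool → Carrier
      k β = valency β - sum λ y → 𝟙 K (not (β ≡ᵇ b y))

      regular : ∀ x → deg x ≈ k (b x)
      regular x = begin
        deg x                                              ≈⟨ solve 2 (λ d s → d := (d :+ s) :- s) refl (deg x) (sum (X x)) ⟩
        (deg x + sum (X x)) - sum (X x)                    ≈⟨ +-congʳ (∑-distrib-+ (A x) (X x)) ⟨
        sum (λ y → A x y + X x y) - sum (X x)              ≈⟨ +-congʳ (sum-cong-≋ (adjacency-split join x)) ⟨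
        sum (adjacency K Γ x) - sum (X x)                  ≈⟨ +-congʳ (valency≈ x) ⟩
        k (b x)                                            ∎
        where open ≈R

      module Join′ = Join Γ connected ED b join k regular

    join-rank : ∀ {r} → StandardBasis K (𝒲 K Γ) r → ¬ (8 ℕ.< r)
    join-rank {r} S r>8 = Join′.Side.relation? true λ rel-true → Join′.Side.relation? false λ rel-false → absurd rel-true rel-false
      where
      open Colours (Closure-isCoherent K (adjacency K Γ)) S
      absurd : Join′.Side.Relation true → Join′.Side.Relation false → ⊥
      absurd (u₁ , v₁ , w₁ , rel₁) (u₀ , v₀ , w₀ , rel₀) = same-cell (pigeonhole r>8 (λ l → cell (rx l) (ry l)))
        where
        pick : Carrier → Carrier → Bool → Carrier
        pick s t β = if β then s else t
        relation : ∀ x y → b x ≡ b y → sum (λ z → A x z * A z y) ≈ pick u₁ u₀ (b x) * basis x y + pick v₁ v₀ (b x) * A x y + pick w₁ w₀ (b x)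
        relation x y p = go (b x) (b y) ≡.refl ≡.refl p
          where
          go : ∀ β β′ → b x ≡ β → b y ≡ β′ → β ≡ β′ → sum (λ z → A x z * A z y) ≈ pick u₁ u₀ β * basis x y + pick v₁ v₀ β * A x y + pick w₁ w₀ β
          go true  true  p q _ = rel₁ x y (≡.cong (_≡ᵇ true) p) (≡.cong (_≡ᵇ true) q)
          go false false p q _ = rel₀ x y (≡.cong (_≡ᵇ false) p) (≡.cong (_≡ᵇ false) q)
        open Coarse C C-sym (λ x → ≡.cong (_∧ (b x ≡ᵇ b x)) (loopless x)) b C⇒≡ k regular (pick u₁ u₀) (pick v₁ v₀) (pick w₁ w₀) relation
        adjacency∈ : 𝒜 (adjacency K Γ)
        adjacency∈ = (λ _ → 0#) , (λ _ → 1#) , (λ β β′ → 𝟙 K (not (β ≡ᵇ β′))) , λ x y →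
          trans (Join′.adjacency≈ x y) (solve 3 (λ δ a e → a :+ e := :0 :* δ :+ :1 :* a :+ e) refl (basis x y) (A x y) _)
        rx ry : Fin r → Fin n
        rx l = proj₁ (nonempty l)
        ry l = proj₁ (proj₂ (nonempty l))
        Bl : ∀ l → B l (rx l) (ry l) ≡ true
        Bl l = proj₂ (proj₂ (nonempty l))
        same-cell : (∃[ i ] ∃[ j ] (i < j) × cell (rx i) (ry i) ≡ cell (rx j) (ry j)) → ⊥
        same-cell (i , j , i<j , p) = <⇒≢ i<j (≡.sym (disjoint (Bl j) (≡.trans (≡.sym
          (𝟙-injective (B i (rx i) (ry i)) (B i (rx j) (ry j)) (constant-on-cells (Closure-least K coherent adjacency∈ (member i)) p))) (Bl i)) ))

-- Counting fibres and colours

module Configurations {c ℓ₁ ℓ₂ : Level} (K : HeytingField c ℓ₁ ℓ₂) (char0 : CharacteristicZero K)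
  (closed : AlgebraicallyClosed K) where

  open Field K char0
  open LinearAlgebra K char0
  open Matrices K char0 closed
  open StandardBases K char0
  open CoarseAlgebras K char0 closed

  -- Counting the true values of a predicate on a finite set.
  module Count where
    open SemiringSum ℕₚ.+-*-semiring public using () renaming (sum to sumℕ; sum-permute to sumℕ-permute; ∑-distrib-+ to sumℕ-+; sum-cong-≋ to sumℕ-cong)

    weight : Bool → ℕ
    weight p = if p then 1 else 0

    count : ∀ {m} → (Fin m → Bool) → ℕ
    count p = sumℕ λ k → weight (p k)

    length-filter : ∀ {a p m} {A : Set a} {P : A → Set p} (P? : Decidable P) (f : Fin m → A) →
      length (filter P? (tabulate f)) ≡ count (λ k → does (P? (f k)))
    length-filter {m = zero}  P? f = ≡.refl
    length-filter {m = suc m} P? f with does (P? (f zero))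
    ... | true  = ≡.cong suc (length-filter P? (f ∘ suc))
    ... | false = length-filter P? (f ∘ suc)

    count-cong : ∀ {m} {p q : Fin m → Bool} → (∀ k → p k ≡ q k) → count p ≡ count q
    count-cong h = sumℕ-cong λ k → ≡.cong weight (h k)

    count≥1 : ∀ {m} {p : Fin m → Bool} k → p k ≡ true → 1 ℕ.≤ count p
    count≥1 {p = p} zero    e = ℕₚ.≤-trans (ℕₚ.≤-reflexive (≡.cong weight (≡.sym e))) (ℕₚ.m≤m+n (weight (p zero)) _)
    count≥1 {p = p} (suc k) e = ℕₚ.≤-trans (count≥1 {p = p ∘ suc} k e) (ℕₚ.m≤n+m _ (weight (p zero)))

    count≥2 : ∀ {m} {p : Fin m → Bool} k l → k ≢ l → p k ≡ true → p l ≡ true → 2 ℕ.≤ count p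
    count≥2 zero zero h e f = ⊥-elim (h ≡.refl)
    count≥2 {p = p} zero (suc l) h e f = ℕₚ.+-mono-≤ (ℕₚ.≤-reflexive (≡.cong weight (≡.sym e))) (count≥1 {p = p ∘ suc} l f)
    count≥2 {p = p} (suc k) zero h e f = ℕₚ.+-mono-≤ (ℕₚ.≤-reflexive (≡.cong weight (≡.sym f))) (count≥1 {p = p ∘ suc} k e)
    count≥2 {p = p} (suc k) (suc l) h e f = ℕₚ.≤-trans (count≥2 {p = p ∘ suc} k l (λ q → h (≡.cong suc q)) e f) (ℕₚ.m≤n+m _ (weight (p zero)))

    unique : ∀ {m} {p : Fin m → Bool} → count p ℕ.≤ 1 → ∀ k l → p k ≡ true → p l ≡ true → k ≡ l
    unique {p = p} h k l e f = decide (k ≟ᶠ l)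
      where
      decide : Dec (k ≡ l) → k ≡ l
      decide (yes q) = q
      decide (no q)  = ⊥-elim (ℕₚ.<⇒≱ (count≥2 {p = p} k l q e f) h)

    count≡0 : ∀ {m} {p : Fin m → Bool} → (∀ k → p k ≢ true) → count p ≡ 0
    count≡0 {zero}  h = ≡.refl
    count≡0 {suc m} {p} h = ≡.cong₂ ℕ._+_ (≡.cong weight (¬true⇒false (h zero))) (count≡0 {p = p ∘ suc} (h ∘ suc))

    count≤1 : ∀ {m} {p : Fin m → Bool} → (∀ k l → p k ≡ true → p l ≡ true → k ≡ l) → count p ℕ.≤ 1
    count≤1 {zero}  h = z≤n
    count≤1 {suc m} {p} h = decide (p zero ≟ᵇ true)
      where
      decide : Dec (p zero ≡ true) → count p ℕ.≤ 1
      decide (yes e) = ℕₚ.≤-reflexive (≡.cong₂ ℕ._+_ (≡.cong weight e) (count≡0 {p = p ∘ suc} λ k f → zero≢suc (h zero (suc k) e f)))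
        where
        zero≢suc : ∀ {k : Fin m} → zero ≢ suc k
        zero≢suc ()
      decide (no ¬e) = ≡.subst (ℕ._≤ 1) (≡.cong (λ b → weight b ℕ.+ count (p ∘ suc)) (≡.sym (¬true⇒false ¬e)))
        (count≤1 {p = p ∘ suc} λ k l e f → suc-injective (h (suc k) (suc l) e f))

  open Count

  two-two-three : ∀ a m d → 2 ℕ.≤ a → 2 ℕ.≤ m → 2 ℕ.≤ d → a ℕ.+ m ℕ.+ m ℕ.+ d ≡ 9 →
    m ≡ 2 × (a ≡ 2 × d ≡ 3 ⊎ a ≡ 3 × d ≡ 2)
  two-two-three (suc (suc a)) (suc (suc m)) (suc (suc d)) (s≤s (s≤s _)) (s≤s (s≤s _)) (s≤s (s≤s _)) e =
    go a m d (ℕₚ.+-cancelˡ-≡ 8 _ _ (≡.trans (≡.sym (solveℕ a m d)) e))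
    where
    solveℕ : ∀ a m d → suc (suc a) ℕ.+ suc (suc m) ℕ.+ suc (suc m) ℕ.+ suc (suc d) ≡ 8 ℕ.+ (a ℕ.+ (m ℕ.+ m) ℕ.+ d)
    solveℕ = +-*-Solver.solve 3 (λ a m d → (+-*-Solver.con 2 +-*-Solver.:+ a) +-*-Solver.:+ (+-*-Solver.con 2 +-*-Solver.:+ m) +-*-Solver.:+ (+-*-Solver.con 2 +-*-Solver.:+ m) +-*-Solver.:+ (+-*-Solver.con 2 +-*-Solver.:+ d)
       +-*-Solver.:= +-*-Solver.con 8 +-*-Solver.:+ (a +-*-Solver.:+ (m +-*-Solver.:+ m) +-*-Solver.:+ d)) ≡.refl
    go : ∀ a m d → a ℕ.+ (m ℕ.+ m) ℕ.+ d ≡ 1 → suc (suc m) ≡ 2 × (suc (suc a) ≡ 2 × suc (suc d) ≡ 3 ⊎ suc (suc a) ≡ 3 × suc (suc d) ≡ 2)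
    go zero          zero    d e      = ≡.refl , inj₁ (≡.refl , ≡.cong (λ d → suc (suc d)) e)
    go (suc zero)    zero    zero e   = ≡.refl , inj₂ (≡.refl , ≡.refl)
    go zero          (suc m) d e      with ≡.trans (≡.sym (≡.cong (ℕ._+ d) (ℕₚ.+-suc m m))) (ℕₚ.suc-injective e)
    ... | ()
    go (suc a)       (suc m) d e      with ≡.trans (≡.sym (≡.cong (ℕ._+ d) (ℕₚ.+-suc a (m ℕ.+ suc m)))) (ℕₚ.suc-injective e)
    ... | ()
    go (suc (suc a)) zero    d       ()

  -- The coherent configuration of Γ: the colouring by the standard basis of its closure.
  module Configuration {n r : ℕ} (Γ : Graph n) (S : StandardBasis K (𝒲 K Γ) r) where
    open Graph Γ
    open Colours (Closure-isCoherent K (adjacency K Γ)) S public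

    -- The fibre of x, named by the colour of (x , x).
    fibre : Fin n → Fin r
    fibre x = colour x x

    diagonal-colour : ∀ {x u v} → colour x x ≡ colour u v → u ≡ v
    diagonal-colour {x} {u} {v} p = decide (u ≟ᶠ v) (𝟙-injective ⌊ x ≟ᶠ x ⌋ ⌊ u ≟ᶠ v ⌋ (constant I∈ p))
      where
      decide : (q : Dec (u ≡ v)) → ⌊ x ≟ᶠ x ⌋ ≡ ⌊ q ⌋ → u ≡ v
      decide (yes q) _ = q
      decide (no _)  e = ⊥-elim (absurd (x ≟ᶠ x) e)
        where
        absurd : (q : Dec (x ≡ x)) → ¬ (⌊ q ⌋ ≡ false)
        absurd (yes _) ()
        absurd (no q)  _ = q ≡.refl

    colour-adj : ∀ {x y u v} → colour x y ≡ colour u v → adj x y ≡ adj u v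
    colour-adj {x} {y} {u} {v} p = 𝟙-injective (adj x y) (adj u v) (constant gen p)

    colour-transpose : ∀ {x y u v} → colour x y ≡ colour u v → colour y x ≡ colour v u
    colour-transpose {x} {y} {u} {v} p = ≡.sym (colour-unique (≡.trans
      (≡.sym (𝟙-injective (B (colour y x) y x) (B (colour y x) v u) (constant (ᵀ∈ (member (colour y x))) p))) (B-colour y x)))

    -- Pairs of the same colour are joined by paths of length two of the same colours.
    path : ∀ {x y u v} → colour x y ≡ colour u v → ∀ z →
      ∃[ w ] colour u w ≡ colour x z × colour w v ≡ colour z y
    path {x} {y} {u} {v} p z = decide (any? λ w → (B k u w ≟ᵇ true) ×-dec (B l w v ≟ᵇ true))
      where
      k = colour x z
      l = colour z y
      decide : Dec (∃[ w ] B k u w ≡ true × B l w v ≡ true) → ∃[ w ] colour u w ≡ k × colour w v ≡ l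
      decide (yes (w , e , f)) = w , colour-unique e , colour-unique f
      decide (no ¬p) = ⊥-elim (1≉0 (trans (sym one) (Nat-sum≈0 (λ w → Nat-* (Nat-𝟙 (B k x w)) (Nat-𝟙 (B l w y))) xy≈0 z)))
        where
        one : 𝟙 K (B k x z) * 𝟙 K (B l z y) ≈ 1#
        one = trans (*-cong (reflexive (≡.cong (𝟙 K) (B-colour x z))) (reflexive (≡.cong (𝟙 K) (B-colour z y)))) (*-identityˡ 1#)
        zero-term : ∀ a b → ¬ (a ≡ true × b ≡ true) → 𝟙 K a * 𝟙 K b ≈ 0#
        zero-term true  true  h = ⊥-elim (h (≡.refl , ≡.refl))
        zero-term true  false h = zeroʳ _
        zero-term false b     h = zeroˡ _
        xy≈0 : sum (λ w → 𝟙 K (B k x w) * 𝟙 K (B l w y)) ≈ 0#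
        xy≈0 = trans (constant (⊠∈ (member k) (member l)) p)
          (sum-0 {f = λ w → 𝟙 K (B k u w) * 𝟙 K (B l w v)} λ w → zero-term (B k u w) (B l w v) λ q → ¬p (w , q))

    source : ∀ {x y u v} → colour x y ≡ colour u v → fibre x ≡ fibre u
    source {x} {y} {u} p =
      let w , e , _ = path p x in
      ≡.trans (≡.sym e) (≡.cong (colour u) (≡.sym (diagonal-colour (≡.sym e))))

    target : ∀ {x y u v} → colour x y ≡ colour u v → fibre y ≡ fibre v
    target p = source (colour-transpose p)

    valency-fibre : ∀ {x u} → fibre x ≡ fibre u → sum (adjacency K Γ x) ≈ sum (adjacency K Γ u)
    valency-fibre {x} {u} p = begin
      sum (adjacency K Γ x)                    ≈⟨ sum-cong-≋ (λ z → *-identityʳ (adjacency K Γ x z)) ⟨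
      sum (λ z → adjacency K Γ x z * 1#)       ≈⟨ constant (⊠∈ gen J∈) p ⟩
      sum (λ z → adjacency K Γ u z * 1#)       ≈⟨ sum-cong-≋ (λ z → *-identityʳ (adjacency K Γ u z)) ⟩
      sum (adjacency K Γ u)                    ∎
      where open ≈R

    -- A family of points in distinct fibres.
    Distinct : ∀ {f} → (Fin f → Fin n) → Set
    Distinct p = ∀ i j → fibre (p i) ≡ fibre (p j) → i ≡ j

    extend : ∀ {f} → Fin n → (Fin f → Fin n) → Fin (suc f) → Fin n
    extend x p zero    = x
    extend x p (suc i) = p i

    extend-distinct : ∀ {f} {x} {p : Fin f → Fin n} → Distinct p → (∀ i → fibre x ≢ fibre (p i)) → Distinct (extend x p)
    extend-distinct d h zero    zero    e = ≡.refl
    extend-distinct d h zero    (suc j) e = ⊥-elim (h j e)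
    extend-distinct d h (suc i) zero    e = ⊥-elim (h i (≡.sym e))
    extend-distinct d h (suc i) (suc j) e = ≡.cong suc (d i j e)

    -- A family of points which meets all fibres.
    Covering : ∀ {f} → (Fin f → Fin n) → Set
    Covering p = ∀ x → ∃[ i ] fibre x ≡ fibre (p i)

    covering-or-new : ∀ {f} (p : Fin f → Fin n) → Covering p ⊎ ∃[ x ] ∀ i → fibre x ≢ fibre (p i)
    covering-or-new p = decide (any? λ x → all? λ i → ¬? (fibre x ≟ᶠ fibre (p i)))
      where
      decide : Dec (∃[ x ] ∀ i → fibre x ≢ fibre (p i)) → Covering p ⊎ ∃[ x ] ∀ i → fibre x ≢ fibre (p i)
      decide (yes q) = inj₂ q
      decide (no ¬q) = inj₁ λ x → cover x (any? λ i → fibre x ≟ᶠ fibre (p i))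
        where
        cover : ∀ x → Dec (∃[ i ] fibre x ≡ fibre (p i)) → ∃[ i ] fibre x ≡ fibre (p i)
        cover x (yes e) = e
        cover x (no ¬e) = ⊥-elim (¬q (x , λ i e → ¬e (i , e)))

    pair-colour : ∀ {f} → (Fin f → Fin n) → Fin (f ℕ.* f) → Fin r
    pair-colour {f} p i = colour (p (proj₁ (remQuot {f} f i))) (p (proj₂ (remQuot {f} f i)))

    pair-colour-injective : ∀ {f} {p : Fin f → Fin n} → Distinct p → ∀ i j → pair-colour p i ≡ pair-colour p j → i ≡ j
    pair-colour-injective {f} {p} d i j e = ≡.trans (≡.sym (combine-remQuot {f} f i))
      (≡.trans (≡.cong₂ combine (d _ _ (source e)) (d _ _ (target e))) (combine-remQuot {f} f j))

    distinct-bound : ∀ {f} {p : Fin f → Fin n} → Distinct p → f ℕ.* f ℕ.≤ r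
    distinct-bound {f} {p} d = ℕₚ.≮⇒≥ λ r<ff →
      let i , j , i<j , e = pigeonhole r<ff (pair-colour p) in
      <⇒≢ i<j (pair-colour-injective d i j e)

    -- If there are no more colours than pairs of representatives, the fibres are singletons.
    singletons : ∀ {f} {p : Fin f → Fin n} → Distinct p → r ℕ.≤ f ℕ.* f → ∀ {z i} → fibre z ≡ fibre (p i) → z ≡ p i
    singletons {f} {p} d r≤ff {z} {i} e =
      let a , b , a<b , q = pigeonhole (s≤s r≤ff) colours in go a b a<b q
      where
      colours : Fin (suc (f ℕ.* f)) → Fin r
      colours zero    = colour z (p i)
      colours (suc j) = pair-colour p j
      go : ∀ a b → a < b → colours a ≡ colours b → z ≡ p i
      go (suc a) (suc b) (s≤s a<b) q = ⊥-elim (<⇒≢ a<b (pair-colour-injective d a b q))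
      go zero    (suc b) _         q = diagonal-colour {p i} (≡.sym (≡.trans q (≡.cong₂ (λ s t → colour (p s) (p t))
        (d _ _ (≡.trans (≡.sym (source q)) e)) (d _ _ (≡.sym (target q))))))

    star-leaves : ∀ {x y} → Star (λ u v → T (adj u v)) x y → x ≢ y → ∃[ z ] T (adj x z)
    star-leaves ε       h = ⊥-elim (h ≡.refl)
    star-leaves (t ◅ _) h = _ , t

  -- Coherent rank 9: there are two fibres, and Γ is not a join of two regular graphs.
  module Rank9 {n : ℕ} (Γ : Graph n) (connected : Connected Γ) (ED : ExactlyDistinctEigenvalues K 3 (adjacency K Γ))
               (S : StandardBasis K (𝒲 K Γ) 9) where
    open Graph Γ
    open Configuration Γ S

    no-join : (b : Fin n → Bool) → (∀ x y → b x ≢ b y → adj x y ≡ true) →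
      (d : Bool → Carrier) → (∀ x → sum (adjacency K Γ x) ≈ d (b x)) → ⊥
    no-join b join d d≈ = join-rank Γ connected ED b join d d≈ S ℕₚ.≤-refl

    one-fibre : (p : Fin 1 → Fin n) → ¬ Covering p
    one-fibre p cover = no-join (λ _ → true) (λ x y h → ⊥-elim (h ≡.refl)) (λ _ → sum (adjacency K Γ (p 0F)))
      λ x → valency-fibre (≡.trans (proj₂ (cover x)) (≡.cong (fibre ∘ p) (only (proj₁ (cover x)))))
      where
      only : (i : Fin 1) → i ≡ 0F
      only 0F = ≡.refl

    T⇒≡ : ∀ {b} → T b → b ≡ true
    T⇒≡ {true} _ = ≡.refl

    -- On three points with a point o adjacent to the other two, Γ is the join of o and the
    -- rest.
    no-cherry : ∀ {o x y} → o ≢ x → o ≢ y → x ≢ y → (∀ z → z ≡ o ⊎ z ≡ x ⊎ z ≡ y) →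
      adj o x ≡ true → adj o y ≡ true → ⊥
    no-cherry {o} {x} {y} o≢x o≢y x≢y cover ox oy = no-join b join d d≈
      where
      b : Fin n → Bool
      b z = ⌊ o ≟ᶠ z ⌋
      b-o : b o ≡ true
      b-o = go (o ≟ᶠ o)
        where
        go : (q : Dec (o ≡ o)) → ⌊ q ⌋ ≡ true
        go (yes _) = ≡.refl
        go (no q)  = ⊥-elim (q ≡.refl)
      b-off : ∀ {z} → o ≢ z → b z ≡ false
      b-off {z} h = go (o ≟ᶠ z)
        where
        go : (q : Dec (o ≡ z)) → ⌊ q ⌋ ≡ false
        go (yes q) = ⊥-elim (h q)
        go (no _)  = ≡.refl
      join : ∀ z w → b z ≢ b w → adj z w ≡ true
      join z w h = go (cover z) (cover w)
        where
        go : z ≡ o ⊎ z ≡ x ⊎ z ≡ y → w ≡ o ⊎ w ≡ x ⊎ w ≡ y → adj z w ≡ true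
        go (inj₁ ≡.refl) (inj₁ ≡.refl) = ⊥-elim (h ≡.refl)
        go (inj₁ ≡.refl) (inj₂ (inj₁ ≡.refl)) = ox
        go (inj₁ ≡.refl) (inj₂ (inj₂ ≡.refl)) = oy
        go (inj₂ (inj₁ ≡.refl)) (inj₁ ≡.refl) = ≡.trans (adj-sym x o) ox
        go (inj₂ (inj₂ ≡.refl)) (inj₁ ≡.refl) = ≡.trans (adj-sym y o) oy
        go (inj₂ (inj₁ ≡.refl)) (inj₂ (inj₁ ≡.refl)) = ⊥-elim (h ≡.refl)
        go (inj₂ (inj₁ ≡.refl)) (inj₂ (inj₂ ≡.refl)) = ⊥-elim (h (≡.trans (b-off o≢x) (≡.sym (b-off o≢y))))
        go (inj₂ (inj₂ ≡.refl)) (inj₂ (inj₁ ≡.refl)) = ⊥-elim (h (≡.trans (b-off o≢y) (≡.sym (b-off o≢x))))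
        go (inj₂ (inj₂ ≡.refl)) (inj₂ (inj₂ ≡.refl)) = ⊥-elim (h ≡.refl)
      d : Bool → Carrier
      d true  = sum (adjacency K Γ o)
      d false = 1# + 𝟙 K (adj x y)
      basis≈ : ∀ {e z : Fin n} → e ≡ z → basis e z ≈ 1#
      basis≈ {e} ≡.refl = go (e ≟ᶠ e)
        where
        go : (q : Dec (e ≡ e)) → 𝟙 K ⌊ q ⌋ ≈ 1#
        go (yes _) = refl
        go (no q)  = ⊥-elim (q ≡.refl)
      basis≈0 : ∀ {e z : Fin n} → e ≢ z → basis e z ≈ 0#
      basis≈0 {e} {z} h = go (e ≟ᶠ z)
        where
        go : (q : Dec (e ≡ z)) → 𝟙 K ⌊ q ⌋ ≈ 0#
        go (yes q) = ⊥-elim (h q)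
        go (no _)  = refl
      -- The valency of s, where t is the third point.
      leaf : ∀ s t → o ≢ s → o ≢ t → s ≢ t → (∀ z → z ≡ o ⊎ z ≡ s ⊎ z ≡ t) → adj o s ≡ true →
        sum (adjacency K Γ s) ≈ 1# + 𝟙 K (adj s t)
      leaf s t o≢s o≢t s≢t cover os = begin
        sum (adjacency K Γ s)                          ≈⟨ sum-⊕ (basis o) (a ⊛ basis t) (λ z → term z (cover z)) ⟩
        sum (basis o) + sum (a ⊛ basis t)              ≈⟨ +-cong (sum-basis o) (trans (sym (*-distribˡ-sum a (basis t))) (trans (*-congˡ (sum-basis t)) (*-identityʳ a))) ⟩
        1# + a                                         ∎
        where
        open ≈R
        a = 𝟙 K (adj s t)
        term : ∀ z → z ≡ o ⊎ z ≡ s ⊎ z ≡ t → 𝟙 K (adj s z) ≈ basis o z + a * basis t z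
        term z (inj₁ ≡.refl) = trans (reflexive (≡.cong (𝟙 K) (≡.trans (adj-sym s z) os)))
          (sym (trans (+-cong (basis≈ {z} {z} ≡.refl) (trans (*-congˡ (basis≈0 (λ q → o≢t (≡.sym q)))) (zeroʳ a))) (+-identityʳ 1#)))
        term z (inj₂ (inj₁ ≡.refl)) = trans (reflexive (≡.cong (𝟙 K) (loopless z)))
          (sym (trans (+-cong (basis≈0 o≢s) (trans (*-congˡ (basis≈0 (λ q → s≢t (≡.sym q)))) (zeroʳ a))) (+-identityʳ 0#)))
        term z (inj₂ (inj₂ ≡.refl)) = sym (trans (+-cong (basis≈0 o≢t) (trans (*-congˡ (basis≈ {z} {z} ≡.refl)) (*-identityʳ a))) (+-identityˡ a))
      swap : ∀ {a b c : Set} → a ⊎ b ⊎ c → a ⊎ c ⊎ b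
      swap (inj₁ p) = inj₁ p
      swap (inj₂ (inj₁ p)) = inj₂ (inj₂ p)
      swap (inj₂ (inj₂ p)) = inj₂ (inj₁ p)
      d≈ : ∀ z → sum (adjacency K Γ z) ≈ d (b z)
      d≈ z = go (cover z)
        where
        go : z ≡ o ⊎ z ≡ x ⊎ z ≡ y → sum (adjacency K Γ z) ≈ d (b z)
        go (inj₁ ≡.refl) = reflexive (≡.cong d (≡.sym b-o))
        go (inj₂ (inj₁ ≡.refl)) = trans (leaf x y o≢x o≢y x≢y cover ox) (reflexive (≡.cong d (≡.sym (b-off o≢x))))
        go (inj₂ (inj₂ ≡.refl)) = trans (leaf y x o≢y o≢x (λ q → x≢y (≡.sym q)) (swap ∘ cover) oy)
          (trans (+-congˡ (reflexive (≡.cong (𝟙 K) (adj-sym y x)))) (reflexive (≡.cong d (≡.sym (b-off o≢y)))))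

    -- Three fibres are singletons, and a connected graph on three points has a vertex
    -- adjacent to both others.
    three-fibres : (p : Fin 3 → Fin n) → Distinct p → ¬ Covering p
    three-fibres p distinct covering = go (adj x₀ x₁ ≟ᵇ true) (adj x₀ x₂ ≟ᵇ true) (adj x₁ x₂ ≟ᵇ true)
      where
      x₀ x₁ x₂ : Fin n
      x₀ = p 0F
      x₁ = p 1F
      x₂ = p 2F
      p-inj : ∀ {i j} → i ≢ j → p i ≢ p j
      p-inj h e = h (distinct _ _ (≡.cong fibre e))
      cover : ∀ z → z ≡ x₀ ⊎ z ≡ x₁ ⊎ z ≡ x₂
      cover z = at (covering z)
        where
        at : (∃[ i ] fibre z ≡ fibre (p i)) → z ≡ x₀ ⊎ z ≡ x₁ ⊎ z ≡ x₂
        at (0F , e) = inj₁ (singletons distinct ℕₚ.≤-refl e)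
        at (1F , e) = inj₂ (inj₁ (singletons distinct ℕₚ.≤-refl e))
        at (2F , e) = inj₂ (inj₂ (singletons distinct ℕₚ.≤-refl e))
      isolated : ∀ {x} y → x ≢ y → (∀ z → z ≡ x₀ ⊎ z ≡ x₁ ⊎ z ≡ x₂ → adj x z ≢ true) → ⊥
      isolated {x} y h none = let z , t = star-leaves (connected x y) h in none z (cover z) (T⇒≡ t)
      01≢ : x₀ ≢ x₁
      01≢ = p-inj λ ()
      02≢ : x₀ ≢ x₂
      02≢ = p-inj λ ()
      12≢ : x₁ ≢ x₂
      12≢ = p-inj λ ()
      loop : ∀ {x} → adj x x ≢ true
      loop {x} e = false≢true (≡.trans (≡.sym (loopless x)) e)
        where
        false≢true : false ≢ true
        false≢true ()
      flip : ∀ {x y} → adj x y ≢ true → adj y x ≢ true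
      flip {x} {y} h e = h (≡.trans (adj-sym x y) e)
      go : Dec (adj x₀ x₁ ≡ true) → Dec (adj x₀ x₂ ≡ true) → Dec (adj x₁ x₂ ≡ true) → ⊥
      go (yes e) (yes f) _       = no-cherry 01≢ 02≢ 12≢ cover e f
      go (yes e) _       (yes g) = no-cherry (01≢ ∘ ≡.sym) 12≢ 02≢ cover₁ (≡.trans (adj-sym x₁ x₀) e) g
        where
        cover₁ : ∀ z → z ≡ x₁ ⊎ z ≡ x₀ ⊎ z ≡ x₂
        cover₁ z with cover z
        ... | inj₁ q        = inj₂ (inj₁ q)
        ... | inj₂ (inj₁ q) = inj₁ q
        ... | inj₂ (inj₂ q) = inj₂ (inj₂ q)
      go _       (yes f) (yes g) = no-cherry (02≢ ∘ ≡.sym) (12≢ ∘ ≡.sym) 01≢ cover₂ (≡.trans (adj-sym x₂ x₀) f) (≡.trans (adj-sym x₂ x₁) g)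
        where
        cover₂ : ∀ z → z ≡ x₂ ⊎ z ≡ x₀ ⊎ z ≡ x₁
        cover₂ z with cover z
        ... | inj₁ q        = inj₂ (inj₁ q)
        ... | inj₂ (inj₁ q) = inj₂ (inj₂ q)
        ... | inj₂ (inj₂ q) = inj₁ q
      go (no e) (no f) _ = isolated x₁ 01≢ λ
        { z (inj₁ ≡.refl) → loop ; z (inj₂ (inj₁ ≡.refl)) → e ; z (inj₂ (inj₂ ≡.refl)) → f }
      go (no e) _ (no g) = isolated x₂ 12≢ λ
        { z (inj₁ ≡.refl) → flip e ; z (inj₂ (inj₁ ≡.refl)) → loop ; z (inj₂ (inj₂ ≡.refl)) → g }
      go _ (no f) (no g) = isolated x₀ (02≢ ∘ ≡.sym) λ
        { z (inj₁ ≡.refl) → flip f ; z (inj₂ (inj₁ ≡.refl)) → flip g ; z (inj₂ (inj₂ ≡.refl)) → loop }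

    module TwoFibres (p : Fin 2 → Fin n) (distinct : Distinct p) (covering : Covering p) where

      side : Fin n → Fin 2
      side x = proj₁ (covering x)

      fibre-side : ∀ x → fibre x ≡ fibre (p (side x))
      fibre-side x = proj₂ (covering x)

      side-unique : ∀ {x i} → fibre x ≡ fibre (p i) → side x ≡ i
      side-unique {x} {i} e = distinct (side x) i (≡.trans (≡.sym (fibre-side x)) e)

      side-fibre : ∀ {x i} → side x ≡ i → fibre x ≡ fibre (p i)
      side-fibre {x} e = ≡.trans (fibre-side x) (≡.cong (fibre ∘ p) e)

      side-cong : ∀ {x y} → fibre x ≡ fibre y → side x ≡ side y
      side-cong {x} {y} e = side-unique (≡.trans e (fibre-side y))

      fibres : Fibres B 2
      fibres = record
        { index      = fibre ∘ p
        ; injective  = λ {i} {j} → distinct i j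
        ; diagonal   = λ i x y e → diagonal-colour {p i} (≡.sym (colour-unique e))
        ; exhaustive = λ k diag →
            let x , y , e = nonempty k
                e′ = ≡.subst (λ y → B k x y ≡ true) (≡.sym (diag x y e)) e
                i , f = covering x
            in i , ≡.trans (≡.sym f) (colour-unique e′)
        }

      open Fibres fibres using (t; SupportedIn; supportedIn?)

      -- representatives of the colours
      rx ry : Fin 9 → Fin n
      rx k = proj₁ (nonempty k)
      ry k = proj₁ (proj₂ (nonempty k))

      colour-rep : ∀ k → colour (rx k) (ry k) ≡ k
      colour-rep k = colour-unique (proj₂ (proj₂ (nonempty k)))

      -- The colours from fibre i to fibre j, in terms of the representatives.
      From : Fin 2 → Fin 2 → Fin 9 → Set
      From i j k = side (rx k) ≡ i × side (ry k) ≡ j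

      from? : ∀ i j k → Dec (From i j k)
      from? i j k = (side (rx k) ≟ᶠ i) ×-dec (side (ry k) ≟ᶠ j)

      supported⇒from : ∀ {i j k} → SupportedIn i j k → From i j k
      supported⇒from {i} {j} {k} h =
        let e , f = h (rx k) (ry k) (proj₂ (proj₂ (nonempty k))) in
        side-unique (colour-unique e) , side-unique (colour-unique f)

      from⇒supported : ∀ {i j k} → From i j k → SupportedIn i j k
      from⇒supported {i} {j} {k} (e , f) x y h =
        ≡.subst (λ l → B l x x ≡ true) (≡.trans (source same) (side-fibre e)) (B-colour x x) ,
        ≡.subst (λ l → B l y y ≡ true) (≡.trans (target same) (side-fibre f)) (B-colour y y)
        where
        same : colour x y ≡ colour (rx k) (ry k)
        same = ≡.trans (colour-unique h) (≡.sym (colour-rep k))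

      from : Fin 2 → Fin 2 → Fin 9 → Bool
      from i j k = does (from? i j k)

      t≡count : ∀ i j → t i j ≡ count (from i j)
      t≡count i j = ≡.trans (length-filter (supportedIn? i j) id)
        (count-cong {p = λ k → does (supportedIn? i j k)} λ k → does-⇔ (mk⇔ supported⇒from from⇒supported) (supportedIn? i j k) (from? i j k))

      from-true : ∀ {i j k} → From i j k → from i j k ≡ true
      from-true {i} {j} {k} h = go (from? i j k)
        where
        go : (q : Dec (From i j k)) → does q ≡ true
        go (yes _) = ≡.refl
        go (no q)  = ⊥-elim (q h)

      true-from : ∀ {i j k} → from i j k ≡ true → From i j k
      true-from {i} {j} {k} = go (from? i j k)
        where
        go : (q : Dec (From i j k)) → does q ≡ true → From i j k
        go (yes q) _ = q

      from-colour : ∀ {i j x y} → side x ≡ i → side y ≡ j → from i j (colour x y) ≡ true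
      from-colour {x = x} {y} e f = from-true
        ( ≡.trans (side-cong (source (colour-rep (colour x y)))) e
        , ≡.trans (side-cong (target (colour-rep (colour x y)))) f )

      total-count : count (from 0F 0F) ℕ.+ count (from 0F 1F) ℕ.+ count (from 1F 0F) ℕ.+ count (from 1F 1F) ≡ 9
      total-count = ≡.trans (≡.sym (≡.trans (sumℕ-+ (λ k → w 0F 0F k ℕ.+ w 0F 1F k ℕ.+ w 1F 0F k) (w 1F 1F))
        (≡.cong (ℕ._+ count (from 1F 1F)) (≡.trans (sumℕ-+ (λ k → w 0F 0F k ℕ.+ w 0F 1F k) (w 1F 0F))
        (≡.cong (ℕ._+ count (from 1F 0F)) (sumℕ-+ (w 0F 0F) (w 0F 1F)))))))
        (sumℕ-cong λ k → one (side (rx k)) (side (ry k)))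
        where
        w : Fin 2 → Fin 2 → Fin 9 → ℕ
        w i j k = weight (from i j k)
        v : Fin 2 → Fin 2 → Fin 2 → Fin 2 → ℕ
        v s t i j = weight (does ((s ≟ᶠ i) ×-dec (t ≟ᶠ j)))
        one : ∀ s t → v s t 0F 0F ℕ.+ v s t 0F 1F ℕ.+ v s t 1F 0F ℕ.+ v s t 1F 1F ≡ 1
        one 0F 0F = ≡.refl
        one 0F 1F = ≡.refl
        one 1F 0F = ≡.refl
        one 1F 1F = ≡.refl

      transposed : Fin 9 → Fin 9
      transposed k = colour (ry k) (rx k)

      transposed² : ∀ k → transposed (transposed k) ≡ k
      transposed² k = ≡.trans (colour-transpose (colour-rep (transposed k))) (colour-rep k)

      count-sym : count (from 0F 1F) ≡ count (from 1F 0F)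
      count-sym = ≡.trans (sumℕ-permute (λ k → weight (from 0F 1F k)) (permutation transposed transposed transposed² transposed²))
        (count-cong {p = from 0F 1F ∘ transposed} λ k → does-⇔ (mk⇔
          (λ (e , f) → ≡.trans (≡.sym (side-cong (target (colour-rep (transposed k))))) f , ≡.trans (≡.sym (side-cong (source (colour-rep (transposed k))))) e)
          (λ (e , f) → ≡.trans (side-cong (source (colour-rep (transposed k)))) f , ≡.trans (side-cong (target (colour-rep (transposed k)))) e))
          (from? 0F 1F (transposed k)) (from? 1F 0F k))

      -- With one colour between the fibres, adjacency between them is constant, and true by
      -- connectedness: Γ is a join of two regular graphs.
      off-diagonal : 2 ℕ.≤ count (from 0F 1F)
      off-diagonal = ℕₚ.≰⇒> λ c≤1 → no-join (λ x → ⌊ side x ≟ᶠ 0F ⌋) (join c≤1) (λ β → sum (adjacency K Γ (p (if β then 0F else 1F)))) valencies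
        where
        crossing : ∀ {x y} → Star (λ u v → T (adj u v)) x y → side x ≡ 0F → side y ≡ 1F →
          ∃[ u ] ∃[ v ] side u ≡ 0F × side v ≡ 1F × adj u v ≡ true
        crossing ε e f with ≡.trans (≡.sym e) f
        ... | ()
        crossing {x} (_◅_ {j = z} h s) e f = go (side z) ≡.refl
          where
          go : ∀ i → side z ≡ i → ∃[ u ] ∃[ v ] side u ≡ 0F × side v ≡ 1F × adj u v ≡ true
          go 0F q = crossing s q f
          go 1F q = x , z , e , q , T⇒≡ h
        across : count (from 0F 1F) ℕ.≤ 1 → ∀ x y → side x ≡ 0F → side y ≡ 1F → adj x y ≡ true
        across c≤1 x y e f =
          let u , v , e′ , f′ , a = crossing (connected (p 0F) (p 1F)) (side-unique ≡.refl) (side-unique ≡.refl) in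
          ≡.trans (colour-adj (unique {p = from 0F 1F} c≤1 _ _ (from-colour e f) (from-colour e′ f′))) a
        join : count (from 0F 1F) ℕ.≤ 1 → ∀ x y → ⌊ side x ≟ᶠ 0F ⌋ ≢ ⌊ side y ≟ᶠ 0F ⌋ → adj x y ≡ true
        join c≤1 x y h = go (side x) (side y) ≡.refl ≡.refl h
          where
          go : ∀ i j → side x ≡ i → side y ≡ j → ⌊ i ≟ᶠ 0F ⌋ ≢ ⌊ j ≟ᶠ 0F ⌋ → adj x y ≡ true
          go 0F 0F e f h = ⊥-elim (h ≡.refl)
          go 0F 1F e f h = across c≤1 x y e f
          go 1F 0F e f h = ≡.trans (adj-sym x y) (across c≤1 y x f e)
          go 1F 1F e f h = ⊥-elim (h ≡.refl)
        valencies : ∀ x → sum (adjacency K Γ x) ≈ sum (adjacency K Γ (p (if ⌊ side x ≟ᶠ 0F ⌋ then 0F else 1F)))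
        valencies x = valency-fibre (≡.trans (fibre-side x) (≡.cong (fibre ∘ p) (≡.sym (lem (side x)))))
          where
          lem : ∀ i → (if ⌊ i ≟ᶠ 0F ⌋ then 0F else 1F) ≡ i
          lem 0F = ≡.refl
          lem 1F = ≡.refl

      -- A fibre with one colour inside is a single point, and then there is one colour from
      -- it to fibre j: by path, that colour does not depend on the point of fibre j.
      on-diagonal : ∀ i j → 2 ℕ.≤ count (from i j) → 2 ℕ.≤ count (from i i)
      on-diagonal i j 2≤ = ℕₚ.≰⇒> λ c≤1 → ℕₚ.<⇒≱ 2≤ (count≤1 {p = from i j} λ k l e f → same c≤1 (true-from e) (true-from f))
        where
        point : count (from i i) ℕ.≤ 1 → ∀ {x x′} → side x ≡ i → side x′ ≡ i → x ≡ x′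
        point c≤1 {x} {x′} e e′ = diagonal-colour (unique {p = from i i} c≤1 (colour x x) (colour x x′) (from-colour e e) (from-colour e e′))
        same : count (from i i) ℕ.≤ 1 → ∀ {k l} → From i j k → From i j l → k ≡ l
        same c≤1 {k} {l} (e , f) (e′ , f′) =
          let z , _ , q = path (≡.trans (side-fibre f) (≡.sym (side-fibre f′))) (rx k)
              z≡ = point c≤1 (≡.trans (side-cong (source q)) e) e′
          in ≡.trans (≡.sym (colour-rep k)) (≡.trans (≡.sym q) (≡.trans (≡.cong (λ z → colour z (ry l)) z≡) (colour-rep l)))

      counts : t 0F 1F ≡ 2 × t 1F 0F ≡ 2 × (t 0F 0F ≡ 2 × t 1F 1F ≡ 3 ⊎ t 0F 0F ≡ 3 × t 1F 1F ≡ 2)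
      counts = finish (two-two-three _ _ _ (on-diagonal 0F 1F off-diagonal) off-diagonal
        (on-diagonal 1F 0F (≡.subst (2 ℕ.≤_) count-sym off-diagonal))
        (≡.trans (≡.cong (λ m → count (from 0F 0F) ℕ.+ count (from 0F 1F) ℕ.+ m ℕ.+ count (from 1F 1F)) count-sym) total-count))
        where
        finish : count (from 0F 1F) ≡ 2 × (count (from 0F 0F) ≡ 2 × count (from 1F 1F) ≡ 3 ⊎ count (from 0F 0F) ≡ 3 × count (from 1F 1F) ≡ 2) →
          t 0F 1F ≡ 2 × t 1F 0F ≡ 2 × (t 0F 0F ≡ 2 × t 1F 1F ≡ 3 ⊎ t 0F 0F ≡ 3 × t 1F 1F ≡ 2)
        finish (m , q) = ≡.trans (t≡count 0F 1F) m , ≡.trans (t≡count 1F 0F) (≡.trans (≡.sym count-sym) m) , split q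
          where
          split : count (from 0F 0F) ≡ 2 × count (from 1F 1F) ≡ 3 ⊎ count (from 0F 0F) ≡ 3 × count (from 1F 1F) ≡ 2 →
            t 0F 0F ≡ 2 × t 1F 1F ≡ 3 ⊎ t 0F 0F ≡ 3 × t 1F 1F ≡ 2
          split (inj₁ (a , d)) = inj₁ (≡.trans (t≡count 0F 0F) a , ≡.trans (t≡count 1F 1F) d)
          split (inj₂ (a , d)) = inj₂ (≡.trans (t≡count 0F 0F) a , ≡.trans (t≡count 1F 1F) d)

    Goal : Set (c ⊔ ℓ₁)
    Goal = HasType K (𝒲 K Γ) ((2 ∷ 2 ∷ []) ∷ (2 ∷ 3 ∷ []) ∷ [])

    has-type : (F : Fibres B 2) → Fibres.t F 0F 0F ≡ 2 → Fibres.t F 0F 1F ≡ 2 →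
      Fibres.t F 1F 0F ≡ 2 → Fibres.t F 1F 1F ≡ 3 → Goal
    has-type F a b c d = 9 , S , F , λ { 0F 0F → a ; 0F 1F → b ; 1F 0F → c ; 1F 1F → d }

    two-fibres : (p : Fin 2 → Fin n) → Distinct p → Covering p → Goal
    two-fibres p distinct covering = go counts
      where
      open TwoFibres p distinct covering
      swap : Fin 2 → Fin 2
      swap 0F = 1F
      swap 1F = 0F
      swap² : ∀ i → swap (swap i) ≡ i
      swap² 0F = ≡.refl
      swap² 1F = ≡.refl
      module Swapped = TwoFibres (p ∘ swap)
        (λ i j e → ≡.trans (≡.sym (swap² i)) (≡.trans (≡.cong swap (distinct _ _ e)) (swap² j)))
        (λ x → swap (side x) , ≡.trans (fibre-side x) (≡.cong (fibre ∘ p) (≡.sym (swap² (side x)))))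
      open Fibres fibres using (t)
      t-swap : ∀ i j i′ j′ → swap i ≡ i′ → swap j ≡ j′ → ∀ {m} → t i′ j′ ≡ m → Fibres.t Swapped.fibres i j ≡ m
      t-swap i j i′ j′ p q h = ≡.trans (Swapped.t≡count i j) (≡.trans
        (count-cong {p = Swapped.from i j} λ k → does-⇔ (mk⇔
          (λ (e , f) → ≡.trans (≡.sym (swap² _)) (≡.trans (≡.cong swap e) p) , ≡.trans (≡.sym (swap² _)) (≡.trans (≡.cong swap f) q))
          (λ (e , f) → ≡.trans (≡.cong swap (≡.trans e (≡.sym p))) (swap² i) , ≡.trans (≡.cong swap (≡.trans f (≡.sym q))) (swap² j)))
          (Swapped.from? i j k) (from? i′ j′ k))
        (≡.trans (≡.sym (t≡count i′ j′)) h))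
      go : t 0F 1F ≡ 2 × t 1F 0F ≡ 2 × (t 0F 0F ≡ 2 × t 1F 1F ≡ 3 ⊎ t 0F 0F ≡ 3 × t 1F 1F ≡ 2) → Goal
      go (b , c , inj₁ (a , d)) = has-type fibres a b c d
      go (b , c , inj₂ (a , d)) = has-type Swapped.fibres
        (t-swap 0F 0F 1F 1F ≡.refl ≡.refl d) (t-swap 0F 1F 1F 0F ≡.refl ≡.refl c)
        (t-swap 1F 0F 0F 1F ≡.refl ≡.refl b) (t-swap 1F 1F 0F 0F ≡.refl ≡.refl a)

    type-2-2-3 : Goal
    type-2-2-3 = one (covering-or-new p₁)
      where
      p₁ : Fin 1 → Fin n
      p₁ _ = proj₁ (nonempty 0F)
      d₁ : Distinct p₁
      d₁ 0F 0F _ = ≡.refl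
      one : Covering p₁ ⊎ (∃[ x ] ∀ i → fibre x ≢ fibre (p₁ i)) → Goal
      one (inj₁ cover)   = ⊥-elim (one-fibre p₁ cover)
      one (inj₂ (x , h)) = two (covering-or-new p₂)
        where
        p₂ : Fin 2 → Fin n
        p₂ = extend x p₁
        d₂ : Distinct p₂
        d₂ = extend-distinct d₁ h
        two : Covering p₂ ⊎ (∃[ x ] ∀ i → fibre x ≢ fibre (p₂ i)) → Goal
        two (inj₁ cover)    = two-fibres p₂ d₂ cover
        two (inj₂ (y , h′)) = three (covering-or-new p₃)
          where
          p₃ : Fin 3 → Fin n
          p₃ = extend y p₂
          d₃ : Distinct p₃
          d₃ = extend-distinct d₂ h′
          three : Covering p₃ ⊎ (∃[ x ] ∀ i → fibre x ≢ fibre (p₃ i)) → Goal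
          three (inj₁ cover)    = ⊥-elim (three-fibres p₃ d₃ cover)
          three (inj₂ (z , h″)) = ⊥-elim (ℕₚ.<⇒≱ {9} {16} (ℕₚ.m≤m+n 10 6) (distinct-bound (extend-distinct {x = z} d₃ h″)))

theorem5p6 : ∀ {c ℓ₁ ℓ₂} (K : HeytingField c ℓ₁ ℓ₂) → AlgebraicallyClosed K → CharacteristicZero K →
    ∀ {n : ℕ} (Γ : Graph n) → 𝒢₃ K Γ → HasCoherentRank K Γ 9 →
    HasType K (𝒲 K Γ) ((2 ∷ 2 ∷ []) ∷ (2 ∷ 3 ∷ []) ∷ [])
theorem5p6 K closed char0 Γ (connected , eigenvalues) S =
  Configurations.Rank9.type-2-2-3 K char0 closed Γ connected eigenvalues S
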